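{- Let $G$ be an $n$-vertex graph with minimum cut value $c$, and suppose that each edge of $G$ fails independently with probability $p$, where $p^c=n^{ -(2+\delta)}$ for some $\delta>0$. Then: (1) the probability that $G$ becomes disconnected is at most $n^{ -\delta}(1+2/\delta)$; and (2) for every $\alpha\ge 1$, the probability that some cut of $G$ of value $\alpha c$ or greater fails is at most $n^{ -\alpha\delta}(1+2/\delta)$.
   Context: Graphs are undirected; parallel edges are allowed. A cut is a partition of the vertex set into two nonempty groups; its edges are the edges with one endpoint in each group, and its value is the number of its edges. The minimum cut value $c$ is the smallest value of any cut. A cut fails if all of its edges fail (are deleted). The graph becomes disconnected if the surviving edges do not connect all the vertices. -}

module Defs where

open import Data.Bool.Base using (true; false; if_then_else_; _xor_)
open import Data.Bool.Properties using (¬-not)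
open import Data.Fin.Base using (Fin; zero; suc)
open import Data.Fin.Properties using (any?)
open import Data.Fin.Subset as Subset
  using (Subset; inside; outside; _∈_; _∉_; _⊆_; _⊃_; _∪_; ⁅_⁆; ∁; Nonempty)
open import Data.Fin.Subset.Induction using (Acc; acc; ⊃-wellFounded)
open import Data.Fin.Subset.Properties
  using (_∈?_; nonempty?; x∈⁅x⁆; x∈⁅y⁆⇒x≡y; x∈∁p⇒x∉p; x∉∁p⇒x∈p; p⊆p∪q; q⊆p∪q; x∈p∪q⁻)
open import Data.Integer.Base as ℤ using (ℤ; -[1+_])
import Data.Integer.Properties as ℤₚ
open import Data.Nat.Base as ℕ using (ℕ; zero; suc)
import Data.Nat.Properties as ℕₚ
open import Data.Nat.Solver using () renaming (module +-*-Solver to ℕ-Solver)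
open import Data.Product.Base using (∃; _×_; _,_; proj₁; proj₂)
open import Data.Rational.Base as ℚ using (ℚ; 0ℚ; 1ℚ; ½; mkℚ; toℚᵘ) hiding (module ℚ)
import Data.Rational.Properties as ℚₚ
open import Data.Rational.Solver using (module +-*-Solver)
import Data.Rational.Unnormalised.Base as ℚᵘ
import Data.Rational.Unnormalised.Properties as ℚᵘₚ
open import Data.Sum.Base using (_⊎_; inj₁; inj₂; [_,_]′)
open import Data.Vec.Base using ([]; _∷_; lookup; tabulate)
open import Data.Vec.Properties using ([]=⇒lookup; lookup⇒[]=; lookup∘tabulate)
open import Level using (0ℓ)
open import Relation.Binary.Construct.Closure.Equivalence as EqClosure using (EqClosure)
open import Relation.Binary.Construct.Closure.ReflexiveTransitive using (_◅◅_)
open import Relation.Binary.Core using (Rel)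
open import Relation.Binary.PropositionalEquality
open import Relation.Nullary using (¬_; does; yes; no; ¬?; contradiction)
open import Relation.Nullary.Decidable using (_×-dec_; decidable-stable)
open import Relation.Unary using (Pred; Decidable)

module RationalLemmas where
  open ℚ using (_+_; _*_; _-_; -_; _≤_; _<_; ∣_∣; 1/_)
  open +-*-Solver using (solve; _:+_; _:*_; _:-_; :-_; _:=_; con)

  fromℕ : ℕ → ℚ
  fromℕ n = ℤ.+ n ℚ./ 1

  1/suc : ℕ → ℚ
  1/suc k = ℤ.+ 1 ℚ./ suc k

  fromℕ-suc : ∀ n → fromℕ (suc n) ≡ 1ℚ + fromℕ n
  fromℕ-suc n = ℚₚ.toℚᵘ-injective (begin
    toℚᵘ (fromℕ (suc n))          ≈⟨ ℚₚ.toℚᵘ-fromℚᵘ (ℚᵘ.mkℚᵘ (ℤ.+ suc n) 0) ⟩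
    ℚᵘ.mkℚᵘ (ℤ.+ suc n) 0           ≈⟨ ℚᵘ.*≡* (cong (ℤ._* ℤ.+ 1) (cong (ℤ._+_ (ℤ.+ 1)) (sym (ℤₚ.*-identityʳ (ℤ.+ n))))) ⟩
    ℚᵘ.1ℚᵘ ℚᵘ.+ ℚᵘ.mkℚᵘ (ℤ.+ n) 0   ≈⟨ ℚᵘₚ.+-congʳ ℚᵘ.1ℚᵘ (ℚₚ.toℚᵘ-fromℚᵘ (ℚᵘ.mkℚᵘ (ℤ.+ n) 0)) ⟨
    toℚᵘ 1ℚ ℚᵘ.+ toℚᵘ (fromℕ n)   ≈⟨ ℚₚ.toℚᵘ-homo-+ 1ℚ (fromℕ n) ⟨
    toℚᵘ (1ℚ + fromℕ n) ∎)
    where open ℚᵘₚ.≃-Reasoning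

  fromℕ-mono : ∀ {m n} → m ℕ.≤ n → fromℕ m ≤ fromℕ n
  fromℕ-mono {m} {n} m≤n = ℚₚ.toℚᵘ-cancel-≤ (begin
    toℚᵘ (fromℕ m)       ≃⟨ ℚₚ.toℚᵘ-fromℚᵘ (ℚᵘ.mkℚᵘ (ℤ.+ m) 0) ⟩
    ℚᵘ.mkℚᵘ (ℤ.+ m) 0      ≤⟨ ℚᵘ.*≤* (ℤₚ.*-monoʳ-≤-nonNeg (ℤ.+ 1) (ℤ.+≤+ m≤n)) ⟩
    ℚᵘ.mkℚᵘ (ℤ.+ n) 0      ≃⟨ ℚₚ.toℚᵘ-fromℚᵘ (ℚᵘ.mkℚᵘ (ℤ.+ n) 0) ⟨
    toℚᵘ (fromℕ n) ∎)
    where open ℚᵘₚ.≤-Reasoning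

  1/suc-inverse : ∀ k → fromℕ (suc k) * 1/suc k ≡ 1ℚ
  1/suc-inverse k = ℚₚ.toℚᵘ-injective (begin
    toℚᵘ (fromℕ (suc k) * 1/suc k)              ≈⟨ ℚₚ.toℚᵘ-homo-* (fromℕ (suc k)) (1/suc k) ⟩
    toℚᵘ (fromℕ (suc k)) ℚᵘ.* toℚᵘ (1/suc k)    ≈⟨ ℚᵘₚ.*-cong (ℚₚ.toℚᵘ-fromℚᵘ (ℚᵘ.mkℚᵘ (ℤ.+ suc k) 0)) (ℚₚ.toℚᵘ-fromℚᵘ (ℚᵘ.mkℚᵘ (ℤ.+ 1) k)) ⟩
    ℚᵘ.mkℚᵘ (ℤ.+ suc k) 0 ℚᵘ.* ℚᵘ.mkℚᵘ (ℤ.+ 1) k    ≈⟨ ℚᵘₚ.*-inverseʳ (ℚᵘ.mkℚᵘ (ℤ.+ suc k) 0) ⟩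
    ℚᵘ.1ℚᵘ ∎)
    where open ℚᵘₚ.≃-Reasoning

  ≤-fromℕ : ∀ q → ∃ λ n → q ≤ fromℕ n
  ≤-fromℕ q@(mkℚ i d _) = ℤ.∣ i ∣ , ℚₚ.toℚᵘ-cancel-≤ (begin
    ℚᵘ.mkℚᵘ i d                ≤⟨ ℚᵘ.*≤* (i*1≤ i) ⟩
    ℚᵘ.mkℚᵘ (ℤ.+ ℤ.∣ i ∣) 0      ≃⟨ ℚₚ.toℚᵘ-fromℚᵘ (ℚᵘ.mkℚᵘ (ℤ.+ ℤ.∣ i ∣) 0) ⟨
    toℚᵘ (fromℕ ℤ.∣ i ∣) ∎)
    where
    open ℚᵘₚ.≤-Reasoning
    i*1≤ : ∀ i → i ℤ.* ℤ.+ 1 ℤ.≤ ℤ.+ ℤ.∣ i ∣ ℤ.* ℤ.+ suc d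
    i*1≤ (ℤ.+ n)    = subst₂ ℤ._≤_ (ℤₚ.pos-* n 1) (ℤₚ.pos-* n (suc d)) (ℤ.+≤+ (ℕₚ.*-monoʳ-≤ n (ℕ.s≤s ℕ.z≤n)))
    i*1≤ -[1+ n ] = ℤ.-≤+

  0≤fromℕ : ∀ n → 0ℚ ≤ fromℕ n
  0≤fromℕ n = fromℕ-mono {0} {n} ℕ.z≤n

  *-mono : ∀ {a b c} → 0ℚ ≤ a → b ≤ c → a * b ≤ a * c
  *-mono {a} 0≤a b≤c = ℚₚ.*-monoˡ-≤-nonNeg a {{ℚ.nonNegative 0≤a}} b≤c

  *-mono₂ : ∀ {a b c d} → 0ℚ ≤ c → 0ℚ ≤ b → a ≤ b → c ≤ d → a * c ≤ b * d
  *-mono₂ {a} {b} {c} {d} 0≤c 0≤b a≤b c≤d =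
    ℚₚ.≤-trans (ℚₚ.*-monoʳ-≤-nonNeg c {{ℚ.nonNegative 0≤c}} a≤b) (*-mono 0≤b c≤d)

  0≤* : ∀ {a b} → 0ℚ ≤ a → 0ℚ ≤ b → 0ℚ ≤ a * b
  0≤* {a} {b} 0≤a 0≤b = subst (_≤ a * b) (ℚₚ.*-zeroʳ a) (*-mono 0≤a 0≤b)

  0≤+ : ∀ {a b} → 0ℚ ≤ a → 0ℚ ≤ b → 0ℚ ≤ a + b
  0≤+ = ℚₚ.+-mono-≤

  0<1/suc : ∀ k → 0ℚ < 1/suc k
  0<1/suc k = ℚₚ.positive⁻¹ (1/suc k) {{ℚₚ.normalize-pos 1 (suc k)}}

  0≤1/suc : ∀ k → 0ℚ ≤ 1/suc k
  0≤1/suc k = ℚₚ.<⇒≤ (0<1/suc k)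

  1/suc-anti : ∀ {j k} → j ℕ.≤ k → 1/suc k ≤ 1/suc j
  1/suc-anti {j} {k} j≤k = begin
    1/suc k                                ≡⟨ sym (ℚₚ.*-identityʳ _) ⟩
    1/suc k * 1ℚ                           ≡⟨ cong (1/suc k *_) (sym (1/suc-inverse j)) ⟩
    1/suc k * (fromℕ (suc j) * 1/suc j)    ≤⟨ *-mono (0≤1/suc k) (*-mono₂ (0≤1/suc j) (0≤fromℕ (suc k)) (fromℕ-mono (ℕ.s≤s j≤k)) ℚₚ.≤-refl) ⟩
    1/suc k * (fromℕ (suc k) * 1/suc j)    ≡⟨ solve 3 (λ a b c → a :* (b :* c) := (b :* a) :* c) refl (1/suc k) (fromℕ (suc k)) (1/suc j) ⟩
    (fromℕ (suc k) * 1/suc k) * 1/suc j    ≡⟨ cong (_* 1/suc j) (1/suc-inverse k) ⟩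
    1ℚ * 1/suc j                           ≡⟨ ℚₚ.*-identityˡ _ ⟩
    1/suc j                                ∎
    where open ℚₚ.≤-Reasoning

  ∣∣-≤ : ∀ {a b} → a ≤ b → - a ≤ b → ∣ a ∣ ≤ b
  ∣∣-≤ {a} a≤b -a≤b with ℚₚ.∣p∣≡p∨∣p∣≡-p a
  ... | inj₁ eq = subst (_≤ _) (sym eq) a≤b
  ... | inj₂ eq = subst (_≤ _) (sym eq) -a≤b

  ∣-∣-sym : ∀ a b → ∣ a - b ∣ ≡ ∣ b - a ∣
  ∣-∣-sym a b = trans (cong ∣_∣ (solve 2 (λ a b → a :- b := :- (b :- a)) refl a b)) (ℚₚ.∣-p∣≡∣p∣ (b - a))

  triangle : ∀ a b c → ∣ a - c ∣ ≤ ∣ a - b ∣ + ∣ b - c ∣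
  triangle a b c = subst (λ d → ∣ d ∣ ≤ ∣ a - b ∣ + ∣ b - c ∣)
    (solve 3 (λ a b c → (a :- b) :+ (b :- c) := a :- c) refl a b c)
    (ℚₚ.∣p+q∣≤∣p∣+∣q∣ (a - b) (b - c))

  abstract
    0<½* : ∀ {ε} → 0ℚ < ε → 0ℚ < ½ * ε
    0<½* {ε} 0<ε = subst (_< ½ * ε) (ℚₚ.*-zeroʳ ½) (ℚₚ.*-monoʳ-<-pos ½ 0<ε)

  ½+½ : ∀ ε → ½ * ε + ½ * ε ≡ ε
  ½+½ ε = trans (sym (ℚₚ.*-distribʳ-+ ε ½ ½)) (ℚₚ.*-identityˡ ε)

  ∣∣-split : ∀ {a b ε} → ∣ a ∣ ≤ ½ * ε → ∣ b ∣ ≤ ½ * ε → ∣ a + b ∣ ≤ ε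
  ∣∣-split {a} {b} {ε} a≤ b≤ =
    subst (_ ≤_) (½+½ ε) (ℚₚ.≤-trans (ℚₚ.∣p+q∣≤∣p∣+∣q∣ a b) (ℚₚ.+-mono-≤ a≤ b≤))

  scaled-down : ∀ {L ε} n → L ≤ fromℕ n → 0ℚ < ε → ∃ λ δ → 0ℚ < δ × L * δ ≤ ε
  scaled-down {L} {ε} n L≤n 0<ε = ε * 1/B , 0<δ , (begin
    L * (ε * 1/B)           ≤⟨ ℚₚ.*-monoʳ-≤-nonNeg (ε * 1/B) {{ℚ.nonNegative (ℚₚ.<⇒≤ 0<δ)}}
                               (ℚₚ.≤-trans L≤n (fromℕ-mono (ℕₚ.n≤1+n n))) ⟩
    B * (ε * 1/B)           ≡⟨ solve 3 (λ a b c → a :* (b :* c) := b :* (a :* c)) refl B ε 1/B ⟩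
    ε * (B * 1/B)           ≡⟨ cong (ε *_) (1/suc-inverse n) ⟩
    ε * 1ℚ                  ≡⟨ ℚₚ.*-identityʳ ε ⟩
    ε                       ∎)
    where
    open ℚₚ.≤-Reasoning
    B   = fromℕ (suc n)
    1/B = 1/suc n
    0<δ : 0ℚ < ε * 1/B
    0<δ = subst (_< ε * 1/B) (ℚₚ.*-zeroʳ ε) (ℚₚ.*-monoʳ-<-pos ε {{ℚ.positive 0<ε}} (0<1/suc n))

  eventually-small : ∀ {C ε q} N → 0ℚ ≤ ε → C ≡ q * ε → q ≤ fromℕ N → ∀ k → N ℕ.≤ k → C * 1/suc k ≤ ε
  eventually-small {C} {ε} {q} N 0≤ε C≡ q≤N k N≤k = begin
    C * 1/suc k                          ≡⟨ cong (_* 1/suc k) C≡ ⟩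
    (q * ε) * 1/suc k                    ≤⟨ ℚₚ.*-monoʳ-≤-nonNeg (1/suc k) {{ℚ.nonNegative (0≤1/suc k)}}
                                            (ℚₚ.*-monoʳ-≤-nonNeg ε {{ℚ.nonNegative 0≤ε}}
                                              (ℚₚ.≤-trans q≤N (fromℕ-mono (ℕₚ.m≤n⇒m≤1+n N≤k)))) ⟩
    (fromℕ (suc k) * ε) * 1/suc k        ≡⟨ solve 3 (λ a b c → (a :* b) :* c := b :* (a :* c)) refl (fromℕ (suc k)) ε (1/suc k) ⟩
    ε * (fromℕ (suc k) * 1/suc k)        ≡⟨ cong (ε *_) (1/suc-inverse k) ⟩
    ε * 1ℚ                               ≡⟨ ℚₚ.*-identityʳ ε ⟩
    ε                                    ∎
    where open ℚₚ.≤-Reasoning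

  divide : ∀ C {ε} → 0ℚ < ε → ∃ λ q → C ≡ q * ε
  divide C {ε} 0<ε = C * 1/ ε , sym (trans (ℚₚ.*-assoc C (1/ ε) ε)
    (trans (cong (C *_) (ℚₚ.*-inverseˡ ε)) (ℚₚ.*-identityʳ C)))
    where instance ε≢0 = ℚ.>-nonZero 0<ε

  abstract
    shrink : ∀ L {ε} → 0ℚ < ε → ∃ λ δ → 0ℚ < δ × L * δ ≤ ε
    shrink L 0<ε with ≤-fromℕ L
    ... | n , L≤n = scaled-down n L≤n 0<ε

    archimedes : ∀ C {ε} → 0ℚ < ε → ∃ λ N → ∀ k → N ℕ.≤ k → C * 1/suc k ≤ ε
    archimedes C {ε} 0<ε with divide C 0<ε
    ... | q , C≡ with ≤-fromℕ q
    ... | N , q≤N = N , eventually-small N (ℚₚ.<⇒≤ 0<ε) C≡ q≤N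

  fromℕ-+ : ∀ m n → fromℕ (m ℕ.+ n) ≡ fromℕ m + fromℕ n
  fromℕ-+ zero    n = sym (ℚₚ.+-identityˡ (fromℕ n))
  fromℕ-+ (suc m) n = begin
    fromℕ (suc m ℕ.+ n)        ≡⟨ fromℕ-suc (m ℕ.+ n) ⟩
    1ℚ + fromℕ (m ℕ.+ n)       ≡⟨ cong (1ℚ +_) (fromℕ-+ m n) ⟩
    1ℚ + (fromℕ m + fromℕ n)   ≡⟨ sym (ℚₚ.+-assoc 1ℚ (fromℕ m) (fromℕ n)) ⟩
    1ℚ + fromℕ m + fromℕ n     ≡⟨ cong (_+ fromℕ n) (sym (fromℕ-suc m)) ⟩
    fromℕ (suc m) + fromℕ n    ∎
    where open ≡-Reasoning

  fromℕ-* : ∀ m n → fromℕ (m ℕ.* n) ≡ fromℕ m * fromℕ n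
  fromℕ-* zero    n = sym (ℚₚ.*-zeroˡ (fromℕ n))
  fromℕ-* (suc m) n = begin
    fromℕ (n ℕ.+ m ℕ.* n)           ≡⟨ fromℕ-+ n (m ℕ.* n) ⟩
    fromℕ n + fromℕ (m ℕ.* n)       ≡⟨ cong (fromℕ n +_) (fromℕ-* m n) ⟩
    fromℕ n + fromℕ m * fromℕ n     ≡⟨ solve 2 (λ a b → a :+ b :* a := (con 1ℚ :+ b) :* a) refl (fromℕ n) (fromℕ m) ⟩
    (1ℚ + fromℕ m) * fromℕ n        ≡⟨ cong (_* fromℕ n) (sym (fromℕ-suc m)) ⟩
    fromℕ (suc m) * fromℕ n         ∎
    where open ≡-Reasoning

  ≤∣∣ : ∀ q → q ≤ ∣ q ∣
  ≤∣∣ q with ℚₚ.≤-total 0ℚ q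
  ... | inj₁ 0≤q = ℚₚ.≤-reflexive (sym (ℚₚ.0≤p⇒∣p∣≡p 0≤q))
  ... | inj₂ q≤0 = ℚₚ.≤-trans q≤0 (ℚₚ.0≤∣p∣ q)

IsCauchy : (ℕ → ℚ) → Set
IsCauchy x = ∀ ε → 0ℚ ℚ.< ε →
  ∃ λ N → ∀ m n → N ℕ.≤ m → N ℕ.≤ n → ℚ.∣ x m ℚ.- x n ∣ ℚ.≤ ε

module CauchyLemmas where
  open RationalLemmas
  open ℚ using (_+_; _*_; _-_; -_; _≤_; _<_; ∣_∣; 1/_; _⊔_)
  open +-*-Solver using (solve; _:+_; _:*_; _:-_; :-_; _:=_; con)
  open ℚₚ.≤-Reasoning

  abstract
    centred : ∀ {x} →
      (∀ {ε} → 0ℚ < ε → ∃ λ N → ∀ k → N ℕ.≤ k → ∣ x k - x N ∣ ≤ ε) → IsCauchy x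
    centred {x} h ε 0<ε with h (0<½* 0<ε)
    ... | N , near = N , λ m n N≤m N≤n → begin
      ∣ x m - x n ∣                     ≤⟨ triangle (x m) (x N) (x n) ⟩
      ∣ x m - x N ∣ + ∣ x N - x n ∣     ≡⟨ cong (∣ x m - x N ∣ +_) (∣-∣-sym (x N) (x n)) ⟩
      ∣ x m - x N ∣ + ∣ x n - x N ∣     ≤⟨ ℚₚ.+-mono-≤ (near m N≤m) (near n N≤n) ⟩
      ½ * ε + ½ * ε                     ≡⟨ ½+½ ε ⟩
      ε                                 ∎

  abstract
    bounded : ∀ {x} → IsCauchy x → ∃ λ B → ∃ λ N → ∀ k → N ℕ.≤ k → ∣ x k ∣ ≤ fromℕ B
    bounded {x} cx with cx 1ℚ (ℚₚ.positive⁻¹ 1ℚ)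
    ... | N , near with ≤-fromℕ (1ℚ + ∣ x N ∣)
    ... | B , ≤B = B , N , λ k N≤k → begin
      ∣ x k ∣                   ≡⟨ cong ∣_∣ (solve 2 (λ a b → a := (a :- b) :+ b) refl (x k) (x N)) ⟩
      ∣ (x k - x N) + x N ∣     ≤⟨ ℚₚ.∣p+q∣≤∣p∣+∣q∣ (x k - x N) (x N) ⟩
      ∣ x k - x N ∣ + ∣ x N ∣   ≤⟨ ℚₚ.+-monoˡ-≤ ∣ x N ∣ (near k N N≤k ℕₚ.≤-refl) ⟩
      1ℚ + ∣ x N ∣              ≤⟨ ≤B ⟩
      fromℕ B                   ∎

  abstract
    lipschitz : ∀ {x y} L M →
      (∀ m n → M ℕ.≤ m → M ℕ.≤ n → ∣ y m - y n ∣ ≤ L * ∣ x m - x n ∣) →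
      0ℚ ≤ L → IsCauchy x → IsCauchy y
    lipschitz {x} {y} L M lip 0≤L cx ε 0<ε with shrink L 0<ε
    ... | δ , 0<δ , Lδ≤ε with cx δ 0<δ
    ... | N , near = N ℕ.⊔ M , λ m n N≤m N≤n → begin
      ∣ y m - y n ∣        ≤⟨ lip m n (ℕₚ.m⊔n≤o⇒n≤o N M N≤m) (ℕₚ.m⊔n≤o⇒n≤o N M N≤n) ⟩
      L * ∣ x m - x n ∣    ≤⟨ *-mono 0≤L (near m n (ℕₚ.m⊔n≤o⇒m≤o N M N≤m) (ℕₚ.m⊔n≤o⇒m≤o N M N≤n)) ⟩
      L * δ                ≤⟨ Lδ≤ε ⟩
      ε                    ∎

    const : ∀ q → IsCauchy (λ _ → q)
    const q ε 0<ε = 0 , λ _ _ _ _ → subst (λ d → ∣ d ∣ ≤ _) (sym (ℚₚ.+-inverseʳ q)) (ℚₚ.<⇒≤ 0<ε)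

    add : ∀ {x y} → IsCauchy x → IsCauchy y → IsCauchy (λ k → x k + y k)
    add {x} {y} cx cy ε 0<ε with cx (½ * ε) (0<½* 0<ε) | cy (½ * ε) (0<½* 0<ε)
    ... | M , nearx | N , neary = M ℕ.⊔ N , λ m n N≤m N≤n →
      subst (λ d → ∣ d ∣ ≤ ε)
        (solve 4 (λ a b c d → (a :- c) :+ (b :- d) := (a :+ b) :- (c :+ d)) refl (x m) (y m) (x n) (y n))
        (∣∣-split {x m - x n} {y m - y n}
          (nearx m n (ℕₚ.m⊔n≤o⇒m≤o M N N≤m) (ℕₚ.m⊔n≤o⇒m≤o M N N≤n))
          (neary m n (ℕₚ.m⊔n≤o⇒n≤o M N N≤m) (ℕₚ.m⊔n≤o⇒n≤o M N N≤n)))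

    neg : ∀ {x} → IsCauchy x → IsCauchy (λ k → - x k)
    neg {x} cx = lipschitz {x} {λ k → - x k} 1ℚ 0 (λ m n _ _ → ℚₚ.≤-reflexive (begin-equality
      ∣ - x m - - x n ∣      ≡⟨ cong ∣_∣ (solve 2 (λ a b → (:- a) :- (:- b) := b :- a) refl (x m) (x n)) ⟩
      ∣ x n - x m ∣          ≡⟨ ∣-∣-sym (x n) (x m) ⟩
      ∣ x m - x n ∣          ≡⟨ sym (ℚₚ.*-identityˡ _) ⟩
      1ℚ * ∣ x m - x n ∣     ∎)) (0≤fromℕ 1) cx

    product≤ : ∀ {a b A δ ε} → ∣ a ∣ ≤ A → ∣ b ∣ ≤ δ → 0ℚ ≤ A → A * δ ≤ ε → ∣ a * b ∣ ≤ ε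
    product≤ {a} {b} {A} {δ} a≤A b≤δ 0≤A Aδ≤ε = ℚₚ.≤-trans
      (subst (_≤ A * δ) (sym (ℚₚ.∣p*q∣≡∣p∣*∣q∣ a b)) (*-mono₂ (ℚₚ.0≤∣p∣ b) 0≤A a≤A b≤δ)) Aδ≤ε

    product-difference≤ : ∀ a b c d {A B δ η ε} → 0ℚ ≤ A → 0ℚ ≤ B →
      ∣ a ∣ ≤ A → ∣ d ∣ ≤ B → ∣ b - d ∣ ≤ δ → ∣ a - c ∣ ≤ η →
      A * δ ≤ ½ * ε → B * η ≤ ½ * ε → ∣ a * b - c * d ∣ ≤ ε
    product-difference≤ a b c d {ε = ε} 0≤A 0≤B a≤A d≤B b-d≤δ a-c≤η Aδ≤ Bη≤ = subst (λ z → ∣ z ∣ ≤ ε)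
      (solve 4 (λ a b c d → a :* (b :- d) :+ d :* (a :- c) := a :* b :- c :* d) refl a b c d)
      (∣∣-split {a * (b - d)} {d * (a - c)}
        (product≤ {a} {b - d} a≤A b-d≤δ 0≤A Aδ≤) (product≤ {d} {a - c} d≤B a-c≤η 0≤B Bη≤))

    mul : ∀ {x y} → IsCauchy x → IsCauchy y → IsCauchy (λ k → x k * y k)
    mul {x} {y} cx cy ε 0<ε = scales (bounded cx) (bounded cy)
      where
      Goal : Set
      Goal = ∃ λ N → ∀ m n → N ℕ.≤ m → N ℕ.≤ n → ∣ x m * y m - x n * y n ∣ ≤ ε
      Bound Close : (ℕ → ℚ) → ℚ → ℕ → Set
      Bound z B N = ∀ k → N ℕ.≤ k → ∣ z k ∣ ≤ B
      Close z δ N = ∀ m n → N ℕ.≤ m → N ℕ.≤ n → ∣ z m - z n ∣ ≤ δ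
      assemble : ∀ {A B δ η M₁ N₁ M₂ N₂} → 0ℚ ≤ A → 0ℚ ≤ B → Bound x A M₁ → Bound y B N₁ →
        A * δ ≤ ½ * ε → B * η ≤ ½ * ε → Close y δ N₂ → Close x η M₂ → Goal
      assemble {M₁ = M₁} {N₁} {M₂} {N₂} 0≤A 0≤B x≤A y≤B Aδ≤ Bη≤ y-close x-close =
        N , λ m n N≤m N≤n → product-difference≤ (x m) (y m) (x n) (y n) 0≤A 0≤B
          (x≤A m (ℕₚ.≤-trans M₁≤N N≤m)) (y≤B n (ℕₚ.≤-trans N₁≤N N≤n))
          (y-close m n (ℕₚ.≤-trans N₂≤N N≤m) (ℕₚ.≤-trans N₂≤N N≤n))
          (x-close m n (ℕₚ.≤-trans M₂≤N N≤m) (ℕₚ.≤-trans M₂≤N N≤n)) Aδ≤ Bη≤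
        where
        N : ℕ
        N = (M₁ ℕ.+ N₁) ℕ.+ (M₂ ℕ.+ N₂)
        M₁≤N : M₁ ℕ.≤ N
        M₁≤N = ℕₚ.≤-trans (ℕₚ.m≤m+n M₁ N₁) (ℕₚ.m≤m+n (M₁ ℕ.+ N₁) (M₂ ℕ.+ N₂))
        N₁≤N : N₁ ℕ.≤ N
        N₁≤N = ℕₚ.≤-trans (ℕₚ.m≤n+m N₁ M₁) (ℕₚ.m≤m+n (M₁ ℕ.+ N₁) (M₂ ℕ.+ N₂))
        M₂≤N : M₂ ℕ.≤ N
        M₂≤N = ℕₚ.≤-trans (ℕₚ.m≤m+n M₂ N₂) (ℕₚ.m≤n+m (M₂ ℕ.+ N₂) (M₁ ℕ.+ N₁))
        N₂≤N : N₂ ℕ.≤ N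
        N₂≤N = ℕₚ.≤-trans (ℕₚ.m≤n+m N₂ M₂) (ℕₚ.m≤n+m (M₂ ℕ.+ N₂) (M₁ ℕ.+ N₁))
      tolerances : ∀ {A B δ η M₁ N₁} → 0ℚ ≤ A → 0ℚ ≤ B → Bound x A M₁ → Bound y B N₁ →
        0ℚ < δ → 0ℚ < η → A * δ ≤ ½ * ε → B * η ≤ ½ * ε → Goal
      tolerances 0≤A 0≤B x≤A y≤B 0<δ 0<η Aδ≤ Bη≤ =
        assemble 0≤A 0≤B x≤A y≤B Aδ≤ Bη≤ (proj₂ (cy _ 0<δ)) (proj₂ (cx _ 0<η))
      scales : (∃ λ A → ∃ (Bound x (fromℕ A))) → (∃ λ B → ∃ (Bound y (fromℕ B))) → Goal
      scales (A , _ , x≤A) (B , _ , y≤B) =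
        let δ , 0<δ , Aδ≤ = shrink (fromℕ A) (0<½* 0<ε)
            η , 0<η , Bη≤ = shrink (fromℕ B) (0<½* 0<ε)
        in tolerances (0≤fromℕ A) (0≤fromℕ B) x≤A y≤B 0<δ 0<η Aδ≤ Bη≤

  ⊔-positive : ∀ {q} → 0ℚ < q → ∀ u → ℚ.Positive (u ⊔ q)
  ⊔-positive {q} 0<q u = ℚ.positive (ℚₚ.<-≤-trans 0<q (ℚₚ.p≤q⊔p u q))

  ⊔-nonZero : ∀ {q} → 0ℚ < q → ∀ u → ℚ.NonZero (u ⊔ q)
  ⊔-nonZero {q} 0<q u = ℚₚ.pos⇒nonZero (u ⊔ q) {{⊔-positive 0<q u}}

  1/⊔ : ∀ {q} → 0ℚ < q → ℚ → ℚ
  1/⊔ {q} 0<q u = (1/ (u ⊔ q)) {{⊔-nonZero 0<q u}}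

  abstract
    recip : ∀ {x q M} (0<q : 0ℚ < q) → (∀ k → M ℕ.≤ k → q ≤ x k) →
      IsCauchy x → IsCauchy (λ k → 1/⊔ 0<q (x k))
    recip {x} {q} {M} 0<q q≤x cx = lipschitz {x} {y} (1/q * 1/q) M lip (0≤* 0≤1/q 0≤1/q) cx
      where
      instance
        q>0 : ℚ.Positive q
        q>0 = ℚ.positive 0<q
        q≢0 : ℚ.NonZero q
        q≢0 = ℚₚ.pos⇒nonZero q
      1/q : ℚ
      1/q = 1/ q
      0≤1/q : 0ℚ ≤ 1/q
      0≤1/q = ℚₚ.<⇒≤ (ℚₚ.positive⁻¹ 1/q {{ℚₚ.1/pos⇒pos q}})
      y : ℕ → ℚ
      y k = 1/⊔ 0<q (x k)
      0≤y : ∀ k → 0ℚ ≤ y k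
      0≤y k = ℚₚ.<⇒≤ (ℚₚ.positive⁻¹ (y k)
        {{ℚₚ.1/pos⇒pos (x k ⊔ q) {{⊔-positive 0<q (x k)}}}})
      xy≡1 : ∀ k → M ℕ.≤ k → x k * y k ≡ 1ℚ
      xy≡1 k M≤k = trans (cong (_* y k) (sym (ℚₚ.p≥q⇒p⊔q≡p (q≤x k M≤k))))
        (ℚₚ.*-inverseʳ (x k ⊔ q) {{⊔-nonZero 0<q (x k)}})
      y≤1/q : ∀ k → M ℕ.≤ k → y k ≤ 1/q
      y≤1/q k M≤k = begin
        y k                  ≡⟨ sym (ℚₚ.*-identityʳ (y k)) ⟩
        y k * 1ℚ             ≡⟨ cong (y k *_) (sym (ℚₚ.*-inverseʳ q)) ⟩
        y k * (q * 1/q)      ≤⟨ *-mono (0≤y k) (ℚₚ.*-monoʳ-≤-nonNeg 1/q {{ℚ.nonNegative 0≤1/q}} (q≤x k M≤k)) ⟩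
        y k * (x k * 1/q)    ≡⟨ solve 3 (λ a b c → a :* (b :* c) := (b :* a) :* c) refl (y k) (x k) 1/q ⟩
        (x k * y k) * 1/q    ≡⟨ cong (_* 1/q) (xy≡1 k M≤k) ⟩
        1ℚ * 1/q             ≡⟨ ℚₚ.*-identityˡ 1/q ⟩
        1/q                  ∎
      lip : ∀ m n → M ℕ.≤ m → M ℕ.≤ n → ∣ y m - y n ∣ ≤ 1/q * 1/q * ∣ x m - x n ∣
      lip m n M≤m M≤n = begin
        ∣ y m - y n ∣                                ≡⟨ cong ∣_∣ (cong₂ _-_ (expand m n M≤n) (trans (expand n m M≤m) (solve 3 (λ a b c → a :* (b :* c) := c :* (b :* a)) refl (y n) (x m) (y m)))) ⟩
        ∣ y m * (x n * y n) - y m * (x m * y n) ∣    ≡⟨ cong ∣_∣ (solve 4 (λ a b c d → a :* (d :* b) :- a :* (c :* b) := (a :* b) :* (d :- c)) refl (y m) (y n) (x m) (x n)) ⟩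
        ∣ (y m * y n) * (x n - x m) ∣                ≡⟨ ℚₚ.∣p*q∣≡∣p∣*∣q∣ (y m * y n) (x n - x m) ⟩
        ∣ y m * y n ∣ * ∣ x n - x m ∣                ≡⟨ cong₂ _*_ (ℚₚ.0≤p⇒∣p∣≡p (0≤* (0≤y m) (0≤y n))) (∣-∣-sym (x n) (x m)) ⟩
        (y m * y n) * ∣ x m - x n ∣                  ≤⟨ ℚₚ.*-monoʳ-≤-nonNeg ∣ x m - x n ∣ {{ℚₚ.∣-∣-nonNeg (x m - x n)}} (*-mono₂ (0≤y n) 0≤1/q (y≤1/q m M≤m) (y≤1/q n M≤n)) ⟩
        1/q * 1/q * ∣ x m - x n ∣                    ∎
        where
        expand : ∀ i j → M ℕ.≤ j → y i ≡ y i * (x j * y j)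
        expand i j M≤j = trans (sym (ℚₚ.*-identityʳ (y i))) (cong (y i *_) (sym (xy≡1 j M≤j)))

module Exponential where
  open RationalLemmas
  open ℚ using (_+_; _*_; _-_; -_; _≤_; _<_; ∣_∣)
  open +-*-Solver using (solve; _:+_; _:*_; _:-_; :-_; _:=_; con)
  open ℚₚ.≤-Reasoning

  -- term q i = qⁱ / i!,  partialSum q k = Σ_{i ≤ k} qⁱ / i!
  term : ℚ → ℕ → ℚ
  term q zero    = 1ℚ
  term q (suc i) = term q i * q * 1/suc i

  partialSum : ℚ → ℕ → ℚ
  partialSum q zero    = term q 0
  partialSum q (suc k) = partialSum q k + term q (suc k)

  0≤term : ∀ {q} → 0ℚ ≤ q → ∀ i → 0ℚ ≤ term q i
  0≤term 0≤q zero    = 0≤fromℕ 1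
  0≤term 0≤q (suc i) = 0≤* (0≤* (0≤term 0≤q i) 0≤q) (0≤1/suc i)

  ∣*1/suc∣ : ∀ a i → ∣ a * 1/suc i ∣ ≡ ∣ a ∣ * 1/suc i
  ∣*1/suc∣ a i = trans (ℚₚ.∣p*q∣≡∣p∣*∣q∣ a (1/suc i)) (cong (∣ a ∣ *_) (ℚₚ.0≤p⇒∣p∣≡p (0≤1/suc i)))

  ∣term∣≤ : ∀ {q B} → ∣ q ∣ ≤ B → ∀ i → ∣ term q i ∣ ≤ term B i
  ∣term∣≤ q≤B zero = ℚₚ.≤-refl
  ∣term∣≤ {q} {B} q≤B (suc i) = begin
    ∣ term q i * q * 1/suc i ∣       ≡⟨ ∣*1/suc∣ (term q i * q) i ⟩
    ∣ term q i * q ∣ * 1/suc i       ≡⟨ cong (_* 1/suc i) (ℚₚ.∣p*q∣≡∣p∣*∣q∣ (term q i) q) ⟩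
    ∣ term q i ∣ * ∣ q ∣ * 1/suc i   ≤⟨ ℚₚ.*-monoʳ-≤-nonNeg (1/suc i) {{ℚ.nonNegative (0≤1/suc i)}}
                                         (*-mono₂ (ℚₚ.0≤∣p∣ q) (0≤term 0≤B i) (∣term∣≤ q≤B i) q≤B) ⟩
    term B i * B * 1/suc i           ∎
    where
    0≤B : 0ℚ ≤ B
    0≤B = ℚₚ.≤-trans (ℚₚ.0≤∣p∣ q) q≤B

  module _ (b : ℕ) where
    private
      B = fromℕ b
      T = term B
      K = b ℕ.+ b

    0≤T : ∀ i → 0ℚ ≤ T i
    0≤T = 0≤term (0≤fromℕ b)

    halves : ∀ i → K ℕ.≤ i → T (suc i) + T (suc i) ≤ T i
    halves i K≤i = begin
      T i * B * 1/suc i + T i * B * 1/suc i    ≡⟨ solve 3 (λ t b c → t :* b :* c :+ t :* b :* c := t :* ((b :+ b) :* c)) refl (T i) B (1/suc i) ⟩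
      T i * ((B + B) * 1/suc i)                ≤⟨ *-mono (0≤T i) (begin
          (B + B) * 1/suc i         ≤⟨ ℚₚ.*-monoʳ-≤-nonNeg (1/suc i) {{ℚ.nonNegative (0≤1/suc i)}} 2B≤ ⟩
          fromℕ (suc i) * 1/suc i   ≡⟨ 1/suc-inverse i ⟩
          1ℚ                        ∎) ⟩
      T i * 1ℚ                                 ≡⟨ ℚₚ.*-identityʳ (T i) ⟩
      T i                                      ∎
      where
      2B≤ : B + B ≤ fromℕ (suc i)
      2B≤ = subst (_≤ fromℕ (suc i)) (fromℕ-+ b b) (fromℕ-mono (ℕₚ.m≤n⇒m≤1+n K≤i))

    tail≤ : ∀ {q} → ∣ q ∣ ≤ B → ∀ k j → K ℕ.≤ k →
      ∣ partialSum q (j ℕ.+ k) - partialSum q k ∣ ≤ T k - T (j ℕ.+ k)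
    tail≤ {q} q≤B k zero K≤k = ℚₚ.≤-reflexive (trans (cong ∣_∣ (ℚₚ.+-inverseʳ (partialSum q k))) (sym (ℚₚ.+-inverseʳ (T k))))
    tail≤ {q} q≤B k (suc j) K≤k = begin
      ∣ S (suc i) - S k ∣                    ≡⟨ cong ∣_∣ (solve 3 (λ a t c → (a :+ t) :- c := (a :- c) :+ t) refl (S i) (term q (suc i)) (S k)) ⟩
      ∣ (S i - S k) + term q (suc i) ∣       ≤⟨ ℚₚ.∣p+q∣≤∣p∣+∣q∣ (S i - S k) (term q (suc i)) ⟩
      ∣ S i - S k ∣ + ∣ term q (suc i) ∣     ≤⟨ ℚₚ.+-mono-≤ (tail≤ q≤B k j K≤k) (∣term∣≤ q≤B (suc i)) ⟩
      (T k - T i) + T (suc i)                ≡⟨ solve 3 (λ a b c → (a :- b) :+ c := (a :- b) :+ ((c :+ c) :- c)) refl (T k) (T i) (T (suc i)) ⟩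
      (T k - T i) + (T (suc i) + T (suc i) - T (suc i))   ≤⟨ ℚₚ.+-monoʳ-≤ (T k - T i) (ℚₚ.+-monoˡ-≤ (- T (suc i)) (halves i (ℕₚ.≤-trans K≤k (ℕₚ.m≤n+m k j)))) ⟩
      (T k - T i) + (T i - T (suc i))        ≡⟨ solve 3 (λ a b c → (a :- b) :+ (b :- c) := a :- c) refl (T k) (T i) (T (suc i)) ⟩
      T k - T (suc i)                        ∎
      where
      i = j ℕ.+ k
      S = partialSum q

    tail≤T : ∀ {q} → ∣ q ∣ ≤ B → ∀ k m → K ℕ.≤ k → k ℕ.≤ m →
      ∣ partialSum q m - partialSum q k ∣ ≤ T k
    tail≤T {q} q≤B k m K≤k k≤m = begin
      ∣ partialSum q m - partialSum q k ∣                ≡⟨ cong (λ i → ∣ partialSum q i - partialSum q k ∣) (sym (ℕₚ.m∸n+n≡m k≤m)) ⟩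
      ∣ partialSum q (m ℕ.∸ k ℕ.+ k) - partialSum q k ∣  ≤⟨ tail≤ q≤B k (m ℕ.∸ k) K≤k ⟩
      T k - T (m ℕ.∸ k ℕ.+ k)                            ≤⟨ ℚₚ.+-monoʳ-≤ (T k) (ℚₚ.neg-antimono-≤ (0≤T (m ℕ.∸ k ℕ.+ k))) ⟩
      T k + 0ℚ                                           ≡⟨ ℚₚ.+-identityʳ (T k) ⟩
      T k                                                ∎

    decay : ∀ j → fromℕ (suc j) * T (j ℕ.+ K) ≤ T K
    decay zero    = ℚₚ.≤-reflexive (ℚₚ.*-identityˡ (T K))
    decay (suc j) = begin
      fromℕ (suc (suc j)) * T (suc i)                     ≡⟨ cong (_* T (suc i)) (fromℕ-suc (suc j)) ⟩
      (1ℚ + fromℕ (suc j)) * T (suc i)                    ≤⟨ ℚₚ.*-monoʳ-≤-nonNeg (T (suc i)) {{ℚ.nonNegative (0≤T (suc i))}}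
                                                              (ℚₚ.+-monoˡ-≤ (fromℕ (suc j)) (fromℕ-mono {1} {suc j} (ℕ.s≤s ℕ.z≤n))) ⟩
      (fromℕ (suc j) + fromℕ (suc j)) * T (suc i)         ≡⟨ solve 2 (λ a b → (a :+ a) :* b := a :* (b :+ b)) refl (fromℕ (suc j)) (T (suc i)) ⟩
      fromℕ (suc j) * (T (suc i) + T (suc i))             ≤⟨ *-mono (0≤fromℕ (suc j)) (halves i (ℕₚ.m≤n+m K j)) ⟩
      fromℕ (suc j) * T i                                 ≤⟨ decay j ⟩
      T K                                                 ∎
      where i = j ℕ.+ K

    abstract
      T-null : ∀ {ε} → 0ℚ < ε → ∃ λ N → K ℕ.≤ N × T N ≤ ε
      T-null {ε} 0<ε with archimedes (T K) 0<ε
      ... | N , small = N ℕ.+ K , ℕₚ.m≤n+m K N , (begin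
        T (N ℕ.+ K)                                   ≡⟨ sym (ℚₚ.*-identityˡ _) ⟩
        1ℚ * T (N ℕ.+ K)                              ≡⟨ cong (_* T (N ℕ.+ K)) (sym (1/suc-inverse N)) ⟩
        fromℕ (suc N) * 1/suc N * T (N ℕ.+ K)         ≡⟨ solve 3 (λ a b c → a :* b :* c := a :* c :* b) refl (fromℕ (suc N)) (1/suc N) (T (N ℕ.+ K)) ⟩
        fromℕ (suc N) * T (N ℕ.+ K) * 1/suc N         ≤⟨ ℚₚ.*-monoʳ-≤-nonNeg (1/suc N) {{ℚ.nonNegative (0≤1/suc N)}} (decay N) ⟩
        T K * 1/suc N                                 ≤⟨ small N ℕₚ.≤-refl ⟩
        ε                                             ∎)

    T-decreasing : ∀ i j → K ℕ.≤ i → T (j ℕ.+ i) ≤ T i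
    T-decreasing i zero    K≤i = ℚₚ.≤-refl
    T-decreasing i (suc j) K≤i = begin
      T (suc (j ℕ.+ i))                        ≡⟨ sym (ℚₚ.+-identityʳ _) ⟩
      T (suc (j ℕ.+ i)) + 0ℚ                   ≤⟨ ℚₚ.+-monoʳ-≤ (T (suc (j ℕ.+ i))) (0≤T (suc (j ℕ.+ i))) ⟩
      T (suc (j ℕ.+ i)) + T (suc (j ℕ.+ i))    ≤⟨ halves (j ℕ.+ i) (ℕₚ.≤-trans K≤i (ℕₚ.m≤n+m i j)) ⟩
      T (j ℕ.+ i)                              ≤⟨ T-decreasing i j K≤i ⟩
      T i                                      ∎

    term-difference : ∀ {p q} → ∣ p ∣ ≤ B → ∣ q ∣ ≤ B → ∀ i →
      ∣ term p (suc i) - term q (suc i) ∣ ≤ ∣ p - q ∣ * T i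
    term-difference {p} {q} p≤B q≤B zero = ℚₚ.≤-reflexive (begin-equality
      ∣ 1ℚ * p * 1ℚ - 1ℚ * q * 1ℚ ∣    ≡⟨ cong ∣_∣ (cong₂ _-_ (one p) (one q)) ⟩
      ∣ p - q ∣                        ≡⟨ sym (ℚₚ.*-identityʳ _) ⟩
      ∣ p - q ∣ * 1ℚ                   ∎)
      where
      one : ∀ a → 1ℚ * a * 1ℚ ≡ a
      one a = trans (ℚₚ.*-identityʳ (1ℚ * a)) (ℚₚ.*-identityˡ a)
    term-difference {p} {q} p≤B q≤B (suc i) = begin
      ∣ t p * p * r - t q * q * r ∣                       ≡⟨ cong ∣_∣ (solve 5 (λ s t p q r → s :* p :* r :- t :* q :* r := (s :* (p :- q) :+ (s :- t) :* q) :* r) refl (t p) (t q) p q r) ⟩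
      ∣ (t p * (p - q) + (t p - t q) * q) * r ∣           ≡⟨ ∣*1/suc∣ (t p * (p - q) + (t p - t q) * q) (suc i) ⟩
      ∣ t p * (p - q) + (t p - t q) * q ∣ * r             ≤⟨ monoʳ (ℚₚ.∣p+q∣≤∣p∣+∣q∣ (t p * (p - q)) ((t p - t q) * q)) ⟩
      (∣ t p * (p - q) ∣ + ∣ (t p - t q) * q ∣) * r       ≡⟨ cong (_* r) (cong₂ _+_ (ℚₚ.∣p*q∣≡∣p∣*∣q∣ (t p) (p - q)) (ℚₚ.∣p*q∣≡∣p∣*∣q∣ (t p - t q) q)) ⟩
      (∣ t p ∣ * d + ∣ t p - t q ∣ * ∣ q ∣) * r           ≤⟨ monoʳ (ℚₚ.+-mono-≤
                                                               (ℚₚ.*-monoʳ-≤-nonNeg d {{ℚₚ.∣-∣-nonNeg (p - q)}} (∣term∣≤ p≤B (suc i)))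
                                                               (*-mono₂ (ℚₚ.0≤∣p∣ q) (0≤* (ℚₚ.0≤∣p∣ (p - q)) (0≤T i)) (term-difference p≤B q≤B i) q≤B)) ⟩
      (T (suc i) * d + d * T i * B) * r                   ≡⟨ cong (λ x → (T (suc i) * d + x) * r) TiB ⟩
      (T (suc i) * d + d * (T (suc i) * f)) * r           ≡⟨ solve 4 (λ t d f r → (t :* d :+ d :* (t :* f)) :* r := d :* t :* ((con 1ℚ :+ f) :* r)) refl (T (suc i)) d f r ⟩
      d * T (suc i) * ((1ℚ + f) * r)                      ≡⟨ cong (λ x → d * T (suc i) * (x * r)) (sym (fromℕ-suc (suc i))) ⟩
      d * T (suc i) * (fromℕ (suc (suc i)) * r)           ≡⟨ cong (d * T (suc i) *_) (1/suc-inverse (suc i)) ⟩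
      d * T (suc i) * 1ℚ                                  ≡⟨ ℚₚ.*-identityʳ _ ⟩
      d * T (suc i)                                       ∎
      where
      t : ℚ → ℚ
      t a = term a (suc i)
      r = 1/suc (suc i)
      d = ∣ p - q ∣
      f = fromℕ (suc i)
      monoʳ : ∀ {a b} → a ≤ b → a * r ≤ b * r
      monoʳ = ℚₚ.*-monoʳ-≤-nonNeg r {{ℚ.nonNegative (0≤1/suc (suc i))}}
      TiB : d * T i * B ≡ d * (T (suc i) * f)
      TiB = sym (begin-equality
        d * (T i * B * 1/suc i * f)      ≡⟨ solve 5 (λ d t b r f → d :* (t :* b :* r :* f) := d :* t :* b :* (f :* r)) refl d (T i) B (1/suc i) f ⟩
        d * T i * B * (f * 1/suc i)      ≡⟨ cong (d * T i * B *_) (1/suc-inverse i) ⟩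
        d * T i * B * 1ℚ                 ≡⟨ ℚₚ.*-identityʳ _ ⟩
        d * T i * B                      ∎)

    partialSum-difference⁺ : ∀ {p q} → ∣ p ∣ ≤ B → ∣ q ∣ ≤ B → ∀ k →
      ∣ partialSum p (suc k) - partialSum q (suc k) ∣ ≤ partialSum B k * ∣ p - q ∣
    partialSum-difference⁺ {p} {q} p≤B q≤B zero = begin
      ∣ (1ℚ + term p 1) - (1ℚ + term q 1) ∣    ≡⟨ cong ∣_∣ (solve 3 (λ o a b → (o :+ a) :- (o :+ b) := a :- b) refl 1ℚ (term p 1) (term q 1)) ⟩
      ∣ term p 1 - term q 1 ∣                  ≤⟨ term-difference p≤B q≤B 0 ⟩
      ∣ p - q ∣ * 1ℚ                           ≡⟨ ℚₚ.*-comm ∣ p - q ∣ 1ℚ ⟩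
      1ℚ * ∣ p - q ∣                           ∎
    partialSum-difference⁺ {p} {q} p≤B q≤B (suc k) = begin
      ∣ (S p + u p) - (S q + u q) ∣             ≡⟨ cong ∣_∣ (solve 4 (λ a b c d → (a :+ b) :- (c :+ d) := (a :- c) :+ (b :- d)) refl (S p) (u p) (S q) (u q)) ⟩
      ∣ (S p - S q) + (u p - u q) ∣             ≤⟨ ℚₚ.∣p+q∣≤∣p∣+∣q∣ (S p - S q) (u p - u q) ⟩
      ∣ S p - S q ∣ + ∣ u p - u q ∣             ≤⟨ ℚₚ.+-mono-≤ (partialSum-difference⁺ p≤B q≤B k) (term-difference p≤B q≤B (suc k)) ⟩
      partialSum B k * d + d * T (suc k)        ≡⟨ solve 3 (λ a d t → a :* d :+ d :* t := (a :+ t) :* d) refl (partialSum B k) d (T (suc k)) ⟩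
      partialSum B (suc k) * d                  ∎
      where
      d = ∣ p - q ∣
      S u : ℚ → ℚ
      S a = partialSum a (suc k)
      u a = term a (suc (suc k))

    L : ℚ
    L = partialSum B K + T K

    0≤partialSum : ∀ k → 0ℚ ≤ partialSum B k
    0≤partialSum zero    = 0≤T 0
    0≤partialSum (suc k) = 0≤+ (0≤partialSum k) (0≤T (suc k))

    partialSum≤L : ∀ k → K ℕ.≤ k → partialSum B k ≤ L
    partialSum≤L k K≤k = begin
      partialSum B k                                      ≡⟨ solve 2 (λ a b → a := b :+ (a :- b)) refl (partialSum B k) (partialSum B K) ⟩
      partialSum B K + (partialSum B k - partialSum B K)  ≤⟨ ℚₚ.+-monoʳ-≤ (partialSum B K) (ℚₚ.≤-trans (≤∣∣ _) (tail≤T ∣B∣≤B K k ℕₚ.≤-refl K≤k)) ⟩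
      L                                                   ∎
      where
      ∣B∣≤B : ∣ B ∣ ≤ B
      ∣B∣≤B = ℚₚ.≤-reflexive (ℚₚ.0≤p⇒∣p∣≡p (0≤fromℕ b))

    partialSum-difference : ∀ {p q} → ∣ p ∣ ≤ B → ∣ q ∣ ≤ B → ∀ k → K ℕ.≤ k →
      ∣ partialSum p k - partialSum q k ∣ ≤ L * ∣ p - q ∣
    partialSum-difference {p} {q} p≤B q≤B zero    K≤k =
      0≤* {L} (0≤+ (0≤partialSum K) (0≤T K)) (ℚₚ.0≤∣p∣ (p - q))
    partialSum-difference {p} {q} p≤B q≤B (suc k) K≤k = begin
      ∣ partialSum p (suc k) - partialSum q (suc k) ∣    ≤⟨ partialSum-difference⁺ p≤B q≤B k ⟩
      partialSum B k * ∣ p - q ∣                         ≤⟨ ℚₚ.*-monoʳ-≤-nonNeg ∣ p - q ∣ {{ℚₚ.∣-∣-nonNeg (p - q)}} (begin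
          partialSum B k                 ≡⟨ sym (ℚₚ.+-identityʳ _) ⟩
          partialSum B k + 0ℚ            ≤⟨ ℚₚ.+-monoʳ-≤ (partialSum B k) (0≤T (suc k)) ⟩
          partialSum B (suc k)           ≤⟨ partialSum≤L (suc k) K≤k ⟩
          L                              ∎) ⟩
      L * ∣ p - q ∣                                      ∎

    partialSum-close : ∀ {p q δ ε N} k n → ∣ p ∣ ≤ B → ∣ q ∣ ≤ B → ∣ p - q ∣ ≤ δ →
      L * δ ≤ ½ * ε → K ℕ.≤ N → T N ≤ ½ * ε → N ℕ.≤ n → n ℕ.≤ k →
      ∣ partialSum p k - partialSum q n ∣ ≤ ε
    partialSum-close {p} {q} {δ} {ε} {N} k n p≤B q≤B p-q≤δ Lδ≤ K≤N TN≤ N≤n n≤k =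
      subst (λ d → ∣ d ∣ ≤ ε)
        (solve 3 (λ a b c → (a :- b) :+ (b :- c) := a :- c) refl (partialSum p k) (partialSum q k) (partialSum q n))
        (∣∣-split {partialSum p k - partialSum q k} {partialSum q k - partialSum q n}
          (begin
            ∣ partialSum p k - partialSum q k ∣   ≤⟨ partialSum-difference p≤B q≤B k (ℕₚ.≤-trans K≤N (ℕₚ.≤-trans N≤n n≤k)) ⟩
            L * ∣ p - q ∣                         ≤⟨ *-mono (0≤+ (0≤partialSum K) (0≤T K)) p-q≤δ ⟩
            L * δ                                 ≤⟨ Lδ≤ ⟩
            ½ * ε                                 ∎)
          (begin
            ∣ partialSum q k - partialSum q n ∣   ≤⟨ tail≤T q≤B n k (ℕₚ.≤-trans K≤N N≤n) n≤k ⟩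
            T n                                   ≡⟨ cong T (sym (ℕₚ.m∸n+n≡m N≤n)) ⟩
            T (n ℕ.∸ N ℕ.+ N)                     ≤⟨ T-decreasing N (n ℕ.∸ N) K≤N ⟩
            T N                                   ≤⟨ TN≤ ⟩
            ½ * ε                                 ∎))

  abstract
    partialSum-cauchy : ∀ {x} → IsCauchy x → IsCauchy (λ k → partialSum (x k) k)
    partialSum-cauchy {x} cx = CauchyLemmas.centred {λ k → partialSum (x k) k} (λ 0<ε → scale 0<ε (CauchyLemmas.bounded cx))
      where
      Near : ℚ → Set
      Near ε = ∃ λ N → ∀ k → N ℕ.≤ k → ∣ partialSum (x k) k - partialSum (x N) N ∣ ≤ ε
      assemble : ∀ {b δ ε N₁ N₂ N₃} → (∀ k → N₁ ℕ.≤ k → ∣ x k ∣ ≤ fromℕ b) →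
        L b * δ ≤ ½ * ε → b ℕ.+ b ℕ.≤ N₂ → term (fromℕ b) N₂ ≤ ½ * ε →
        (∀ m n → N₃ ℕ.≤ m → N₃ ℕ.≤ n → ∣ x m - x n ∣ ≤ δ) → Near ε
      assemble {b} {N₁ = N₁} {N₂} {N₃} x≤b Lδ≤ 2b≤N₂ TN₂≤ close = N , λ k N≤k →
        partialSum-close b k N (x≤b k (ℕₚ.≤-trans N₁≤N N≤k)) (x≤b N N₁≤N)
          (close k N (ℕₚ.≤-trans N₃≤N N≤k) N₃≤N) Lδ≤ 2b≤N₂ TN₂≤ N₂≤N N≤k
        where
        N : ℕ
        N = N₁ ℕ.+ (N₂ ℕ.+ N₃)
        N₁≤N : N₁ ℕ.≤ N
        N₁≤N = ℕₚ.m≤m+n N₁ (N₂ ℕ.+ N₃)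
        N₂≤N : N₂ ℕ.≤ N
        N₂≤N = ℕₚ.≤-trans (ℕₚ.m≤m+n N₂ N₃) (ℕₚ.m≤n+m (N₂ ℕ.+ N₃) N₁)
        N₃≤N : N₃ ℕ.≤ N
        N₃≤N = ℕₚ.≤-trans (ℕₚ.m≤n+m N₃ N₂) (ℕₚ.m≤n+m (N₂ ℕ.+ N₃) N₁)
      scale : ∀ {ε} → 0ℚ < ε → (∃ λ b → ∃ λ N → ∀ k → N ℕ.≤ k → ∣ x k ∣ ≤ fromℕ b) → Near ε
      scale 0<ε (b , _ , x≤b) =
        let _ , 0<δ , Lδ≤ = shrink (L b) (0<½* 0<ε)
            _ , 2b≤N , TN≤ = T-null b (0<½* 0<ε)
        in assemble {b} x≤b Lδ≤ 2b≤N TN≤ (proj₂ (cx _ 0<δ))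

module Logarithm where
  open RationalLemmas
  open ℚ using (_+_; _*_; _-_; -_; _≤_; _<_; ∣_∣)
  open +-*-Solver using (solve; _:+_; _:*_; _:-_; :-_; _:=_; con)
  open ℚₚ.≤-Reasoning

  -- 1/(a+1) + ⋯ + 1/(a+b)
  harmonic : ℕ → ℕ → ℚ
  harmonic a zero    = 0ℚ
  harmonic a (suc b) = 1/suc a + harmonic (suc a) b

  -- With M = k + 1, this is Σ_{M < i ≤ n M} 1/i = Σ_{M < i ≤ n M} (1/M) · 1/(i/M): the Riemann sum of
  -- 1/t over [1, n] for the mesh 1/M and right endpoints.
  riemannSum : ℕ → ℕ → ℚ
  riemannSum n k = harmonic (suc k) ((n ℕ.∸ 1) ℕ.* suc k)

  harmonic-+ : ∀ a b c → harmonic a (b ℕ.+ c) ≡ harmonic a b + harmonic (a ℕ.+ b) c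
  harmonic-+ a zero    c = sym (trans (ℚₚ.+-identityˡ _) (cong (λ d → harmonic d c) (ℕₚ.+-identityʳ a)))
  harmonic-+ a (suc b) c = begin-equality
    1/suc a + harmonic (suc a) (b ℕ.+ c)                            ≡⟨ cong (1/suc a +_) (harmonic-+ (suc a) b c) ⟩
    1/suc a + (harmonic (suc a) b + harmonic (suc a ℕ.+ b) c)       ≡⟨ sym (ℚₚ.+-assoc (1/suc a) _ _) ⟩
    1/suc a + harmonic (suc a) b + harmonic (suc a ℕ.+ b) c         ≡⟨ cong (λ d → 1/suc a + harmonic (suc a) b + harmonic d c) (sym (ℕₚ.+-suc a b)) ⟩
    1/suc a + harmonic (suc a) b + harmonic (a ℕ.+ suc b) c         ∎

  harmonic-upper : ∀ l a b → l ℕ.≤ a → harmonic a b ≤ fromℕ b * 1/suc l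
  harmonic-upper l a zero    l≤a = ℚₚ.≤-reflexive (sym (ℚₚ.*-zeroˡ (1/suc l)))
  harmonic-upper l a (suc b) l≤a = begin
    1/suc a + harmonic (suc a) b     ≤⟨ ℚₚ.+-mono-≤ (1/suc-anti l≤a) (harmonic-upper l (suc a) b (ℕₚ.m≤n⇒m≤1+n l≤a)) ⟩
    1/suc l + fromℕ b * 1/suc l      ≡⟨ suc-* b (1/suc l) ⟩
    fromℕ (suc b) * 1/suc l          ∎
    where
    suc-* : ∀ b r → r + fromℕ b * r ≡ fromℕ (suc b) * r
    suc-* b r = trans (solve 2 (λ f r → r :+ f :* r := (con 1ℚ :+ f) :* r) refl (fromℕ b) r) (cong (_* r) (sym (fromℕ-suc b)))

  harmonic-lower : ∀ h a b → a ℕ.+ b ℕ.≤ suc h → fromℕ b * 1/suc h ≤ harmonic a b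
  harmonic-lower h a zero    a+b≤ = ℚₚ.≤-reflexive (ℚₚ.*-zeroˡ (1/suc h))
  harmonic-lower h a (suc b) a+b≤ = begin
    fromℕ (suc b) * 1/suc h          ≡⟨ cong (_* 1/suc h) (fromℕ-suc b) ⟩
    (1ℚ + fromℕ b) * 1/suc h         ≡⟨ solve 2 (λ f r → (con 1ℚ :+ f) :* r := r :+ f :* r) refl (fromℕ b) (1/suc h) ⟩
    1/suc h + fromℕ b * 1/suc h      ≤⟨ ℚₚ.+-mono-≤ (1/suc-anti (ℕₚ.≤-trans (ℕₚ.m≤m+n a b) (ℕ.s≤s⁻¹ a+b≤′))) (harmonic-lower h (suc a) b a+b≤′) ⟩
    1/suc a + harmonic (suc a) b     ∎
    where
    a+b≤′ : suc a ℕ.+ b ℕ.≤ suc h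
    a+b≤′ = subst (ℕ._≤ suc h) (ℕₚ.+-suc a b) a+b≤

  suc*1/suc : ∀ r k → fromℕ (suc r) * 1/suc (k ℕ.+ r ℕ.* suc k) ≡ 1/suc k
  suc*1/suc r k = begin-equality
    R * s                          ≡⟨ sym (ℚₚ.*-identityʳ _) ⟩
    R * s * 1ℚ                     ≡⟨ cong (R * s *_) (sym (1/suc-inverse k)) ⟩
    R * s * (fromℕ (suc k) * 1/suc k)   ≡⟨ solve 4 (λ a b c d → a :* b :* (c :* d) := (a :* c) :* b :* d) refl R s (fromℕ (suc k)) (1/suc k) ⟩
    R * fromℕ (suc k) * s * 1/suc k     ≡⟨ cong (λ x → x * s * 1/suc k) (sym (fromℕ-* (suc r) (suc k))) ⟩
    fromℕ (suc r ℕ.* suc k) * s * 1/suc k   ≡⟨ cong (_* 1/suc k) (1/suc-inverse (k ℕ.+ r ℕ.* suc k)) ⟩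
    1ℚ * 1/suc k                   ≡⟨ ℚₚ.*-identityˡ _ ⟩
    1/suc k                        ∎
    where
    R = fromℕ (suc r)
    s = 1/suc (k ℕ.+ r ℕ.* suc k)

  module _ (n : ℕ) where
    private
      r = n ℕ.∸ 1
      H = riemannSum n
      extra : ℕ → ℚ
      extra k = harmonic (suc r ℕ.* suc k) (suc r)

    step : ∀ k → 1/suc (suc k) + H (suc k) ≡ H k + extra k
    step k = begin-equality
      harmonic (suc k) (suc (r ℕ.* suc (suc k)))          ≡⟨ cong (harmonic (suc k)) (ℕ-solve 2 (λ r k → c1 ⊕ r ⊗ (c1 ⊕ (c1 ⊕ k)) ⊜ r ⊗ (c1 ⊕ k) ⊕ (c1 ⊕ r)) refl r k) ⟩
      harmonic (suc k) (r ℕ.* suc k ℕ.+ suc r)            ≡⟨ harmonic-+ (suc k) (r ℕ.* suc k) (suc r) ⟩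
      H k + extra k                                       ∎
      where
      open ℕ-Solver using () renaming (solve to ℕ-solve; _:+_ to _⊕_; _:*_ to _⊗_; _:=_ to _⊜_; con to ℕ-con)
      c1 = ℕ-con 1

    extra≤ : ∀ k → extra k ≤ 1/suc k
    extra≤ k = subst (extra k ≤_) (suc*1/suc r k)
      (harmonic-upper (k ℕ.+ r ℕ.* suc k) (suc r ℕ.* suc k) (suc r) (ℕₚ.n≤1+n _))

    ≤extra : ∀ k → 1/suc (suc k) ≤ extra k
    ≤extra k = subst (_≤ extra k) (suc*1/suc r (suc k))
      (harmonic-lower (suc k ℕ.+ r ℕ.* suc (suc k)) (suc r ℕ.* suc k) (suc r)
        (ℕₚ.≤-reflexive (ℕ-solve 2 (λ r k → (c1 ⊕ r) ⊗ (c1 ⊕ k) ⊕ (c1 ⊕ r) ⊜ (c1 ⊕ r) ⊗ (c1 ⊕ (c1 ⊕ k))) refl r k)))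
      where
      open ℕ-Solver using () renaming (solve to ℕ-solve; _:+_ to _⊕_; _:*_ to _⊗_; _:=_ to _⊜_; con to ℕ-con)
      c1 = ℕ-con 1

    increase : ∀ j k → ∃ λ d → H (j ℕ.+ k) ≡ H k + d × 0ℚ ≤ d × d + 1/suc (j ℕ.+ k) ≤ 1/suc k
    increase zero    k = 0ℚ , sym (ℚₚ.+-identityʳ (H k)) , ℚₚ.≤-refl , ℚₚ.≤-reflexive (ℚₚ.+-identityˡ _)
    increase (suc j) k with increase j k
    ... | d , H≡ , 0≤d , d≤ = d + (e - r′) , eq , 0≤+ 0≤d 0≤e-r′ , (begin
      d + (e - r′) + r′     ≡⟨ solve 3 (λ d e r → d :+ (e :- r) :+ r := d :+ e) refl d e r′ ⟩
      d + e                 ≤⟨ ℚₚ.+-monoʳ-≤ d (extra≤ i) ⟩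
      d + 1/suc i           ≤⟨ d≤ ⟩
      1/suc k               ∎)
      where
      i = j ℕ.+ k
      e = extra i
      r′ = 1/suc (suc i)
      0≤e-r′ : 0ℚ ≤ e - r′
      0≤e-r′ = subst (_≤ e - r′) (ℚₚ.+-inverseʳ r′) (ℚₚ.+-monoˡ-≤ (- r′) (≤extra i))
      eq : H (suc i) ≡ H k + (d + (e - r′))
      eq = begin-equality
        H (suc i)                   ≡⟨ solve 2 (λ h r → h := (r :+ h) :- r) refl (H (suc i)) r′ ⟩
        (r′ + H (suc i)) - r′       ≡⟨ cong (_- r′) (step i) ⟩
        (H i + e) - r′              ≡⟨ cong (λ h → (h + e) - r′) H≡ ⟩
        (H k + d + e) - r′          ≡⟨ solve 4 (λ h d e r → (h :+ d :+ e) :- r := h :+ (d :+ (e :- r))) refl (H k) d e r′ ⟩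
        H k + (d + (e - r′))        ∎

    abstract
      riemannSum-cauchy : IsCauchy H
      riemannSum-cauchy = CauchyLemmas.centred {H} near
        where
        near : ∀ {ε} → 0ℚ < ε → ∃ λ N → ∀ k → N ℕ.≤ k → ∣ H k - H N ∣ ≤ ε
        near {ε} 0<ε with archimedes 1ℚ 0<ε
        ... | N , small = N , bound
          where
          bound : ∀ k → N ℕ.≤ k → ∣ H k - H N ∣ ≤ ε
          bound k N≤k with increase (k ℕ.∸ N) N
          ... | d , H≡ , 0≤d , d≤ = begin
            ∣ H k - H N ∣                 ≡⟨ cong (λ i → ∣ H i - H N ∣) (sym (ℕₚ.m∸n+n≡m N≤k)) ⟩
            ∣ H (k ℕ.∸ N ℕ.+ N) - H N ∣   ≡⟨ cong (λ h → ∣ h - H N ∣) H≡ ⟩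
            ∣ H N + d - H N ∣             ≡⟨ cong ∣_∣ (solve 2 (λ h d → h :+ d :- h := d) refl (H N) d) ⟩
            ∣ d ∣                         ≡⟨ ℚₚ.0≤p⇒∣p∣≡p 0≤d ⟩
            d                             ≡⟨ sym (ℚₚ.+-identityʳ d) ⟩
            d + 0ℚ                        ≤⟨ ℚₚ.+-monoʳ-≤ d (0≤1/suc (k ℕ.∸ N ℕ.+ N)) ⟩
            d + 1/suc (k ℕ.∸ N ℕ.+ N)     ≤⟨ d≤ ⟩
            1/suc N                       ≡⟨ sym (ℚₚ.*-identityˡ (1/suc N)) ⟩
            1ℚ * 1/suc N                  ≤⟨ small N ℕₚ.≤-refl ⟩
            ε                             ∎

-- Real numbers are Cauchy sequences of rationals, with _≈_ as their equality.
record ℝ : Set where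
  constructor mkℝ
  field
    seq      : ℕ → ℚ
    isCauchy : IsCauchy seq
open ℝ public

infix  4 _≈_ _≤_ _<_
infixl 6 _+_ _-_
infixl 7 _*_ _/_⟨_⟩
infix  8 -_
infixr 8 _^_ _**_

_≈_ : ℝ → ℝ → Set
x ≈ y = ∀ ε → 0ℚ ℚ.< ε → ∃ λ N → ∀ k → N ℕ.≤ k → ℚ.∣ seq x k ℚ.- seq y k ∣ ℚ.≤ ε

_≤_ : ℝ → ℝ → Set
x ≤ y = ∀ ε → 0ℚ ℚ.< ε → ∃ λ N → ∀ k → N ℕ.≤ k → seq x k ℚ.≤ seq y k ℚ.+ ε

_<_ : ℝ → ℝ → Set
x < y = ∃ λ ε → 0ℚ ℚ.< ε × ∃ λ N → ∀ k → N ℕ.≤ k → seq x k ℚ.+ ε ℚ.≤ seq y k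

ℚ→ℝ : ℚ → ℝ
ℚ→ℝ q = mkℝ (λ _ → q) (CauchyLemmas.const q)

ℕ→ℝ : ℕ → ℝ
ℕ→ℝ n = ℚ→ℝ (RationalLemmas.fromℕ n)

0ℝ 1ℝ 2ℝ : ℝ
0ℝ = ℚ→ℝ 0ℚ
1ℝ = ℚ→ℝ 1ℚ
2ℝ = ℕ→ℝ 2

_+_ _*_ : ℝ → ℝ → ℝ
x + y = mkℝ (λ k → seq x k ℚ.+ seq y k) (CauchyLemmas.add {seq x} {seq y} (isCauchy x) (isCauchy y))
x * y = mkℝ (λ k → seq x k ℚ.* seq y k) (CauchyLemmas.mul {seq x} {seq y} (isCauchy x) (isCauchy y))

-_ : ℝ → ℝ
- x = mkℝ (λ k → ℚ.- seq x k) (CauchyLemmas.neg {seq x} (isCauchy x))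

_-_ : ℝ → ℝ → ℝ
x - y = x + (- y)

-- The witness ε of 0 < y bounds y from below eventually, so 1/⊔ ε, which sends u to 1/max(u, ε),
-- is eventually the reciprocal of the approximations to y.
_/_⟨_⟩ : (x y : ℝ) → 0ℝ < y → ℝ
x / y ⟨ ε , 0<ε , _ , 0+ε≤y ⟩ = x * mkℝ (λ k → CauchyLemmas.1/⊔ 0<ε (seq y k))
  (CauchyLemmas.recip {seq y} 0<ε (λ k N≤k → subst (ℚ._≤ seq y k) (ℚₚ.+-identityˡ ε) (0+ε≤y k N≤k)) (isCauchy y))

_^_ : ℝ → ℕ → ℝ
x ^ zero  = 1ℝ
x ^ suc k = x * x ^ k

exp : ℝ → ℝ
exp x = mkℝ (λ k → Exponential.partialSum (seq x k) k) (Exponential.partialSum-cauchy {seq x} (isCauchy x))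

-- The natural logarithm of n ≥ 1, as the integral of 1/t over [1, n].  (ln 0 is 0 by convention.)
ln : ℕ → ℝ
ln n = mkℝ (Logarithm.riemannSum n) (Logarithm.riemannSum-cauchy n)

-- n to the real power x, for n ≥ 1
_**_ : ℕ → ℝ → ℝ
n ** x = exp (x * ln n)

-- Undirected multigraphs on n vertices with m labelled edges; the order of the two endpoints of an
-- edge is immaterial below.  Loops are not excluded, but belong to no cut and connect nothing.
record Graph (n m : ℕ) : Set where
  field
    source target : Fin m → Fin n

-- The cut given by side and the one given by its complement are the same partition, and have the
-- same edges.
record Cut (n : ℕ) : Set where
  field
    side      : Subset n
    nonempty  : Nonempty side
    nonempty′ : Nonempty (∁ side)

module _ {n m : ℕ} (G : Graph n m) where
  open Graph G

  crossing : Subset n → Subset m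
  crossing S = tabulate (λ e → lookup S (source e) xor lookup S (target e))

  cutEdges : Cut n → Subset m
  cutEdges C = crossing (Cut.side C)

  value : Cut n → ℕ
  value C = Subset.∣ cutEdges C ∣

  IsMinCutValue : ℕ → Set
  IsMinCutValue c = (∃ λ C → value C ≡ c) × (∀ C → c ℕ.≤ value C)

  -- In the following, F is the set of failed edges.

  CutFails : Cut n → Pred (Subset m) 0ℓ
  CutFails C F = cutEdges C ⊆ F

  CutOfValueAtLeastFails : ℝ → Pred (Subset m) 0ℓ
  CutOfValueAtLeastFails t F = ∃ λ C → t ≤ ℕ→ℝ (value C) × CutFails C F

  Surviving : Subset m → Rel (Fin n) 0ℓ
  Surviving F u v = ∃ λ e → e ∉ F × source e ≡ u × target e ≡ v

  Connected : Pred (Subset m) 0ℓ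
  Connected F = ∀ u v → EqClosure (Surviving F) u v

  Disconnected : Pred (Subset m) 0ℓ
  Disconnected F = ¬ Connected F

  xor≡false⇒≡ : ∀ a b → a xor b ≡ false → a ≡ b
  xor≡false⇒≡ true  true  _ = refl
  xor≡false⇒≡ false false _ = refl

  lookup-crossing : ∀ S e → lookup (crossing S) e ≡ lookup S (source e) xor lookup S (target e)
  lookup-crossing S e = lookup∘tabulate (λ e → lookup S (source e) xor lookup S (target e)) e

  ∉⇒lookup≡false : ∀ {k} {i : Fin k} {S : Subset k} → i ∉ S → lookup S i ≡ false
  ∉⇒lookup≡false {i = i} {S} i∉S = ¬-not (λ eq → i∉S (lookup⇒[]= i S eq))

  failing-cut⇒disconnected : ∀ {F} → (∃ λ C → CutFails C F) → Disconnected F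
  failing-cut⇒disconnected {F} (C , fails) connected = x∈∁p⇒x∉p v∈∁S
    (lookup⇒[]= v S (trans (sym (same-side (connected u v))) ([]=⇒lookup u∈S)))
    where
    open Cut C renaming (side to S)
    u v : Fin n
    u = proj₁ nonempty
    v = proj₁ nonempty′
    u∈S : u ∈ S
    u∈S = proj₂ nonempty
    v∈∁S : v ∈ ∁ S
    v∈∁S = proj₂ nonempty′
    uncut : ∀ {a b} → Surviving F a b → lookup S a ≡ lookup S b
    uncut (e , e∉F , refl , refl) = xor≡false⇒≡ _ _
      (trans (sym (lookup-crossing S e)) (∉⇒lookup≡false (λ e∈ → e∉F (fails e∈))))
    same-side : ∀ {a b} → EqClosure (Surviving F) a b → lookup S a ≡ lookup S b
    same-side = EqClosure.gfold isEquivalence (lookup S) uncut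

  explore : ∀ F S u → Acc _⊃_ S → u ∈ S → (∀ v → v ∈ S → EqClosure (Surviving F) u v) →
    (∃ λ C → CutFails C F) ⊎ (∀ v → EqClosure (Surviving F) u v)
  explore F S u (acc rec) u∈S reach with nonempty? (∁ S)
  ... | no ∁S-empty = inj₂ (λ v → reach v (x∉∁p⇒x∈p (λ v∈∁S → ∁S-empty (v , v∈∁S))))
  ... | yes ∁S-nonempty with any? (λ e → (e ∈? crossing S) ×-dec ¬? (e ∈? F))
  ... | no none = inj₁
    ( record { side = S ; nonempty = u , u∈S ; nonempty′ = ∁S-nonempty }
    , λ {e} e∈ → decidable-stable (e ∈? F) (λ e∉F → none (e , e∈ , e∉F)) )
  ... | yes (e , e∈ , e∉F) with source e ∈? S | target e ∈? S
  ... | yes a∈S | yes b∈S = contradiction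
    (trans (sym ([]=⇒lookup e∈)) (trans (lookup-crossing S e) (cong₂ _xor_ ([]=⇒lookup a∈S) ([]=⇒lookup b∈S)))) λ()
  ... | no  a∉S | no  b∉S = contradiction
    (trans (sym ([]=⇒lookup e∈)) (trans (lookup-crossing S e) (cong₂ _xor_ (∉⇒lookup≡false a∉S) (∉⇒lookup≡false b∉S)))) λ()
  ... | yes a∈S | no  b∉S = explore F (S ∪ ⁅ target e ⁆) u
    (rec (p⊆p∪q _ , target e , q⊆p∪q S _ (x∈⁅x⁆ (target e)) , b∉S)) (p⊆p∪q _ u∈S)
    (λ v v∈ → [ reach v , (λ v∈⁅b⁆ → subst (EqClosure (Surviving F) u) (sym (x∈⁅y⁆⇒x≡y _ v∈⁅b⁆))
      (reach (source e) a∈S ◅◅ EqClosure.return (e , e∉F , refl , refl))) ]′ (x∈p∪q⁻ S ⁅ target e ⁆ v∈))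
  ... | no  a∉S | yes b∈S = explore F (S ∪ ⁅ source e ⁆) u
    (rec (p⊆p∪q _ , source e , q⊆p∪q S _ (x∈⁅x⁆ (source e)) , a∉S)) (p⊆p∪q _ u∈S)
    (λ v v∈ → [ reach v , (λ v∈⁅a⁆ → subst (EqClosure (Surviving F) u) (sym (x∈⁅y⁆⇒x≡y _ v∈⁅a⁆))
      (reach (target e) b∈S ◅◅ EqClosure.symmetric _ (EqClosure.return (e , e∉F , refl , refl)))) ]′
      (x∈p∪q⁻ S ⁅ source e ⁆ v∈))

  failing-cut-or-reachable : ∀ F u →
    (∃ λ C → CutFails C F) ⊎ (∀ v → EqClosure (Surviving F) u v)
  failing-cut-or-reachable F u = explore F ⁅ u ⁆ u (⊃-wellFounded ⁅ u ⁆) (x∈⁅x⁆ u)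
    (λ v v∈⁅u⁆ → subst (EqClosure (Surviving F) u) (sym (x∈⁅y⁆⇒x≡y u v∈⁅u⁆)) (EqClosure.reflexive _))

disconnected? : ∀ {n m} (G : Graph n m) → Decidable (Disconnected G)
disconnected? {zero}  G F = no (λ disconnected → disconnected λ())
disconnected? {suc _} G F with failing-cut-or-reachable G F zero
... | inj₁ cut   = yes (failing-cut⇒disconnected G cut)
... | inj₂ reach = no (λ disconnected → disconnected
  (λ u v → EqClosure.symmetric _ (reach u) ◅◅ reach v))

-- The probability that exactly the edges in F fail
weight : ∀ {m} → ℝ → Subset m → ℝ
weight p []            = 1ℝ
weight p (inside ∷ F)  = p * weight p F
weight p (outside ∷ F) = (1ℝ - p) * weight p F

sum : ∀ {m} → (Subset m → ℝ) → ℝ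
sum {zero}  f = f []
sum {suc m} f = sum (λ F → f (inside ∷ F)) + sum (λ F → f (outside ∷ F))

Pr : ∀ {m} {E : Pred (Subset m) 0ℓ} → ℝ → Decidable E → ℝ
Pr p E? = sum (λ F → if does (E? F) then weight p F else 0ℝ)

-- An event defined by comparing real numbers, such as CutOfValueAtLeastFails, need not be decidable, so
-- its probability need not be a constructive real number.  That it is at most b is taken to mean that
-- every decidable event contained in it has probability at most b.  For 0 ≤ p ≤ 1 and a decidable event
-- (classically, for any event) this says that its own probability is at most b.
PrAtMost : ∀ {m} → ℝ → Pred (Subset m) 0ℓ → ℝ → Set₁
PrAtMost p E b = ∀ {D : Pred _ 0ℓ} (D? : Decidable D) → (∀ F → D F → E F) → Pr p D? ≤ b

{-# OPTIONS --safe #-}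
-- Karger's contraction argument, made deterministic: averaging over the edges that may be contracted
-- shows that the number N of bipartitions of value at most w satisfies N ^ c ≤ n ^ (2 w); for a fractional
-- 2 w / c this rests on a weighted arithmetic-geometric mean inequality.  So if the bipartitions are listed by
-- increasing value, the k-th nontrivial one fails with probability at most (k + 1)^{-(1 + δ/2)}, because the
-- trivial bipartition is counted in N as well.  A cut of value at least α c fails with probability at most
-- A^{-(1 + δ/2)}, where A = n^{2 α}.  The union bound uses the latter for the first A cuts and the former,
-- compared with ∫ x^{-(1 + δ/2)} dx, for the others.  Since every failing cut has value at least c, the case
-- α = 1 bounds the probability of disconnection.
--
-- Comparisons of Cauchy reals are undecidable, but x ≤ y is stable under double negation.  Hence
-- case distinctions between x ≤ y and y ≤ x are allowed in proofs of inequalities.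
module Submission where

open import Data.Nat.Base as ℕ using (ℕ; zero; suc; z≤n; s≤s)
import Data.Nat.Properties as ℕₚ
open import Data.Nat.Solver using () renaming (module +-*-Solver to ℕ-Solver)
open import Data.Product.Base using (∃; _×_; _,_; proj₁; proj₂)
open import Data.Rational.Base as ℚ using (ℚ; 0ℚ; 1ℚ; ½) hiding (module ℚ)
import Data.Rational.Properties as ℚₚ
open import Data.Rational.Solver using (module +-*-Solver)
open import Data.Sum.Base using (_⊎_; inj₁; inj₂)
open import Function.Base using (_∘_; flip)
open import Level using (0ℓ)
open import Relation.Binary.PropositionalEquality using (_≡_; _≢_; refl; sym; trans; cong; cong₂; subst; subst₂)
open import Relation.Nullary using (¬_; yes; no; does; contradiction)
open import Relation.Unary using (Pred; Decidable)

-- On k vertices there are M ≥ k c / 2 non-loop edges, and a vertex set of value at most v is left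
-- uncut by at least M - v of them, so one contraction costs a factor k c / (k c - 2 v). Contraction
-- has to stop at κ + 1 = ⌈2 v / c⌉ vertices, where all 2 ^ (κ + 1) sets are counted. With r = (κ +
-- 1) c - 2 v the denominators are j c + r. Estimating them by j c would give the exponent ⌈2 v / c⌉
-- in place of 2 v / c; the mean inequality recovers the difference. Everything is stated for
-- natural numbers, as c-th powers with denominators cleared.
--
-- The number A is real. Counting the trivial bipartition shifts the ranks by one, and this shift
-- lets the entry at which the rank passes A be charged entirely to the integral from A on. With t =
-- δ/2 the first entries give A^(-t), the integral gives at most A^(-t) / t, and together they make
-- the constant 1 + 2/δ.

-- Power inequalities for natural numbers

module PowerInequalities where
  open import Data.Nat.Base
  open import Data.Nat.Properties

  open ℕ-Solver using (solve; _:+_; _:*_; _:=_; con)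
  open ≤-Reasoning

  ^-distribʳ-* : ∀ o m n → (m * n) ^ o ≡ m ^ o * n ^ o
  ^-distribʳ-* zero    m n = refl
  ^-distribʳ-* (suc o) m n = trans (cong (m * n *_) (^-distribʳ-* o m n))
    (solve 4 (λ m n M N → m :* n :* (M :* N) := m :* M :* (n :* N)) refl m n (m ^ o) (n ^ o))

  2xy≤x²+y² : ∀ x y → 2 * (x * y) ≤ x * x + y * y
  2xy≤x²+y² x y with ≤-total x y
  ... | inj₁ x≤y with m≤n⇒∃[o]m+o≡n x≤y
  ...   | d , refl = subst (2 * (x * (x + d)) ≤_)
    (solve 2 (λ x d → con 2 :* (x :* (x :+ d)) :+ d :* d := x :* x :+ (x :+ d) :* (x :+ d)) refl x d) (m≤m+n _ (d * d))
  2xy≤x²+y² x y | inj₂ y≤x with m≤n⇒∃[o]m+o≡n y≤x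
  ...   | d , refl = subst (2 * ((y + d) * y) ≤_)
    (solve 2 (λ y d → con 2 :* ((y :+ d) :* y) :+ d :* d := (y :+ d) :* (y :+ d) :+ y :* y) refl y d) (m≤m+n _ (d * d))

  -- Bernoulli's inequality (u/w)ⁿ⁺¹ ≥ 1 + (n + 1)(u/w − 1), cleared of denominators and of subtraction.
  bernoulli : ∀ u w n → suc n * (u * w ^ n) ≤ u ^ suc n + n * w ^ suc n
  bernoulli u w zero = ≤-reflexive (solve 1 (λ u → con 1 :* (u :* con 1) := u :* con 1 :+ con 0) refl u)
  bernoulli u w (suc n) = +-cancelʳ-≤ (n * (u * (w * W))) _ _ (begin
    suc (suc n) * (u * (w * W)) + n * (u * (w * W))
      ≡⟨ solve 4 (λ u w W n → (con 2 :+ n) :* (u :* (w :* W)) :+ n :* (u :* (w :* W)) := ((con 1 :+ n) :* W) :* (con 2 :* (u :* w))) refl u w W n ⟩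
    (suc n * W) * (2 * (u * w))
      ≤⟨ *-monoʳ-≤ (suc n * W) (2xy≤x²+y² u w) ⟩
    (suc n * W) * (u * u + w * w)
      ≡⟨ solve 4 (λ u w W n → ((con 1 :+ n) :* W) :* (u :* u :+ w :* w) := u :* ((con 1 :+ n) :* (u :* W)) :+ (con 1 :+ n) :* (w :* (w :* W))) refl u w W n ⟩
    u * (suc n * (u * W)) + suc n * (w * (w * W))
      ≤⟨ +-monoˡ-≤ (suc n * (w * (w * W))) (*-monoʳ-≤ u (bernoulli u w n)) ⟩
    u * (u * U + n * (w * W)) + suc n * (w * (w * W))
      ≡⟨ solve 5 (λ u w U W n → u :* (u :* U :+ n :* (w :* W)) :+ (con 1 :+ n) :* (w :* (w :* W)) := u :* (u :* U) :+ (con 1 :+ n) :* (w :* (w :* W)) :+ n :* (u :* (w :* W))) refl u w U W n ⟩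
    u * (u * U) + suc n * (w * (w * W)) + n * (u * (w * W)) ∎)
    where
    U = u ^ n
    W = w ^ n

  -- Appending x to n numbers of sum s: bernoulli at u = n (s + x), w = (n + 1) s.
  amgm-step : ∀ n s x → suc n ^ suc n * (s ^ n * x) ≤ n ^ n * (s + x) ^ suc n
  amgm-step zero      s x = ≤-trans (≤-reflexive (solve 1 (λ x → con 1 :* (con 1 :* x) := x) refl x))
    (≤-trans (m≤n+m x s) (≤-reflexive (solve 1 (λ y → y := con 1 :* (y :* con 1)) refl (s + x))))
  amgm-step n@(suc _) s x = *-cancelˡ-≤ n (+-cancelʳ-≤ (n * (w * W)) _ _ (begin
    n * (suc n * suc n ^ n * (s ^ n * x)) + n * (w * W)
      ≡⟨ cong (λ z → n * (suc n * suc n ^ n * (s ^ n * x)) + n * (w * z)) (^-distribʳ-* n (suc n) s) ⟩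
    n * (suc n * N * (S * x)) + n * (suc n * s * (N * S))
      ≡⟨ solve 6 (λ a b N S s x → a :* (b :* N :* (S :* x)) :+ a :* (b :* s :* (N :* S)) := b :* (a :* (s :+ x) :* (N :* S))) refl n (suc n) N S s x ⟩
    suc n * (n * (s + x) * (N * S))
      ≡⟨ cong (λ z → suc n * (n * (s + x) * z)) (^-distribʳ-* n (suc n) s) ⟨
    suc n * (u * W)
      ≤⟨ bernoulli u w n ⟩
    u ^ suc n + n * (w * W)
      ≡⟨ cong (_+ n * (w * W)) (^-distribʳ-* (suc n) n (s + x)) ⟩
    n ^ suc n * (s + x) ^ suc n + n * (w * W)
      ≡⟨ cong (_+ n * (w * W)) (*-assoc n (n ^ n) ((s + x) ^ suc n)) ⟩
    n * (n ^ n * (s + x) ^ suc n) + n * (w * W) ∎))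
    where
    u = n * (s + x)
    w = suc n * s
    W = w ^ n
    N = suc n ^ n
    S = s ^ n

  -- Induction on `r`: for `s` copies of `y` alone there is equality, and `amgm-step` appends one
  -- copy of `x` at a time. The factor `n ^ n` cancels even for `n = 0`, because `0 ^ 0` is 1.
  weighted-amgm : ∀ x y r s → (r + s) ^ (r + s) * (x ^ r * y ^ s) ≤ (r * x + s * y) ^ (r + s)
  weighted-amgm x y zero    s = ≤-reflexive (trans (cong (s ^ s *_) (*-identityˡ (y ^ s))) (sym (^-distribʳ-* s s y)))
  weighted-amgm x y (suc r) s = *-cancelˡ-≤ (n ^ n) {{^-nonZero n}} (begin
    n ^ n * (suc n ^ suc n * (x * x ^ r * y ^ s))
      ≡⟨ solve 5 (λ a b x X Y → a :* (b :* (x :* X :* Y)) := b :* (a :* (X :* Y) :* x)) refl (n ^ n) (suc n ^ suc n) x (x ^ r) (y ^ s) ⟩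
    suc n ^ suc n * (n ^ n * (x ^ r * y ^ s) * x)
      ≤⟨ *-monoʳ-≤ (suc n ^ suc n) (*-monoˡ-≤ x (weighted-amgm x y r s)) ⟩
    suc n ^ suc n * (t ^ n * x)
      ≤⟨ amgm-step n t x ⟩
    n ^ n * (t + x) ^ suc n
      ≡⟨ cong (λ z → n ^ n * z ^ suc n) (solve 4 (λ r x s y → r :* x :+ s :* y :+ x := (con 1 :+ r) :* x :+ s :* y) refl r x s y) ⟩
    n ^ n * (suc r * x + s * y) ^ suc n ∎)
    where
    n = r + s
    t = r * x + s * y
    ^-nonZero : ∀ k → NonZero (k ^ k)
    ^-nonZero zero    = _
    ^-nonZero (suc k) = m^n≢0 (suc k) (suc k)

  -- Estimates for the product of the contraction factors

  -- If (κ + 1) c = 2 v + r, then j c + r is k c - 2 v for k = κ + 1 + j: the denominators of the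
  -- contraction factors. The numerators are c times the factors of `rising (suc κ) a`.
  progression : ℕ → ℕ → ℕ → ℕ
  progression c r zero    = 1
  progression c r (suc a) = (suc a * c + r) * progression c r a

  -- j c + r = r (j + 1) + s j is at least c times the weighted geometric mean of j + 1 and j.
  factorial-≤-progression : ∀ r s a → let c = r + s in
    (c ^ a * a !) ^ c * suc a ^ r ≤ progression c r a ^ c
  factorial-≤-progression r s zero = ≤-reflexive (trans (cong₂ _*_ (^-zeroˡ (r + s)) (^-zeroˡ r)) (sym (^-zeroˡ (r + s))))
  factorial-≤-progression r s (suc a) = begin
    (c * c ^ a * (suc a * a !)) ^ c * suc (suc a) ^ r
      ≡⟨ cong (λ z → z ^ c * suc (suc a) ^ r) (solve 4 (λ c C a A → c :* C :* (a :* A) := c :* a :* (C :* A)) refl c (c ^ a) (suc a) (a !)) ⟩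
    (c * suc a * (c ^ a * a !)) ^ c * suc (suc a) ^ r
      ≡⟨ cong (_* suc (suc a) ^ r) (trans (^-distribʳ-* c (c * suc a) (c ^ a * a !)) (cong (_* (c ^ a * a !) ^ c) (trans (^-distribʳ-* c c (suc a)) (cong (c ^ c *_) (^-distribˡ-+-* (suc a) r s))))) ⟩
    c ^ c * (suc a ^ r * suc a ^ s) * (c ^ a * a !) ^ c * suc (suc a) ^ r
      ≡⟨ solve 5 (λ C A B D E → C :* (A :* B) :* D :* E := C :* (E :* B) :* (D :* A)) refl (c ^ c) (suc a ^ r) (suc a ^ s) ((c ^ a * a !) ^ c) (suc (suc a) ^ r) ⟩
    c ^ c * (suc (suc a) ^ r * suc a ^ s) * ((c ^ a * a !) ^ c * suc a ^ r)
      ≤⟨ *-mono-≤ (weighted-amgm (suc (suc a)) (suc a) r s) (factorial-≤-progression r s a) ⟩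
    (r * suc (suc a) + s * suc a) ^ c * progression c r a ^ c
      ≡⟨ cong (λ z → z ^ c * progression c r a ^ c) (solve 3 (λ r s a → r :* (con 2 :+ a) :+ s :* (con 1 :+ a) := (con 1 :+ a) :* (r :+ s) :+ r) refl r s a) ⟩
    (suc a * c + r) ^ c * progression c r a ^ c
      ≡⟨ ^-distribʳ-* c (suc a * c + r) (progression c r a) ⟨
    progression c r (suc a) ^ c ∎
    where c = r + s

  -- Absorbs the `2 ^ suc κ` sets present when contraction stops into the factorial. The 2 that
  -- survives accounts for the two sides of a bipartition.
  2^≤2*! : ∀ κ → 2 ^ suc κ ≤ 2 * suc κ !
  2^≤2*! zero    = ≤-refl
  2^≤2*! (suc κ) = *-monoʳ-≤ 2 (begin
    2 ^ suc κ                ≤⟨ 2^≤2*! κ ⟩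
    2 * suc κ !              ≤⟨ *-monoˡ-≤ (suc κ !) (s≤s (s≤s (z≤n {κ}))) ⟩
    suc (suc κ) * suc κ !    ∎)

  -- Of the factors a + 1, ..., a + κ + 1 the least is kept exact, since in `power-bound` it cancels
  -- against `suc a ^ r`; the other κ are replaced by the largest.
  !-+-≤ : ∀ κ a → (suc κ + a) ! ≤ suc a * a ! * (suc κ + a) ^ κ
  !-+-≤ zero    a = ≤-reflexive (sym (*-identityʳ _))
  !-+-≤ (suc κ) a = begin
    n * (suc κ + a) !                            ≤⟨ *-monoʳ-≤ n (!-+-≤ κ a) ⟩
    n * (suc a * a ! * (suc κ + a) ^ κ)          ≤⟨ *-monoʳ-≤ n (*-monoʳ-≤ (suc a * a !) (^-monoˡ-≤ κ (n≤1+n (suc κ + a)))) ⟩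
    n * (suc a * a ! * n ^ κ)                    ≡⟨ solve 3 (λ x y z → x :* (y :* z) := y :* (x :* z)) refl n (suc a * a !) (n ^ κ) ⟩
    suc a * a ! * (n * n ^ κ)                    ∎
    where n = suc (suc κ) + a

  rising : ℕ → ℕ → ℕ
  rising κ zero    = 1
  rising κ (suc a) = (suc a + κ) * rising κ a

  rising-! : ∀ κ a → rising κ a * κ ! ≡ (a + κ) !
  rising-! κ zero    = *-identityˡ (κ !)
  rising-! κ (suc a) = trans (*-assoc (suc a + κ) (rising κ a) (κ !)) (cong ((suc a + κ) *_) (rising-! κ a))

  2^≤ : ∀ n → 2 ^ suc n ≤ 2 * suc n ^ n
  2^≤ zero    = ≤-refl
  2^≤ (suc n) = *-monoʳ-≤ 2 (^-monoˡ-≤ (suc n) (s≤s (s≤s (z≤n {n}))))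

  -- `κ` is the ceiling of `x / suc c`. The excess `r` and `suc s` add up to the divisor and become
  -- the two weights in `weighted-amgm`.
  round-up : ∀ c x → ∃ λ κ → ∃ λ r → ∃ λ s → suc r + s ≡ suc c × κ * suc c ≡ x + r
  round-up c zero = 0 , 0 , c , refl , refl
  round-up c (suc x) with round-up c x
  ... | κ , suc r , s , eq , eq′ = κ , r , suc s , trans (+-suc (suc r) s) eq , trans eq′ (+-suc x r)
  ... | κ , zero  , s , eq , eq′ = suc κ , c , 0 , cong suc (+-identityʳ c) ,
    cong suc (trans (cong (c +_) eq′) (trans (+-comm c (x + 0)) (cong (_+ c) (+-identityʳ x))))

  -- The factorials cancel, and what remains is 2 (a + 1) n ^ κ to the power c, divided by the gain
  -- (a + 1) ^ r from `factorial-≤-progression`. Hence a + 1 occurs only to the power s, and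
  -- bounding it by n gives the exponent s + κ c, which is exactly w even if c does not divide w.
  power-bound : ∀ X κ r s a w → let c = r + s; n = a + suc κ in .{{_ : NonZero c}} →
    suc κ * c ≡ w + r → X * progression c r a ≤ 2 ^ suc κ * (c ^ a * rising (suc κ) a) →
    X ^ c ≤ 2 ^ c * n ^ w
  power-bound X κ r s a w κc≡ hyp = *-cancelʳ-≤ _ _ (F ^ c * K ^ c * suc a ^ r) {{M≢0}} (begin
    X ^ c * (F ^ c * K ^ c * suc a ^ r)
      ≡⟨ solve 4 (λ x f k y → x :* (f :* k :* y) := x :* (f :* y) :* k) refl (X ^ c) (F ^ c) (K ^ c) (suc a ^ r) ⟩
    X ^ c * (F ^ c * suc a ^ r) * K ^ c
      ≤⟨ *-monoˡ-≤ (K ^ c) (*-monoʳ-≤ (X ^ c) (factorial-≤-progression r s a)) ⟩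
    X ^ c * P ^ c * K ^ c
      ≡⟨ trans (cong (_* K ^ c) (sym (^-distribʳ-* c X P))) (sym (^-distribʳ-* c (X * P) K)) ⟩
    (X * P * K) ^ c
      ≤⟨ ^-monoˡ-≤ c (begin
        X * P * K                           ≤⟨ *-monoˡ-≤ K hyp ⟩
        T * (c ^ a * H) * K                 ≡⟨ solve 4 (λ t c h k → t :* (c :* h) :* k := t :* c :* (h :* k)) refl T (c ^ a) H K ⟩
        T * c ^ a * (H * K)                 ≡⟨ cong (T * c ^ a *_) (trans (rising-! (suc κ) a) (cong _! (+-comm a (suc κ)))) ⟩
        T * c ^ a * (suc κ + a) !           ≤⟨ *-mono-≤ (*-monoˡ-≤ (c ^ a) (2^≤2*! κ)) (!-+-≤ κ a) ⟩
        2 * K * c ^ a * (suc a * a ! * (suc κ + a) ^ κ)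
          ≡⟨ cong (λ m → 2 * K * c ^ a * (suc a * a ! * m ^ κ)) (+-comm (suc κ) a) ⟩
        2 * K * c ^ a * (suc a * a ! * n ^ κ)
          ≡⟨ solve 5 (λ k c b f N → con 2 :* k :* c :* (b :* f :* N) := con 2 :* (k :* ((c :* f) :* (b :* N)))) refl K (c ^ a) (suc a) (a !) (n ^ κ) ⟩
        2 * (K * (F * (suc a * n ^ κ)))     ∎) ⟩
    (2 * (K * (F * (suc a * n ^ κ)))) ^ c
      ≡⟨ trans (^-distribʳ-* c 2 _) (cong (2 ^ c *_) (trans (^-distribʳ-* c K _) (cong (K ^ c *_)
           (trans (^-distribʳ-* c F _) (cong (F ^ c *_) (trans (^-distribʳ-* c (suc a) (n ^ κ))
             (cong₂ _*_ (^-distribˡ-+-* (suc a) r s) (^-*-assoc n κ c)))))))) ⟩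
    2 ^ c * (K ^ c * (F ^ c * (suc a ^ r * suc a ^ s * n ^ (κ * c))))
      ≤⟨ *-monoʳ-≤ (2 ^ c) (*-monoʳ-≤ (K ^ c) (*-monoʳ-≤ (F ^ c) (*-monoˡ-≤ (n ^ (κ * c)) (*-monoʳ-≤ (suc a ^ r) (^-monoˡ-≤ s suc-a≤n))))) ⟩
    2 ^ c * (K ^ c * (F ^ c * (suc a ^ r * n ^ s * n ^ (κ * c))))
      ≡⟨ solve 6 (λ t k f b x y → t :* (k :* (f :* (b :* x :* y))) := t :* (x :* y) :* (f :* k :* b)) refl (2 ^ c) (K ^ c) (F ^ c) (suc a ^ r) (n ^ s) (n ^ (κ * c)) ⟩
    2 ^ c * (n ^ s * n ^ (κ * c)) * (F ^ c * K ^ c * suc a ^ r)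
      ≡⟨ cong (λ z → 2 ^ c * z * (F ^ c * K ^ c * suc a ^ r)) (trans (sym (^-distribˡ-+-* n s (κ * c))) (cong (n ^_) s+κc≡w)) ⟩
    2 ^ c * n ^ w * (F ^ c * K ^ c * suc a ^ r) ∎)
    where
    c = r + s
    n = a + suc κ
    F = c ^ a * a !
    K = suc κ !
    T = 2 ^ suc κ
    P = progression c r a
    H = rising (suc κ) a
    suc-a≤n : suc a ≤ n
    suc-a≤n = subst (suc a ≤_) (sym (+-suc a κ)) (s≤s (m≤m+n a κ))
    s+κc≡w : s + κ * c ≡ w
    s+κc≡w = +-cancelʳ-≡ r _ _ (trans (solve 3 (λ r s k → s :+ k :+ r := r :+ s :+ k) refl r s (κ * c)) κc≡)
    M≢0 : NonZero (F ^ c * K ^ c * suc a ^ r)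
    M≢0 = m*n≢0 _ _ {{m*n≢0 _ _ {{m^n≢0 F c {{m*n≢0 _ _ {{m^n≢0 c a}} {{a !≢0}}}}}} {{m^n≢0 K c {{suc κ !≢0}}}}}} {{m^n≢0 (suc a) r}}

-- Counting small cuts by contraction

module Counting where
  open PowerInequalities
  open import Defs using (Graph; Cut; crossing; value)
  open import Algebra.Properties.Semiring.Sum ℕₚ.+-*-semiring using (sum; sum-cong-≗; *-distribˡ-sum; *-distribʳ-sum; ∑-distrib-+; ∑-comm)
  open import Data.Bool.Base using (Bool; true; false; not; _xor_)
  open import Data.Fin.Base using (Fin; zero; suc; punchIn; punchOut)
  open import Data.Fin.Properties using (punchIn-punchOut) renaming (_≟_ to _≟ᶠ_)
  open import Data.Fin.Subset using (Subset; inside; outside; ⁅_⁆; ∁; ⊥; ⊤; ∣_∣)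
  open import Data.Fin.Subset.Properties using (x∈⁅x⁆)
  open import Data.List.Base using (List; []; _∷_; map; filter; length; _++_)
  open import Data.List.Membership.Propositional using (_∈_)
  open import Data.List.Membership.Propositional.Properties using (∈-filter⁺; ∈-map⁺; ∈-++⁺ˡ; ∈-++⁺ʳ)
  open import Data.List.Properties using (filter-++; filter-notAll; length-++)
  open import Data.List.Relation.Unary.Any as Any using (here)
  open import Data.Nat.Base
  open import Data.Nat.Properties
  open import Data.Vec.Base using ([]; _∷_; lookup; tabulate; insertAt)
  open import Data.Vec.Properties using (insertAt-lookup; insertAt-punchIn; lookup-map; lookup-replicate; []=⇒lookup; lookup⇒[]=; tabulate-cong)

  𝟙 : Bool → ℕ
  𝟙 true  = 1
  𝟙 false = 0

  ∑ˢ : ∀ {n} → (Subset n → ℕ) → ℕ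
  ∑ˢ {zero}  f = f []
  ∑ˢ {suc n} f = ∑ˢ (f ∘ (inside ∷_)) + ∑ˢ (f ∘ (outside ∷_))

  ∑ˢ-cong : ∀ {n} {f g : Subset n → ℕ} → (∀ S → f S ≡ g S) → ∑ˢ f ≡ ∑ˢ g
  ∑ˢ-cong {zero}  f≗g = f≗g []
  ∑ˢ-cong {suc n} f≗g = cong₂ _+_ (∑ˢ-cong (f≗g ∘ (inside ∷_))) (∑ˢ-cong (f≗g ∘ (outside ∷_)))

  ∑ˢ-mono : ∀ {n} {f g : Subset n → ℕ} → (∀ S → f S ≤ g S) → ∑ˢ f ≤ ∑ˢ g
  ∑ˢ-mono {zero}  f≤g = f≤g []
  ∑ˢ-mono {suc n} f≤g = +-mono-≤ (∑ˢ-mono (f≤g ∘ (inside ∷_))) (∑ˢ-mono (f≤g ∘ (outside ∷_)))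

  ∑ˢ-+ : ∀ {n} (f g : Subset n → ℕ) → ∑ˢ (λ S → f S + g S) ≡ ∑ˢ f + ∑ˢ g
  ∑ˢ-+ {zero}  f g = refl
  ∑ˢ-+ {suc n} f g = trans (cong₂ _+_ (∑ˢ-+ (f ∘ (inside ∷_)) (g ∘ (inside ∷_))) (∑ˢ-+ (f ∘ (outside ∷_)) (g ∘ (outside ∷_))))
    (solve 4 (λ a b c d → (a :+ b) :+ (c :+ d) := (a :+ c) :+ (b :+ d)) refl (∑ˢ (f ∘ (inside ∷_))) (∑ˢ (g ∘ (inside ∷_))) (∑ˢ (f ∘ (outside ∷_))) (∑ˢ (g ∘ (outside ∷_))))
    where open ℕ-Solver using (solve; _:+_; _:=_)

  ∑ˢ-*ˡ : ∀ {n} k (f : Subset n → ℕ) → ∑ˢ (λ S → k * f S) ≡ k * ∑ˢ f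
  ∑ˢ-*ˡ {zero}  k f = refl
  ∑ˢ-*ˡ {suc n} k f = trans (cong₂ _+_ (∑ˢ-*ˡ k (f ∘ (inside ∷_))) (∑ˢ-*ˡ k (f ∘ (outside ∷_)))) (sym (*-distribˡ-+ k _ _))

  ∑ˢ-sum-comm : ∀ {n m} (f : Subset n → Fin m → ℕ) → ∑ˢ (λ S → sum (f S)) ≡ sum (λ e → ∑ˢ (λ S → f S e))
  ∑ˢ-sum-comm {zero}  f = refl
  ∑ˢ-sum-comm {suc n} f = trans (cong₂ _+_ (∑ˢ-sum-comm (f ∘ (inside ∷_))) (∑ˢ-sum-comm (f ∘ (outside ∷_))))
    (sym (∑-distrib-+ (λ e → ∑ˢ (λ S → f (inside ∷ S) e)) (λ e → ∑ˢ (λ S → f (outside ∷ S) e))))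

  ∑ˢ≤2^ : ∀ {n} {f : Subset n → ℕ} → (∀ S → f S ≤ 1) → ∑ˢ f ≤ 2 ^ n
  ∑ˢ≤2^ {zero}  f≤1 = f≤1 []
  ∑ˢ≤2^ {suc n} f≤1 = +-mono-≤ (∑ˢ≤2^ (f≤1 ∘ (inside ∷_))) (≤-trans (∑ˢ≤2^ (f≤1 ∘ (outside ∷_))) (≤-reflexive (sym (+-identityʳ _))))

  ∑ˢ-∁ : ∀ {n} (f : Subset n → ℕ) → ∑ˢ (f ∘ ∁) ≡ ∑ˢ f
  ∑ˢ-∁ {zero}  f = refl
  ∑ˢ-∁ {suc n} f = trans (cong₂ _+_ (∑ˢ-∁ (f ∘ (outside ∷_))) (∑ˢ-∁ (f ∘ (inside ∷_)))) (+-comm (∑ˢ (f ∘ (outside ∷_))) _)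

  ∑ˢ-insertAt : ∀ {n} a (f : Subset (suc n) → ℕ) →
    ∑ˢ f ≡ ∑ˢ (λ T → f (insertAt T a inside) + f (insertAt T a outside))
  ∑ˢ-insertAt zero f = sym (∑ˢ-+ (f ∘ (inside ∷_)) (f ∘ (outside ∷_)))
  ∑ˢ-insertAt {suc n} (suc a) f = cong₂ _+_ (∑ˢ-insertAt a (f ∘ (inside ∷_))) (∑ˢ-insertAt a (f ∘ (outside ∷_)))

  sum-mono : ∀ {n} {f g : Fin n → ℕ} → (∀ i → f i ≤ g i) → sum f ≤ sum g
  sum-mono {zero}  f≤g = ≤-refl
  sum-mono {suc n} f≤g = +-mono-≤ (f≤g zero) (sum-mono (f≤g ∘ suc))

  const≤sum : ∀ {n} c {f : Fin n → ℕ} → (∀ i → c ≤ f i) → n * c ≤ sum f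
  const≤sum {zero}  c c≤f = z≤n
  const≤sum {suc n} c c≤f = +-mono-≤ (c≤f zero) (const≤sum c (c≤f ∘ suc))

  ∣tabulate∣ : ∀ {n} (f : Fin n → Bool) → ∣ tabulate f ∣ ≡ sum (𝟙 ∘ f)
  ∣tabulate∣ {zero}  f = refl
  ∣tabulate∣ {suc n} f with f zero
  ... | true  = cong suc (∣tabulate∣ (f ∘ suc))
  ... | false = ∣tabulate∣ (f ∘ suc)

  lookup-⊥ : ∀ {n} (i : Fin n) → lookup ⊥ i ≡ false
  lookup-⊥ i = lookup-replicate i outside

  sum-zero : ∀ {n} {f : Fin n → ℕ} → (∀ i → f i ≡ 0) → sum f ≡ 0
  sum-zero {zero}  f≡0 = refl
  sum-zero {suc n} f≡0 = cong₂ _+_ (f≡0 zero) (sum-zero (f≡0 ∘ suc))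

  sum-⁅⁆ : ∀ {n} (u : Fin n) → sum (λ x → 𝟙 (lookup ⁅ x ⁆ u)) ≡ 1
  sum-⁅⁆ {suc n} zero    = cong suc (sum-zero {n} (λ _ → refl))
  sum-⁅⁆ {suc n} (suc u) = cong₂ _+_ (cong 𝟙 (lookup-⊥ u)) (sum-⁅⁆ u)

  lookup-⁅⁆-punchIn : ∀ {n} (x : Fin (suc n)) j → lookup ⁅ x ⁆ (punchIn x j) ≡ false
  lookup-⁅⁆-punchIn zero    j       = lookup-⊥ j
  lookup-⁅⁆-punchIn (suc x) zero    = refl
  lookup-⁅⁆-punchIn (suc x) (suc j) = lookup-⁅⁆-punchIn x j

  lookup-∁ : ∀ {n} (S : Subset n) i → lookup S i ≡ false → lookup (∁ S) i ≡ true
  lookup-∁ S i eq = trans (lookup-map i not S) (cong not eq)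

  lookup-∁⁻ : ∀ {n} (S : Subset n) i → lookup (∁ S) i ≡ true → lookup S i ≡ false
  lookup-∁⁻ S i eq with lookup S i | trans (sym (lookup-map i not S)) eq
  ... | false | _ = refl

  -- Cut values, loops and degrees

  module _ {n m : ℕ} (G : Graph n m) where
    open Graph G

    cutValue : Subset n → ℕ
    cutValue S = ∣ crossing G S ∣

    MinCut≥ : ℕ → Set
    MinCut≥ c = ∀ (C : Cut n) → c ≤ value G C

    small : ℕ → Subset n → ℕ
    small v S = 𝟙 (does (cutValue S ≤? v))

    smallCuts : ℕ → ℕ
    smallCuts v = ∑ˢ (small v)

    crosses : Subset n → Fin m → Bool
    crosses S e = lookup S (source e) xor lookup S (target e)

    -- Contraction creates loops. They cannot be contracted and cross no cut, so the averages are
    -- taken over the other edges.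
    nonLoop : Fin m → ℕ
    nonLoop e = 𝟙 (not (does (source e ≟ᶠ target e)))

    nonLoops : ℕ
    nonLoops = sum nonLoop

    cutValue≡sum : ∀ S → cutValue S ≡ sum (𝟙 ∘ crosses S)
    cutValue≡sum S = ∣tabulate∣ (crosses S)

    crosses-loop : ∀ S e → source e ≡ target e → crosses S e ≡ false
    crosses-loop S e eq rewrite eq with lookup S (target e)
    ... | true  = refl
    ... | false = refl

    nonLoop-split : ∀ S e → nonLoop e ≡ 𝟙 (crosses S e) + nonLoop e * 𝟙 (not (crosses S e))
    nonLoop-split S e with source e ≟ᶠ target e | crosses S e in eq
    ... | yes s≡t | true  = contradiction (trans (sym eq) (crosses-loop S e s≡t)) λ()
    ... | yes s≡t | false = refl
    ... | no  s≢t | true  = refl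
    ... | no  s≢t | false = refl

    nonLoops-split : ∀ S → nonLoops ≡ cutValue S + sum (λ e → nonLoop e * 𝟙 (not (crosses S e)))
    nonLoops-split S = trans (sum-cong-≗ (nonLoop-split S))
      (trans (∑-distrib-+ (𝟙 ∘ crosses S) (λ e → nonLoop e * 𝟙 (not (crosses S e)))) (cong (_+ sum (λ e → nonLoop e * 𝟙 (not (crosses S e)))) (sym (cutValue≡sum S))))

    sum-singleton-crosses : ∀ e → sum (λ x → 𝟙 (crosses ⁅ x ⁆ e)) ≤ 2 * nonLoop e
    sum-singleton-crosses e with source e ≟ᶠ target e
    ... | yes s≡t = ≤-reflexive (sum-zero (λ x → cong 𝟙 (crosses-loop ⁅ x ⁆ e s≡t)))
    ... | no  s≢t = ≤-trans (sum-mono (λ x → 𝟙-xor (lookup ⁅ x ⁆ (source e)) (lookup ⁅ x ⁆ (target e))))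
      (≤-reflexive (trans (∑-distrib-+ (λ x → 𝟙 (lookup ⁅ x ⁆ (source e))) (λ x → 𝟙 (lookup ⁅ x ⁆ (target e))))
        (cong₂ _+_ (sum-⁅⁆ (source e)) (sum-⁅⁆ (target e)))))
      where
      𝟙-xor : ∀ a b → 𝟙 (a xor b) ≤ 𝟙 a + 𝟙 b
      𝟙-xor true  true  = z≤n
      𝟙-xor true  false = ≤-refl
      𝟙-xor false true  = ≤-refl
      𝟙-xor false false = ≤-refl

  singleton : ∀ {n} → Fin (suc (suc n)) → Cut (suc (suc n))
  singleton x = record
    { side      = ⁅ x ⁆
    ; nonempty  = x , x∈⁅x⁆ x
    ; nonempty′ = y , lookup⇒[]= y (∁ ⁅ x ⁆) (lookup-∁ ⁅ x ⁆ y (lookup-⁅⁆-punchIn x zero))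
    }
    where y = punchIn x zero

  -- Handshake count: with at least two vertices every singleton is a side of a cut, and a non-loop
  -- edge crosses at most two singletons.
  degree-sum : ∀ {n m} (G : Graph (suc (suc n)) m) {c} → MinCut≥ G c → suc (suc n) * c ≤ 2 * nonLoops G
  degree-sum {n} G {c} c≤ = begin
    suc (suc n) * c                                          ≤⟨ const≤sum c (c≤ ∘ singleton) ⟩
    sum (λ x → cutValue G ⁅ x ⁆)                             ≡⟨ sum-cong-≗ (λ x → cutValue≡sum G ⁅ x ⁆) ⟩
    sum (λ x → sum (λ e → 𝟙 (crosses G ⁅ x ⁆ e)))            ≡⟨ ∑-comm (λ x e → 𝟙 (crosses G ⁅ x ⁆ e)) ⟩
    sum (λ e → sum (λ x → 𝟙 (crosses G ⁅ x ⁆ e)))            ≤⟨ sum-mono (sum-singleton-crosses G) ⟩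
    sum (λ e → 2 * nonLoop G e)                              ≡⟨ *-distribˡ-sum 2 (nonLoop G) ⟨
    2 * nonLoops G                                           ∎
    where open ≤-Reasoning

  -- Contraction of one edge

  module Contraction {n m : ℕ} (G : Graph (suc n) m) (e : Fin m) (s≢t : Graph.source G e ≢ Graph.target G e) where
    open Graph G

    a : Fin (suc n)
    a = source e

    j : Fin n
    j = punchOut s≢t

    merge : Fin (suc n) → Fin n
    merge x with a ≟ᶠ x
    ... | yes _   = j
    ... | no  a≢x = punchOut a≢x

    -- All `m` edges are kept, those parallel to `e` as loops, so only the number of vertices
    -- changes during the induction.
    contract : Graph n m
    contract = record { source = merge ∘ source ; target = merge ∘ target }

    expand : Subset n → Subset (suc n)
    expand T = insertAt T a (lookup T j)

    lookup-expand : ∀ T x → lookup (expand T) x ≡ lookup T (merge x)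
    lookup-expand T x with a ≟ᶠ x
    ... | yes refl = insertAt-lookup T a (lookup T j)
    ... | no  a≢x  = trans (cong (lookup (expand T)) (sym (punchIn-punchOut a≢x))) (insertAt-punchIn T a (lookup T j) (punchOut a≢x))

    lookup-target : ∀ T (x : Bool) → lookup (insertAt T a x) (target e) ≡ lookup T j
    lookup-target T x = trans (cong (lookup (insertAt T a x)) (sym (punchIn-punchOut s≢t))) (insertAt-punchIn T a x j)

    cutValue-expand : ∀ T → cutValue G (expand T) ≡ cutValue contract T
    cutValue-expand T = cong ∣_∣ (tabulate-cong (λ f → cong₂ _xor_ (lookup-expand T (source f)) (lookup-expand T (target f))))

    expandCut : Cut n → Cut (suc n)
    expandCut C = record
      { side      = expand S
      ; nonempty  = punchIn a x , lookup⇒[]= _ (expand S) (trans (insertAt-punchIn S a (lookup S j) x) ([]=⇒lookup x∈S))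
      ; nonempty′ = punchIn a y , lookup⇒[]= _ (∁ (expand S)) (lookup-∁ (expand S) (punchIn a y) (trans (insertAt-punchIn S a (lookup S j) y) (lookup-∁⁻ S y ([]=⇒lookup y∈∁S))))
      }
      where
      S = Cut.side C
      x = proj₁ (Cut.nonempty C)
      x∈S = proj₂ (Cut.nonempty C)
      y = proj₁ (Cut.nonempty′ C)
      y∈∁S = proj₂ (Cut.nonempty′ C)

    contract-MinCut≥ : ∀ {c} → MinCut≥ G c → MinCut≥ contract c
    contract-MinCut≥ c≤ C = ≤-trans (c≤ (expandCut C)) (≤-reflexive (cutValue-expand (Cut.side C)))

    -- Of the two ways to extend `T` to the vertex `source e`, only the one that agrees with the
    -- merged vertex leaves `e` uncut.
    uncut-insertAt : ∀ v T → let g = λ S → small G v S * 𝟙 (not (crosses G S e)) in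
      g (insertAt T a inside) + g (insertAt T a outside) ≡ small contract v T
    uncut-insertAt v T = trans (cong₂ _+_ (at inside) (at outside))
      (trans (pick (lookup T j)) (cong (λ w → 𝟙 (does (w ≤? v))) (cutValue-expand T)))
      where
      h : Bool → ℕ
      h x = small G v (insertAt T a x)
      at : ∀ x → h x * 𝟙 (not (crosses G (insertAt T a x) e)) ≡ h x * 𝟙 (not (x xor lookup T j))
      at x = cong (λ z → h x * 𝟙 (not z)) (cong₂ _xor_ (insertAt-lookup T a x) (lookup-target T x))
      pick : ∀ b → h inside * 𝟙 (not (inside xor b)) + h outside * 𝟙 (not (outside xor b)) ≡ h b
      pick true  = trans (cong₂ _+_ (*-identityʳ (h inside)) (*-zeroʳ (h outside))) (+-identityʳ _)
      pick false = cong₂ _+_ (*-zeroʳ (h inside)) (*-identityʳ (h outside))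

    smallCuts-contract : ∀ v → ∑ˢ (λ S → small G v S * 𝟙 (not (crosses G S e))) ≡ smallCuts contract v
    smallCuts-contract v = trans (∑ˢ-insertAt a (λ S → small G v S * 𝟙 (not (crosses G S e)))) (∑ˢ-cong (uncut-insertAt v))

  -- Averaging over the contracted edge

  module _ {n m : ℕ} (G : Graph (suc n) m) where
    open Graph G
    open ℕ-Solver using (solve; _:+_; _:*_; _:=_; con)

    -- Double counting of the pairs of a small set and a non-loop edge that it leaves uncut. A small
    -- set has at least `nonLoops G` - `v` such edges; for a fixed edge such sets are the small sets
    -- of the contracted graph. `Q` and `R` carry the induction hypothesis, a bound by R / Q,
    -- without division.
    contraction-bound : ∀ v Q R →
      (∀ e (s≢t : source e ≢ target e) → smallCuts (Contraction.contract G e s≢t) v * Q ≤ R) →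
      nonLoops G * (smallCuts G v * Q) ≤ v * (smallCuts G v * Q) + nonLoops G * R
    contraction-bound v Q R bound = begin
      M * (C * Q)
        ≡⟨ *-assoc M C Q ⟨
      M * C * Q
        ≡⟨ cong (_* Q) (∑ˢ-*ˡ M (small G v)) ⟨
      ∑ˢ (λ S → M * small G v S) * Q
        ≤⟨ *-monoˡ-≤ Q (∑ˢ-mono split) ⟩
      ∑ˢ (λ S → v * small G v S + sum (λ e → nonLoop G e * uncut S e)) * Q
        ≡⟨ cong (_* Q) (trans (∑ˢ-+ (λ S → v * small G v S) (λ S → sum (λ e → nonLoop G e * uncut S e))) (cong₂ _+_ (∑ˢ-*ˡ v (small G v)) (∑ˢ-sum-comm (λ S e → nonLoop G e * uncut S e)))) ⟩
      (v * C + sum (λ e → ∑ˢ (λ S → nonLoop G e * uncut S e))) * Q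
        ≡⟨ cong (λ z → (v * C + z) * Q) (sum-cong-≗ (λ e → ∑ˢ-*ˡ (nonLoop G e) (λ S → uncut S e))) ⟩
      (v * C + sum (λ e → nonLoop G e * ∑ˢ (λ S → uncut S e))) * Q
        ≡⟨ trans (*-distribʳ-+ Q (v * C) _) (cong₂ _+_ (*-assoc v C Q) (*-distribʳ-sum Q (λ e → nonLoop G e * ∑ˢ (λ S → uncut S e)))) ⟩
      v * (C * Q) + sum (λ e → nonLoop G e * ∑ˢ (λ S → uncut S e) * Q)
        ≤⟨ +-monoʳ-≤ (v * (C * Q)) (sum-mono edge) ⟩
      v * (C * Q) + sum (λ e → nonLoop G e * R)
        ≡⟨ cong (v * (C * Q) +_) (*-distribʳ-sum R (nonLoop G)) ⟨
      v * (C * Q) + M * R ∎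
      where
      open ≤-Reasoning
      M = nonLoops G
      C = smallCuts G v
      uncut : Subset (suc n) → Fin m → ℕ
      uncut S e = small G v S * 𝟙 (not (crosses G S e))
      split : ∀ S → M * small G v S ≤ v * small G v S + sum (λ e → nonLoop G e * uncut S e)
      split S with cutValue G S ≤ᵇ v | ≤ᵇ⇒≤ (cutValue G S) v
      ... | false | _  = ≤-trans (≤-reflexive (*-zeroʳ M)) z≤n
      ... | true  | ≤v = begin
        M * 1             ≡⟨ *-identityʳ M ⟩
        M                 ≡⟨ nonLoops-split G S ⟩
        cutValue G S + sum (λ e → nonLoop G e * 𝟙 (not (crosses G S e)))
          ≤⟨ +-mono-≤ (≤-trans (≤v _) (≤-reflexive (sym (*-identityʳ v)))) (≤-reflexive (sum-cong-≗ (λ e → cong (nonLoop G e *_) (sym (+-identityʳ (𝟙 (not (crosses G S e)))))))) ⟩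
        v * 1 + sum (λ e → nonLoop G e * (1 * 𝟙 (not (crosses G S e)))) ∎
      edge : ∀ e → nonLoop G e * ∑ˢ (λ S → uncut S e) * Q ≤ nonLoop G e * R
      edge e with source e ≟ᶠ target e
      ... | yes _   = z≤n
      ... | no  s≢t = ≤-trans (≤-reflexive (trans (*-assoc 1 (∑ˢ (λ S → uncut S e)) Q) (cong (λ z → 1 * (z * Q)) (Contraction.smallCuts-contract G e s≢t v))))
        (*-monoʳ-≤ 1 (bound e s≢t))

  -- M X ≤ v X + M R says X ≤ R / (1 − v/M), which is weakest for the least M.
  decrease-factor : ∀ {x y} v X R → y ≤ x → x * X ≤ v * X + x * R → y * X ≤ v * X + y * R
  decrease-factor {x} {y} v X R y≤x hyp with ≤-total X R
  ... | inj₁ X≤R = ≤-trans (*-monoʳ-≤ y X≤R) (m≤n+m (y * R) (v * X))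
  ... | inj₂ R≤X with m≤n⇒∃[o]m+o≡n R≤X
  ...   | D , refl = begin
    y * (R + D)                  ≡⟨ *-distribˡ-+ y R D ⟩
    y * R + y * D                ≤⟨ +-monoʳ-≤ (y * R) (≤-trans (*-monoˡ-≤ D y≤x) xD≤) ⟩
    y * R + v * (R + D)          ≡⟨ +-comm (y * R) _ ⟩
    v * (R + D) + y * R          ∎
    where
    open ≤-Reasoning
    xD≤ : x * D ≤ v * (R + D)
    xD≤ = +-cancelʳ-≤ (x * R) _ _ (≤-trans (≤-reflexive (trans (+-comm (x * D) (x * R)) (sym (*-distribˡ-+ x R D)))) hyp)

  smallCuts≤2^ : ∀ {n m} (G : Graph n m) v → smallCuts G v ≤ 2 ^ n
  smallCuts≤2^ G v = ∑ˢ≤2^ (λ S → 𝟙≤1 (does (cutValue G S ≤? v)))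
    where
    𝟙≤1 : ∀ b → 𝟙 b ≤ 1
    𝟙≤1 true  = ≤-refl
    𝟙≤1 false = z≤n

  module _ {m : ℕ} (c r κ v : ℕ) (κc≡ : suc κ * c ≡ 2 * v + r) where
    open ℕ-Solver using (solve; _:+_; _:*_; _:=_; con)
    open ≤-Reasoning

    -- The graph on k = j + κ + 1 vertices contributes the factor k c / (k c - 2 v), where k c - 2 v
    -- = j c + r by `κc≡`. At `suc κ` vertices all subsets are counted.
    smallCuts-progression : ∀ a (G : Graph (a + suc κ) m) → MinCut≥ G c →
      smallCuts G v * progression c r a ≤ 2 ^ suc κ * (c ^ a * rising (suc κ) a)
    smallCuts-progression zero G c≤ = begin
      smallCuts G v * 1               ≡⟨ *-identityʳ _ ⟩
      smallCuts G v                   ≤⟨ smallCuts≤2^ G v ⟩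
      2 ^ suc κ                       ≡⟨ *-identityʳ _ ⟨
      2 ^ suc κ * 1                   ∎
    smallCuts-progression (suc a) G c≤ = begin
      C * ((suc a * c + r) * P)
        ≡⟨ solve 3 (λ C q P → C :* (q :* P) := q :* (C :* P)) refl C (suc a * c + r) P ⟩
      (suc a * c + r) * (C * P)
        -- Adding `2 * v * (C * P)` turns the coefficient `suc a * c + r` into `k * c`, the form
        -- that the averaging inequality has once `2 * M` is lowered to `k * c`.
        ≤⟨ +-cancelˡ-≤ (2 * v * (C * P)) _ _ (≤-trans (≤-reflexive rearrange) factored) ⟩
      k * c * R
        ≡⟨ solve 5 (λ k c t d h → k :* c :* (t :* (d :* h)) := t :* (c :* d :* (k :* h))) refl k c (2 ^ suc κ) (c ^ a) (rising (suc κ) a) ⟩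
      2 ^ suc κ * (c * c ^ a * (k * rising (suc κ) a)) ∎
      where
      k = suc a + suc κ
      C = smallCuts G v
      P = progression c r a
      R = 2 ^ suc κ * (c ^ a * rising (suc κ) a)
      M = nonLoops G
      degree : k * c ≤ 2 * M
      -- The equation exhibits `a + suc κ` as a successor, so that `G` visibly has two vertices.
      degree = go (sym (+-suc a κ)) G c≤
        where
        go : ∀ {l} → suc (a + κ) ≡ l → (G : Graph (suc l) m) → MinCut≥ G c → suc l * c ≤ 2 * nonLoops G
        go refl G c≤ = degree-sum G c≤
      doubled : 2 * M * (C * P) ≤ 2 * v * (C * P) + 2 * M * R
      doubled = begin
        2 * M * (C * P)                    ≡⟨ *-assoc 2 M (C * P) ⟩
        2 * (M * (C * P))                  ≤⟨ *-monoʳ-≤ 2 (contraction-bound G v P R (λ e s≢t →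
                                                smallCuts-progression a (Contraction.contract G e s≢t) (Contraction.contract-MinCut≥ G e s≢t c≤))) ⟩
        2 * (v * (C * P) + M * R)          ≡⟨ solve 4 (λ v x M R → con 2 :* (v :* x :+ M :* R) := con 2 :* v :* x :+ con 2 :* M :* R) refl v (C * P) M R ⟩
        2 * v * (C * P) + 2 * M * R        ∎
      factored : k * c * (C * P) ≤ 2 * v * (C * P) + k * c * R
      factored = decrease-factor (2 * v) (C * P) R degree doubled
      rearrange : 2 * v * (C * P) + (suc a * c + r) * (C * P) ≡ k * c * (C * P)
      rearrange = trans (sym (*-distribʳ-+ (C * P) (2 * v) (suc a * c + r))) (cong (_* (C * P)) (trans
        (solve 3 (λ w b r → w :+ (b :+ r) := b :+ (w :+ r)) refl (2 * v) (suc a * c) r)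
        (trans (cong (suc a * c +_) (sym κc≡)) (sym (*-distribʳ-+ c (suc a) (suc κ))))))

  crossing-∁ : ∀ {n m} (G : Graph n m) S → crossing G (∁ S) ≡ crossing G S
  crossing-∁ G S = tabulate-cong (λ e → trans (cong₂ _xor_ (lookup-map (source e) not S) (lookup-map (target e) not S))
    (not-xor-not (lookup S (source e)) (lookup S (target e))))
    where
    open Graph G
    not-xor-not : ∀ a b → not a xor not b ≡ a xor b
    not-xor-not true  true  = refl
    not-xor-not true  false = refl
    not-xor-not false true  = refl
    not-xor-not false false = refl

  module _ {n m : ℕ} (G : Graph (suc n) m) where

    -- Every bipartition has exactly one side that contains vertex zero.  The trivial bipartition is counted too.
    smallBipartitions : ℕ → ℕ
    smallBipartitions v = ∑ˢ (λ S → small G v (inside ∷ S))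

    smallCuts≡2* : ∀ v → smallCuts G v ≡ 2 * smallBipartitions v
    smallCuts≡2* v = cong (smallBipartitions v +_) (trans (sym (∑ˢ-∁ (λ S → small G v (outside ∷ S))))
      (trans (∑ˢ-cong (λ S → cong (λ F → 𝟙 (does (∣ F ∣ ≤? v))) (crossing-∁ G (inside ∷ S)))) (sym (+-identityʳ _))))

  -- Contraction stops at ⌈2 v / c⌉ vertices, since k c - 2 v is negative for any smaller k. If `G`
  -- itself has fewer vertices, the number of all subsets is already small enough.
  smallCuts-bound : ∀ {n m} c v .{{_ : NonZero c}} .{{_ : NonZero v}} (G : Graph (suc n) m) → MinCut≥ G c →
    smallCuts G v ^ c ≤ 2 ^ c * suc n ^ (2 * v)
  smallCuts-bound {n} {m} c@(suc d) v@(suc _) G c≤ with round-up d (2 * v)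
  -- The ceiling is a successor because `v` is positive.
  ... | suc κ , r , s , r+s≡ , κc≡ with suc κ ≤? suc n
  ...   | yes κ≤n with m≤n⇒∃[o]m+o≡n κ≤n
  ...     | a , κ+a≡n = go c (trans (+-suc r s) r+s≡) κc≡ (trans (+-comm a (suc κ)) κ+a≡n) G c≤
    where
    go : ∀ {l} c .{{_ : NonZero c}} → r + suc s ≡ c → suc κ * c ≡ 2 * v + r → a + suc κ ≡ l → (G : Graph l m) → MinCut≥ G c →
      smallCuts G v ^ c ≤ 2 ^ c * l ^ (2 * v)
    go _ refl κc≡ refl G c≤ = power-bound (smallCuts G v) κ r (suc s) a (2 * v) κc≡
      (smallCuts-progression (r + suc s) r κ v κc≡ a G c≤)
  smallCuts-bound {n} {m} c@(suc d) v@(suc _) G c≤ | suc κ , r , s , r+s≡ , κc≡ | no κ≰n = begin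
    smallCuts G v ^ c             ≤⟨ ^-monoˡ-≤ c (≤-trans (smallCuts≤2^ G v) (2^≤ n)) ⟩
    (2 * suc n ^ n) ^ c           ≡⟨ trans (^-distribʳ-* c 2 (suc n ^ n)) (cong (2 ^ c *_) (^-*-assoc (suc n) n c)) ⟩
    2 ^ c * suc n ^ (n * c)       ≤⟨ *-monoʳ-≤ (2 ^ c) (^-monoʳ-≤ (suc n) nc≤2v) ⟩
    2 ^ c * suc n ^ (2 * v)       ∎
    where
    open ≤-Reasoning
    nc≤2v : n * c ≤ 2 * v
    nc≤2v = ≤-trans (*-monoˡ-≤ c (≤-trans (n≤1+n n) (s≤s⁻¹ (≰⇒> κ≰n)))) (+-cancelʳ-≤ r (κ * c) (2 * v) (begin
      κ * c + r      ≤⟨ +-monoʳ-≤ (κ * c) (≤-trans (m≤m+n r (suc s)) (≤-reflexive (trans (+-suc r s) r+s≡))) ⟩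
      κ * c + c      ≡⟨ +-comm (κ * c) c ⟩
      suc κ * c      ≡⟨ κc≡ ⟩
      2 * v + r      ∎))

  smallBipartitions-bound : ∀ {n m} c v .{{_ : NonZero c}} .{{_ : NonZero v}} (G : Graph (suc n) m) → MinCut≥ G c →
    smallBipartitions G v ^ c ≤ suc n ^ (2 * v)
  smallBipartitions-bound {n} c v G c≤ = *-cancelˡ-≤ (2 ^ c) {{m^n≢0 2 c}} (begin
    2 ^ c * smallBipartitions G v ^ c     ≡⟨ ^-distribʳ-* c 2 (smallBipartitions G v) ⟨
    (2 * smallBipartitions G v) ^ c       ≡⟨ cong (_^ c) (smallCuts≡2* G v) ⟨
    smallCuts G v ^ c                     ≤⟨ smallCuts-bound c v G c≤ ⟩
    2 ^ c * suc n ^ (2 * v)               ∎)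
    where open ≤-Reasoning

  -- Listing the bipartitions by value

  subsets : ∀ n → List (Subset n)
  subsets zero    = [] ∷ []
  subsets (suc n) = map (inside ∷_) (subsets n) ++ map (outside ∷_) (subsets n)

  ∈-subsets : ∀ {n} (S : Subset n) → S ∈ subsets n
  ∈-subsets []            = here refl
  ∈-subsets (inside ∷ S)  = ∈-++⁺ˡ (∈-map⁺ (inside ∷_) (∈-subsets S))
  ∈-subsets {suc n} (outside ∷ S) = ∈-++⁺ʳ (map (inside ∷_) (subsets n)) (∈-map⁺ (outside ∷_) (∈-subsets S))

  module _ {A B : Set} {P : Pred B 0ℓ} (P? : Decidable P) (f : A → B) where
    length-filter-map : ∀ xs → length (filter P? (map f xs)) ≡ length (filter (P? ∘ f) xs)
    length-filter-map []       = refl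
    length-filter-map (x ∷ xs) with does (P? (f x))
    ... | true  = cong suc (length-filter-map xs)
    ... | false = length-filter-map xs

  module _ {A : Set} {P Q : Pred A 0ℓ} (P? : Decidable P) (Q? : Decidable Q) where
    length-filter-comm : ∀ xs → length (filter P? (filter Q? xs)) ≡ length (filter Q? (filter P? xs))
    length-filter-comm []       = refl
    length-filter-comm (x ∷ xs) with does (P? x) in eqP | does (Q? x) in eqQ
    ... | true  | true  rewrite eqP | eqQ = cong suc (length-filter-comm xs)
    ... | true  | false rewrite eqQ = length-filter-comm xs
    ... | false | true  rewrite eqP = length-filter-comm xs
    ... | false | false = length-filter-comm xs

  length-filter-subsets : ∀ {n} {P : Pred (Subset n) 0ℓ} (P? : Decidable P) →
    length (filter P? (subsets n)) ≡ ∑ˢ (λ S → 𝟙 (does (P? S)))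
  length-filter-subsets {zero} P? with does (P? [])
  ... | true  = refl
  ... | false = refl
  length-filter-subsets {suc n} P? = trans (cong length (filter-++ P? (map (inside ∷_) (subsets n)) _))
    (trans (length-++ (filter P? (map (inside ∷_) (subsets n)))) (cong₂ _+_ (half inside) (half outside)))
    where
    half : ∀ b → length (filter P? (map (b ∷_) (subsets n))) ≡ ∑ˢ (λ S → 𝟙 (does (P? (b ∷ S))))
    half b = trans (length-filter-map P? (b ∷_) (subsets n)) (length-filter-subsets (P? ∘ (b ∷_)))

  module _ {n m : ℕ} (G : Graph (suc n) m) where

    bipartitionValue : Subset n → ℕ
    bipartitionValue S = cutValue G (inside ∷ S)

    -- One entry for each bipartition, with repetitions: the union bound depends on a cut only
    -- through its value.
    largeValues : ℕ → List ℕ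
    largeValues a = map bipartitionValue (filter (λ S → a ≤? bipartitionValue S) (subsets n))

    bipartitionValue-⊤ : bipartitionValue ⊤ ≡ 0
    bipartitionValue-⊤ = trans (cutValue≡sum G ⊤) (sum-zero (λ e → cong 𝟙
      (cong₂ _xor_ (lookup-replicate (Graph.source G e) inside) (lookup-replicate (Graph.target G e) inside))))

    -- The trivial bipartition is small but not large.
    largeValues-count : ∀ {a} → 0 < a → ∀ w → length (filter (_≤? w) (largeValues a)) < smallBipartitions G w
    largeValues-count {a} 0<a w = begin-strict
      length (filter (_≤? w) (largeValues a))
        ≡⟨ length-filter-map (_≤? w) (bipartitionValue) (filter large? (subsets n)) ⟩
      length (filter small? (filter large? (subsets n)))
        ≡⟨ length-filter-comm small? large? (subsets n) ⟩
      length (filter large? (filter small? (subsets n)))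
        <⟨ filter-notAll large? (filter small? (subsets n)) (Any.map (λ { refl → ⊤-not-large }) ⊤∈) ⟩
      length (filter small? (subsets n))
        ≡⟨ length-filter-subsets small? ⟩
      smallBipartitions G w ∎
      where
      open ≤-Reasoning
      large? : Decidable (λ S → a ≤ bipartitionValue S)
      large? S = a ≤? bipartitionValue S
      small? : Decidable (λ S → bipartitionValue S ≤ w)
      small? S = bipartitionValue S ≤? w
      ⊤-not-large : ¬ (a ≤ bipartitionValue ⊤)
      ⊤-not-large a≤ = <⇒≱ 0<a (≤-trans a≤ (≤-reflexive bipartitionValue-⊤))
      ⊤∈ : ⊤ ∈ filter small? (subsets n)
      ⊤∈ = ∈-filter⁺ small? (∈-subsets ⊤) (≤-trans (≤-reflexive bipartitionValue-⊤) z≤n)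

-- The product of truncated exponential series

module ExponentialProduct where
  open import Defs using (module RationalLemmas; module Exponential)
  open RationalLemmas
  open Exponential using (term; partialSum; 0≤term; ∣term∣≤)
  open +-*-Solver using (solve; _:+_; _:*_; _:-_; :-_; _:=_; con)
  open import Data.Nat.Base using (_∸_)
  open ℚ using (_+_; _*_; _-_; -_; _≤_; _<_; ∣_∣)
  open ℚₚ.≤-Reasoning

  ≤-+ : ∀ a {b} → 0ℚ ℚ.≤ b → a ℚ.≤ a ℚ.+ b
  ≤-+ a {b} 0≤b = subst (ℚ._≤ a ℚ.+ b) (ℚₚ.+-identityʳ a) (ℚₚ.+-monoʳ-≤ a 0≤b)

  Σ≤ : (ℕ → ℚ) → ℕ → ℚ
  Σ≤ f zero    = f zero
  Σ≤ f (suc k) = Σ≤ f k + f (suc k)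

  Σ≤-cong : ∀ {f g} k → (∀ i → i ℕ.≤ k → f i ≡ g i) → Σ≤ f k ≡ Σ≤ g k
  Σ≤-cong zero    f≗g = f≗g 0 z≤n
  Σ≤-cong (suc k) f≗g = cong₂ _+_ (Σ≤-cong k (λ i i≤k → f≗g i (ℕₚ.m≤n⇒m≤1+n i≤k))) (f≗g (suc k) ℕₚ.≤-refl)

  Σ≤-mono : ∀ {f g} k → (∀ i → i ℕ.≤ k → f i ≤ g i) → Σ≤ f k ≤ Σ≤ g k
  Σ≤-mono zero    f≤g = f≤g 0 z≤n
  Σ≤-mono (suc k) f≤g = ℚₚ.+-mono-≤ (Σ≤-mono k (λ i i≤k → f≤g i (ℕₚ.m≤n⇒m≤1+n i≤k))) (f≤g (suc k) ℕₚ.≤-refl)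

  Σ≤-+ : ∀ f g k → Σ≤ (λ i → f i + g i) k ≡ Σ≤ f k + Σ≤ g k
  Σ≤-+ f g zero    = refl
  Σ≤-+ f g (suc k) = trans (cong (_+ (f (suc k) + g (suc k))) (Σ≤-+ f g k))
    (solve 4 (λ a b c d → a :+ b :+ (c :+ d) := a :+ c :+ (b :+ d)) refl (Σ≤ f k) (Σ≤ g k) (f (suc k)) (g (suc k)))

  Σ≤-*ˡ : ∀ c f k → Σ≤ (λ i → c * f i) k ≡ c * Σ≤ f k
  Σ≤-*ˡ c f zero    = refl
  Σ≤-*ˡ c f (suc k) = trans (cong (_+ c * f (suc k)) (Σ≤-*ˡ c f k)) (sym (ℚₚ.*-distribˡ-+ c (Σ≤ f k) (f (suc k))))

  Σ≤-shift : ∀ f k → Σ≤ f (suc k) ≡ f 0 + Σ≤ (λ i → f (suc i)) k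
  Σ≤-shift f zero    = refl
  Σ≤-shift f (suc k) = trans (cong (_+ f (suc (suc k))) (Σ≤-shift f k)) (ℚₚ.+-assoc (f 0) _ _)

  ∣Σ≤∣ : ∀ f k → ∣ Σ≤ f k ∣ ≤ Σ≤ (λ i → ∣ f i ∣) k
  ∣Σ≤∣ f zero    = ℚₚ.≤-refl
  ∣Σ≤∣ f (suc k) = ℚₚ.≤-trans (ℚₚ.∣p+q∣≤∣p∣+∣q∣ (Σ≤ f k) (f (suc k))) (ℚₚ.+-monoˡ-≤ ∣ f (suc k) ∣ (∣Σ≤∣ f k))

  partialSum≡Σ≤ : ∀ q k → partialSum q k ≡ Σ≤ (term q) k
  partialSum≡Σ≤ q zero    = refl
  partialSum≡Σ≤ q (suc k) = cong (_+ term q (suc k)) (partialSum≡Σ≤ q k)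

  suc*term : ∀ q i → fromℕ (suc i) * term q (suc i) ≡ q * term q i
  suc*term q i = begin-equality
    fromℕ (suc i) * (term q i * q * 1/suc i)     ≡⟨ solve 4 (λ f t q r → f :* (t :* q :* r) := (f :* r) :* (q :* t)) refl (fromℕ (suc i)) (term q i) q (1/suc i) ⟩
    (fromℕ (suc i) * 1/suc i) * (q * term q i)   ≡⟨ cong (_* (q * term q i)) (1/suc-inverse i) ⟩
    1ℚ * (q * term q i)                          ≡⟨ ℚₚ.*-identityˡ _ ⟩
    q * term q i                                 ∎

  fromℕ-suc-cancel : ∀ i {a b} → fromℕ (suc i) * a ≡ fromℕ (suc i) * b → a ≡ b
  fromℕ-suc-cancel i {a} {b} eq = trans (sym (recover a)) (trans (cong (1/suc i *_) eq) (recover b))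
    where
    recover : ∀ a → 1/suc i * (fromℕ (suc i) * a) ≡ a
    recover a = trans (solve 3 (λ r f a → r :* (f :* a) := (f :* r) :* a) refl (1/suc i) (fromℕ (suc i)) a)
      (trans (cong (_* a) (1/suc-inverse i)) (ℚₚ.*-identityˡ a))

  module _ (p q : ℚ) where
    convolution : ℕ → ℚ
    convolution l = Σ≤ (λ i → term p i * term q (l ∸ i)) l

    -- l + 1 = i + (l + 1 - i) splits the sum into p and q times the previous convolution.
    suc*convolution : ∀ l → fromℕ (suc l) * convolution (suc l) ≡ (p + q) * convolution l
    suc*convolution l = begin-equality
      fromℕ (suc l) * convolution (suc l)
        ≡⟨ Σ≤-*ˡ (fromℕ (suc l)) c (suc l) ⟨
      Σ≤ (λ i → fromℕ (suc l) * c i) (suc l)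
        ≡⟨ Σ≤-cong (suc l) split ⟩
      Σ≤ (λ i → f i + g i) (suc l)
        ≡⟨ Σ≤-+ f g (suc l) ⟩
      Σ≤ f (suc l) + Σ≤ g (suc l)
        ≡⟨ cong₂ _+_ left right ⟩
      p * convolution l + q * convolution l
        ≡⟨ ℚₚ.*-distribʳ-+ (convolution l) p q ⟨
      (p + q) * convolution l ∎
      where
      c f g d : ℕ → ℚ
      c i = term p i * term q (suc l ∸ i)
      d i = term p i * term q (l ∸ i)
      f i = fromℕ i * c i
      g i = fromℕ (suc l ∸ i) * c i
      split : ∀ i → i ℕ.≤ suc l → fromℕ (suc l) * c i ≡ f i + g i
      split i i≤ = trans (cong (λ m → fromℕ m * c i) (sym (ℕₚ.m+[n∸m]≡n i≤)))
        (trans (cong (_* c i) (fromℕ-+ i (suc l ∸ i))) (ℚₚ.*-distribʳ-+ (c i) (fromℕ i) (fromℕ (suc l ∸ i))))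
      left : Σ≤ f (suc l) ≡ p * convolution l
      left = begin-equality
        Σ≤ f (suc l)                          ≡⟨ Σ≤-shift f l ⟩
        f 0 + Σ≤ (λ i → f (suc i)) l          ≡⟨ cong₂ _+_ (ℚₚ.*-zeroˡ (c 0)) (Σ≤-cong l (λ i _ → begin-equality
            fromℕ (suc i) * (term p (suc i) * term q (l ∸ i))     ≡⟨ ℚₚ.*-assoc (fromℕ (suc i)) (term p (suc i)) (term q (l ∸ i)) ⟨
            fromℕ (suc i) * term p (suc i) * term q (l ∸ i)       ≡⟨ cong (_* term q (l ∸ i)) (suc*term p i) ⟩
            p * term p i * term q (l ∸ i)                         ≡⟨ ℚₚ.*-assoc p (term p i) (term q (l ∸ i)) ⟩
            p * d i                                               ∎)) ⟩
        0ℚ + Σ≤ (λ i → p * d i) l             ≡⟨ ℚₚ.+-identityˡ _ ⟩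
        Σ≤ (λ i → p * d i) l                  ≡⟨ Σ≤-*ˡ p d l ⟩
        p * convolution l                     ∎
      right : Σ≤ g (suc l) ≡ q * convolution l
      right = begin-equality
        Σ≤ g l + g (suc l)                    ≡⟨ cong₂ _+_ (Σ≤-cong l shift) (trans (cong (λ m → fromℕ m * c (suc l)) (ℕₚ.n∸n≡0 l)) (ℚₚ.*-zeroˡ (c (suc l)))) ⟩
        Σ≤ (λ i → q * d i) l + 0ℚ             ≡⟨ ℚₚ.+-identityʳ _ ⟩
        Σ≤ (λ i → q * d i) l                  ≡⟨ Σ≤-*ˡ q d l ⟩
        q * convolution l                     ∎
        where
        shift : ∀ i → i ℕ.≤ l → g i ≡ q * d i
        shift i i≤l = begin-equality
          fromℕ (suc l ∸ i) * (term p i * term q (suc l ∸ i))       ≡⟨ cong (λ m → fromℕ m * (term p i * term q m)) (ℕₚ.+-∸-assoc 1 i≤l) ⟩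
          fromℕ (suc (l ∸ i)) * (term p i * term q (suc (l ∸ i)))   ≡⟨ solve 3 (λ f a b → f :* (a :* b) := a :* (f :* b)) refl (fromℕ (suc (l ∸ i))) (term p i) (term q (suc (l ∸ i))) ⟩
          term p i * (fromℕ (suc (l ∸ i)) * term q (suc (l ∸ i)))   ≡⟨ cong (term p i *_) (suc*term q (l ∸ i)) ⟩
          term p i * (q * term q (l ∸ i))                           ≡⟨ solve 3 (λ q a b → a :* (q :* b) := q :* (a :* b)) refl q (term p i) (term q (l ∸ i)) ⟩
          q * d i                                                   ∎

    -- This is the binomial theorem divided by l!. Both sides satisfy the recurrence of
    -- `suc*convolution`, so that no binomial coefficients are needed.
    convolution≡term : ∀ l → convolution l ≡ term (p + q) l
    convolution≡term zero    = ℚₚ.*-identityˡ 1ℚ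
    convolution≡term (suc l) = fromℕ-suc-cancel l (begin-equality
      fromℕ (suc l) * convolution (suc l)       ≡⟨ suc*convolution l ⟩
      (p + q) * convolution l                   ≡⟨ cong ((p + q) *_) (convolution≡term l) ⟩
      (p + q) * term (p + q) l                  ≡⟨ suc*term (p + q) l ⟨
      fromℕ (suc l) * term (p + q) (suc l)      ∎)

    -- The part of the product of the two series with indices i + j ≤ k.
    triangle-sum : ℕ → ℚ
    triangle-sum k = Σ≤ (λ i → term p i * partialSum q (k ∸ i)) k

    triangle-sum≡partialSum : ∀ k → triangle-sum k ≡ partialSum (p + q) k
    triangle-sum≡partialSum zero    = ℚₚ.*-identityˡ 1ℚ
    triangle-sum≡partialSum (suc k) = begin-equality
      Σ≤ (λ i → term p i * partialSum q (suc k ∸ i)) k + term p (suc k) * partialSum q (k ∸ k)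
        ≡⟨ cong₂ _+_ (Σ≤-cong k step) last ⟩
      Σ≤ (λ i → term p i * partialSum q (k ∸ i) + term p i * term q (suc k ∸ i)) k + term p (suc k) * term q (k ∸ k)
        ≡⟨ cong (_+ term p (suc k) * term q (k ∸ k)) (Σ≤-+ (λ i → term p i * partialSum q (k ∸ i)) (λ i → term p i * term q (suc k ∸ i)) k) ⟩
      triangle-sum k + Σ≤ (λ i → term p i * term q (suc k ∸ i)) k + term p (suc k) * term q (k ∸ k)
        ≡⟨ ℚₚ.+-assoc (triangle-sum k) _ _ ⟩
      triangle-sum k + convolution (suc k)
        ≡⟨ cong₂ _+_ (triangle-sum≡partialSum k) (convolution≡term (suc k)) ⟩
      partialSum (p + q) (suc k) ∎
      where
      step : ∀ i → i ℕ.≤ k → term p i * partialSum q (suc k ∸ i) ≡ term p i * partialSum q (k ∸ i) + term p i * term q (suc k ∸ i)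
      step i i≤k = trans (cong (λ m → term p i * partialSum q m) (ℕₚ.+-∸-assoc 1 i≤k))
        (trans (ℚₚ.*-distribˡ-+ (term p i) (partialSum q (k ∸ i)) (term q (suc (k ∸ i))))
          (cong (λ m → term p i * partialSum q (k ∸ i) + term p i * term q m) (sym (ℕₚ.+-∸-assoc 1 i≤k))))
      last : term p (suc k) * partialSum q (k ∸ k) ≡ term p (suc k) * term q (k ∸ k)
      last = trans (cong (λ m → term p (suc k) * partialSum q m) (ℕₚ.n∸n≡0 k)) (cong (λ m → term p (suc k) * term q m) (sym (ℕₚ.n∸n≡0 k)))

    product-minus-triangle : ∀ k → partialSum p k * partialSum q k - partialSum (p + q) k ≡
      Σ≤ (λ i → term p i * (partialSum q k - partialSum q (k ∸ i))) k
    product-minus-triangle k = begin-equality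
      partialSum p k * partialSum q k - partialSum (p + q) k
        ≡⟨ cong₂ (λ a b → a * partialSum q k - b) (partialSum≡Σ≤ p k) (sym (triangle-sum≡partialSum k)) ⟩
      Σ≤ (term p) k * partialSum q k - triangle-sum k
        ≡⟨ solve 3 (λ a b c → a :* b :- c := b :* a :+ con (- 1ℚ) :* c) refl (Σ≤ (term p) k) (partialSum q k) (triangle-sum k) ⟩
      partialSum q k * Σ≤ (term p) k + - 1ℚ * triangle-sum k
        ≡⟨ cong₂ _+_ (sym (Σ≤-*ˡ (partialSum q k) (term p) k)) (sym (Σ≤-*ˡ (- 1ℚ) (λ i → term p i * partialSum q (k ∸ i)) k)) ⟩
      Σ≤ (λ i → partialSum q k * term p i) k + Σ≤ (λ i → - 1ℚ * (term p i * partialSum q (k ∸ i))) k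
        ≡⟨ Σ≤-+ (λ i → partialSum q k * term p i) (λ i → - 1ℚ * (term p i * partialSum q (k ∸ i))) k ⟨
      Σ≤ (λ i → partialSum q k * term p i + - 1ℚ * (term p i * partialSum q (k ∸ i))) k
        ≡⟨ Σ≤-cong k (λ i _ → solve 3 (λ s t u → s :* t :+ con (- 1ℚ) :* (t :* u) := t :* (s :- u)) refl (partialSum q k) (term p i) (partialSum q (k ∸ i))) ⟩
      Σ≤ (λ i → term p i * (partialSum q k - partialSum q (k ∸ i))) k ∎

  partialSum-gap : ∀ {q Q} → ∣ q ∣ ≤ Q → ∀ j k → ∣ partialSum q (j ℕ.+ k) - partialSum q k ∣ ≤ partialSum Q (j ℕ.+ k) - partialSum Q k
  partialSum-gap {q} {Q} q≤Q zero    k = ℚₚ.≤-reflexive (trans (cong ∣_∣ (ℚₚ.+-inverseʳ (partialSum q k))) (sym (ℚₚ.+-inverseʳ (partialSum Q k))))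
  partialSum-gap {q} {Q} q≤Q (suc j) k = begin
    ∣ partialSum q i + term q (suc i) - partialSum q k ∣       ≡⟨ cong ∣_∣ (rearrange (partialSum q i) (term q (suc i)) (partialSum q k)) ⟩
    ∣ partialSum q i - partialSum q k + term q (suc i) ∣       ≤⟨ ℚₚ.∣p+q∣≤∣p∣+∣q∣ (partialSum q i - partialSum q k) (term q (suc i)) ⟩
    ∣ partialSum q i - partialSum q k ∣ + ∣ term q (suc i) ∣   ≤⟨ ℚₚ.+-mono-≤ (partialSum-gap q≤Q j k) (∣term∣≤ q≤Q (suc i)) ⟩
    partialSum Q i - partialSum Q k + term Q (suc i)           ≡⟨ rearrange (partialSum Q i) (term Q (suc i)) (partialSum Q k) ⟨
    partialSum Q i + term Q (suc i) - partialSum Q k           ∎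
    where
    i = j ℕ.+ k
    rearrange : ∀ a b c → a + b - c ≡ a - c + b
    rearrange = solve 3 (λ a b c → a :+ b :- c := a :- c :+ b) refl

  0≤partialSum′ : ∀ {q} → 0ℚ ≤ q → ∀ k → 0ℚ ≤ partialSum q k
  0≤partialSum′ 0≤q zero    = 0≤term 0≤q 0
  0≤partialSum′ 0≤q (suc k) = 0≤+ (0≤partialSum′ 0≤q k) (0≤term 0≤q (suc k))

  partialSum-mono : ∀ {q} → 0ℚ ≤ q → ∀ j k → partialSum q k ≤ partialSum q (j ℕ.+ k)
  partialSum-mono 0≤q zero    k = ℚₚ.≤-refl
  partialSum-mono {q} 0≤q (suc j) k = ℚₚ.≤-trans (partialSum-mono 0≤q j k) (≤-+ (partialSum q (j ℕ.+ k)) (0≤term 0≤q (suc (j ℕ.+ k))))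

  Σ≤-extend : ∀ {f} → (∀ i → 0ℚ ≤ f i) → ∀ j k → Σ≤ f k ≤ Σ≤ f (j ℕ.+ k)
  Σ≤-extend 0≤f zero    k = ℚₚ.≤-refl
  Σ≤-extend {f} 0≤f (suc j) k = ℚₚ.≤-trans (Σ≤-extend 0≤f j k) (≤-+ (Σ≤ f (j ℕ.+ k)) (0≤f (suc (j ℕ.+ k))))

  -- The indices i, j ≤ k of the product lie in the triangle i + j ≤ 2 k.
  product≤partialSum : ∀ {P} → 0ℚ ≤ P → ∀ k → partialSum P k * partialSum P k ≤ partialSum (P + P) (k ℕ.+ k)
  product≤partialSum {P} 0≤P k = begin
    partialSum P k * partialSum P k                              ≡⟨ cong (partialSum P k *_) (partialSum≡Σ≤ P k) ⟩
    partialSum P k * Σ≤ (term P) k                               ≡⟨ Σ≤-*ˡ (partialSum P k) (term P) k ⟨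
    Σ≤ (λ i → partialSum P k * term P i) k                       ≤⟨ Σ≤-mono k (λ i i≤k → begin
        partialSum P k * term P i                 ≡⟨ ℚₚ.*-comm (partialSum P k) (term P i) ⟩
        term P i * partialSum P k                 ≤⟨ *-mono (0≤term 0≤P i) (subst (λ m → partialSum P k ≤ partialSum P m)
                                                       (trans (ℕₚ.+-comm (k ∸ i) k) (sym (ℕₚ.+-∸-assoc k i≤k))) (partialSum-mono 0≤P (k ∸ i) k)) ⟩
        term P i * partialSum P (k ℕ.+ k ∸ i)     ∎) ⟩
    Σ≤ (λ i → term P i * partialSum P (k ℕ.+ k ∸ i)) k           ≤⟨ Σ≤-extend (λ i → 0≤* (0≤term 0≤P i) (0≤partialSum′ 0≤P (k ℕ.+ k ∸ i))) k k ⟩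
    triangle-sum P P (k ℕ.+ k)                                   ≡⟨ triangle-sum≡partialSum P P (k ℕ.+ k) ⟩
    partialSum (P + P) (k ℕ.+ k)                                 ∎

  -- The product of the partial sums runs over the square i, j ≤ k and differs from the triangle i +
  -- j ≤ k by a corner. There each term is dominated by the one for p = q = P, and the corner for P
  -- lies between the triangles of sizes k and 2 k.
  product-error : ∀ {p q P} → 0ℚ ≤ P → ∣ p ∣ ≤ P → ∣ q ∣ ≤ P → ∀ k →
    ∣ partialSum p k * partialSum q k - partialSum (p + q) k ∣ ≤ partialSum (P + P) (k ℕ.+ k) - partialSum (P + P) k
  product-error {p} {q} {P} 0≤P p≤P q≤P k = begin
    ∣ partialSum p k * partialSum q k - partialSum (p + q) k ∣             ≡⟨ cong ∣_∣ (product-minus-triangle p q k) ⟩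
    ∣ Σ≤ (λ i → term p i * (partialSum q k - partialSum q (k ∸ i))) k ∣    ≤⟨ ∣Σ≤∣ (λ i → term p i * (partialSum q k - partialSum q (k ∸ i))) k ⟩
    Σ≤ (λ i → ∣ term p i * (partialSum q k - partialSum q (k ∸ i)) ∣) k    ≤⟨ Σ≤-mono k termwise ⟩
    Σ≤ (λ i → term P i * (partialSum P k - partialSum P (k ∸ i))) k        ≡⟨ product-minus-triangle P P k ⟨
    partialSum P k * partialSum P k - partialSum (P + P) k                 ≤⟨ ℚₚ.+-monoˡ-≤ (- partialSum (P + P) k) (product≤partialSum 0≤P k) ⟩
    partialSum (P + P) (k ℕ.+ k) - partialSum (P + P) k                    ∎
    where
    termwise : ∀ i → i ℕ.≤ k → ∣ term p i * (partialSum q k - partialSum q (k ∸ i)) ∣ ≤ term P i * (partialSum P k - partialSum P (k ∸ i))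
    termwise i i≤k = begin
      ∣ term p i * (partialSum q k - partialSum q (k ∸ i)) ∣        ≡⟨ ℚₚ.∣p*q∣≡∣p∣*∣q∣ (term p i) (partialSum q k - partialSum q (k ∸ i)) ⟩
      ∣ term p i ∣ * ∣ partialSum q k - partialSum q (k ∸ i) ∣      ≤⟨ *-mono₂ (ℚₚ.0≤∣p∣ _) (0≤term 0≤P i) (∣term∣≤ p≤P i)
                                                                        (subst (λ m → ∣ partialSum q m - partialSum q (k ∸ i) ∣ ≤ partialSum P m - partialSum P (k ∸ i))
                                                                          (ℕₚ.m+[n∸m]≡n i≤k) (partialSum-gap q≤P i (k ∸ i))) ⟩
      term P i * (partialSum P k - partialSum P (k ∸ i))            ∎

open import Defs
open import Data.Bool.Base using (Bool; true; false; _∧_; if_then_else_)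
open import Data.Fin.Base using (Fin; zero; suc)
open import Data.Fin.Subset using (Subset; inside; outside; ∁; _⊆_; ∣_∣)
open import Data.Fin.Subset.Properties using (drop-∷-⊆; ∣p∣≤n; x∈∁p⇒x∉p)
open import Data.List.Base using (List; []; _∷_; foldr; map; filter; length)
open import Data.List.Membership.Propositional using (_∈_)
open import Data.List.Membership.Propositional.Properties using (∈-filter⁺; ∈-map⁺)
open import Data.List.Properties using (filter-all; length-map; map-∘)
open import Data.List.Relation.Binary.Permutation.Propositional as Perm using (_↭_; ↭-sym)
open import Data.List.Relation.Binary.Permutation.Propositional.Properties using (All-resp-↭; ↭-length; filter-↭) renaming (map⁺ to map-↭)
open import Data.List.Relation.Unary.All as All using (All; []; _∷_)
open import Data.List.Relation.Unary.All.Properties using (all-filter; map⁺)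
open import Data.List.Relation.Unary.AllPairs using (AllPairs; []; _∷_)
open import Data.List.Relation.Unary.Any using (here; there)
open import Data.List.Relation.Unary.Linked.Properties using (Linked⇒AllPairs)
import Data.List.Sort
open import Data.Vec.Base as Vec using ([]; _∷_)
open import Relation.Binary.Construct.Closure.Equivalence as EqClosure using ()
open import Relation.Binary.Construct.Closure.ReflexiveTransitive using (_◅◅_)
open import Relation.Binary.Construct.Flip.EqAndOrd using (decTotalOrder)
import Relation.Binary.Reasoning.Base.Double
open import Relation.Binary.Structures using (IsPreorder)
open RationalLemmas
open Exponential using (term; partialSum; 0≤term; tail≤T; T-decreasing; T-null; 0≤T; partialSum-difference; 0≤partialSum)
open Logarithm using (harmonic; riemannSum; harmonic-+; harmonic-lower; suc*1/suc; increase; riemannSum-cauchy)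
open +-*-Solver using (solve; _:+_; _:*_; _:-_; :-_; _:=_; con)
open Counting using (MinCut≥; cutValue; crossing-∁; smallBipartitions; smallBipartitions-bound; subsets; ∈-subsets; bipartitionValue; largeValues; largeValues-count)
open ExponentialProduct using (≤-+; fromℕ-suc-cancel; product-error)

-- Order and arithmetic of the reals

-- The equation says b - a = r - l.  With l ≤ r a sum of known inequalities, it is a ring identity.
linear : ∀ {a b l r} → l ℚ.≤ r → b ℚ.+ l ≡ a ℚ.+ r → a ℚ.≤ b
linear {a} {b} {l} {r} l≤r eq = subst₂ ℚ._≤_
  (solve 2 (λ a r → a :+ r :- r := a) refl a r) (solve 2 (λ b r → b :+ r :- r := b) refl b r)
  (ℚₚ.+-monoˡ-≤ (ℚ.- r) (subst (ℚ._≤ b ℚ.+ r) eq (ℚₚ.+-monoʳ-≤ b l≤r)))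

∣-∣≤⇒≤+ : ∀ a b {e} → ℚ.∣ a ℚ.- b ∣ ℚ.≤ e → a ℚ.≤ b ℚ.+ e
∣-∣≤⇒≤+ a b {e} h = linear (ℚₚ.≤-trans (≤∣∣ (a ℚ.- b)) h)
  (solve 3 (λ a b e → b :+ e :+ (a :- b) := a :+ e) refl a b e)

≤+⇒∣-∣≤ : ∀ {a b e} → a ℚ.≤ b ℚ.+ e → b ℚ.≤ a ℚ.+ e → ℚ.∣ a ℚ.- b ∣ ℚ.≤ e
≤+⇒∣-∣≤ {a} {b} {e} h h′ = ∣∣-≤
  (linear h (solve 3 (λ a b e → e :+ a := a :- b :+ (b :+ e)) refl a b e))
  (linear h′ (solve 3 (λ a b e → e :+ b := :- (a :- b) :+ (a :+ e)) refl a b e))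

Eventually : (ℕ → Set) → Set
Eventually P = ∃ λ N → ∀ k → N ℕ.≤ k → P k

eventually-map : ∀ {P Q : ℕ → Set} → (∀ k → P k → Q k) → Eventually P → Eventually Q
eventually-map f (N , p) = N , λ k N≤k → f k (p k N≤k)

eventually-zip : ∀ {P Q R : ℕ → Set} → (∀ k → P k → Q k → R k) → Eventually P → Eventually Q → Eventually R
eventually-zip f (M , p) (N , q) = M ℕ.+ N , λ k M+N≤k →
  f k (p k (ℕₚ.≤-trans (ℕₚ.m≤m+n M N) M+N≤k)) (q k (ℕₚ.≤-trans (ℕₚ.m≤n+m N M) M+N≤k))

infix 4 _≼_ _≃_

-- x ≤ y and x ≈ y unfold to function types, from which x and y cannot be inferred.
record _≼_ (x y : ℝ) : Set where
  constructor wrap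
  field unwrap : x ≤ y
open _≼_ public

record _≃_ (x y : ℝ) : Set where
  constructor _,_
  field
    ≃⇒≼ : x ≼ y
    ≃⇒≽ : y ≼ x
open _≃_ public

abstract
  pointwise-≼ : ∀ {x y} → (∀ k → seq x k ℚ.≤ seq y k) → x ≼ y
  pointwise-≼ {x} {y} x≤y = wrap λ ε 0<ε → 0 , λ k _ → ℚₚ.≤-trans (x≤y k)
    (subst (ℚ._≤ seq y k ℚ.+ ε) (ℚₚ.+-identityʳ (seq y k)) (ℚₚ.+-monoʳ-≤ (seq y k) (ℚₚ.<⇒≤ 0<ε)))

  eventually-≼ : ∀ {x y} → Eventually (λ k → seq x k ℚ.≤ seq y k) → x ≼ y
  eventually-≼ {x} {y} ev = wrap λ ε 0<ε → eventually-map (λ k x≤y → ℚₚ.≤-trans x≤y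
    (subst (ℚ._≤ seq y k ℚ.+ ε) (ℚₚ.+-identityʳ (seq y k)) (ℚₚ.+-monoʳ-≤ (seq y k) (ℚₚ.<⇒≤ 0<ε)))) ev

  pointwise-≃ : ∀ {x y} → (∀ k → seq x k ≡ seq y k) → x ≃ y
  pointwise-≃ {x} {y} x≡y = pointwise-≼ {x} {y} (λ k → ℚₚ.≤-reflexive (x≡y k)) , pointwise-≼ {y} {x} (λ k → ℚₚ.≤-reflexive (sym (x≡y k)))

  ≼-refl : ∀ {x} → x ≼ x
  ≼-refl {x} = pointwise-≼ {x} {x} (λ k → ℚₚ.≤-refl)

  ≼-trans : ∀ {x y z} → x ≼ y → y ≼ z → x ≼ z
  ≼-trans {x} {y} {z} (wrap x≤y) (wrap y≤z) = wrap λ ε 0<ε → eventually-zip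
    (λ k p q → linear (ℚₚ.+-mono-≤ p q)
      (solve 4 (λ x y z e → z :+ e :+ (x :+ y) := x :+ (y :+ con ½ :* e :+ (z :+ con ½ :* e))) refl (seq x k) (seq y k) (seq z k) ε))
    (x≤y _ (0<½* 0<ε)) (y≤z _ (0<½* 0<ε))

  +-mono : ∀ {x y u v} → x ≼ y → u ≼ v → x + u ≼ y + v
  +-mono {x} {y} {u} {v} (wrap x≤y) (wrap u≤v) = wrap λ ε 0<ε → eventually-zip
    (λ k p q → linear (ℚₚ.+-mono-≤ p q)
      (solve 5 (λ x y u v e → y :+ v :+ e :+ (x :+ u) := x :+ u :+ (y :+ con ½ :* e :+ (v :+ con ½ :* e))) refl (seq x k) (seq y k) (seq u k) (seq v k) ε))
    (x≤y _ (0<½* 0<ε)) (u≤v _ (0<½* 0<ε))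

  neg-mono : ∀ {x y} → x ≼ y → - y ≼ - x
  neg-mono {x} {y} (wrap x≤y) = wrap λ ε 0<ε → eventually-map
    (λ k p → linear p (solve 3 (λ x y e → :- x :+ e :+ x := :- y :+ (y :+ e)) refl (seq x k) (seq y k) ε)) (x≤y ε 0<ε)

  -- From a, b ≥ -η and a, b ≤ B: a b ≥ -η (a + b) - η² ≥ -η (2 B + 1) if η ≤ 1.
  almost-nonNegative-* : ∀ {a b η B} → 0ℚ ℚ.≤ η → η ℚ.≤ 1ℚ → 0ℚ ℚ.≤ a ℚ.+ η → 0ℚ ℚ.≤ b ℚ.+ η → a ℚ.≤ B → b ℚ.≤ B →
    0ℚ ℚ.≤ a ℚ.* b ℚ.+ (B ℚ.+ B ℚ.+ 1ℚ) ℚ.* η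
  almost-nonNegative-* {a} {b} {η} {B} 0≤η η≤1 0≤a 0≤b a≤B b≤B = ℚₚ.≤-trans (0≤* 0≤a 0≤b)
    (linear (*-mono 0≤η (ℚₚ.+-mono-≤ (ℚₚ.+-mono-≤ a≤B b≤B) η≤1))
      (solve 4 (λ a b η B → a :* b :+ (B :+ B :+ con 1ℚ) :* η :+ η :* (a :+ b :+ η) := (a :+ η) :* (b :+ η) :+ η :* (B :+ B :+ con 1ℚ)) refl a b η B))

  min1 : ∀ {δ} → 0ℚ ℚ.< δ → ∃ λ η → 0ℚ ℚ.< η × η ℚ.≤ 1ℚ × η ℚ.≤ δ
  min1 {δ} 0<δ with ℚₚ.≤-total δ 1ℚ
  ... | inj₁ δ≤1 = δ , 0<δ , δ≤1 , ℚₚ.≤-refl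
  ... | inj₂ 1≤δ = 1ℚ , ℚₚ.positive⁻¹ 1ℚ , ℚₚ.≤-refl , 1≤δ

  common-bound : ∀ x y → ∃ λ B → Eventually λ k → ℚ.∣ seq x k ∣ ℚ.≤ fromℕ B × ℚ.∣ seq y k ∣ ℚ.≤ fromℕ B
  common-bound x y = combine (CauchyLemmas.bounded {seq x} (isCauchy x)) (CauchyLemmas.bounded {seq y} (isCauchy y))
    where
    combine : (∃ λ A → Eventually λ k → ℚ.∣ seq x k ∣ ℚ.≤ fromℕ A) → (∃ λ B → Eventually λ k → ℚ.∣ seq y k ∣ ℚ.≤ fromℕ B) →
      ∃ λ B → Eventually λ k → ℚ.∣ seq x k ∣ ℚ.≤ fromℕ B × ℚ.∣ seq y k ∣ ℚ.≤ fromℕ B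
    combine (A , M , x≤A) (B , N , y≤B) = A ℕ.+ B , M ℕ.+ N , λ k M+N≤k →
      ℚₚ.≤-trans (x≤A k (ℕₚ.≤-trans (ℕₚ.m≤m+n M N) M+N≤k)) (fromℕ-mono (ℕₚ.m≤m+n A B)) ,
      ℚₚ.≤-trans (y≤B k (ℕₚ.≤-trans (ℕₚ.m≤n+m N M) M+N≤k)) (fromℕ-mono (ℕₚ.m≤n+m B A))

  tolerance : ∀ L {ε} → 0ℚ ℚ.≤ L → 0ℚ ℚ.< ε → ∃ λ η → 0ℚ ℚ.< η × η ℚ.≤ 1ℚ × L ℚ.* η ℚ.≤ ε
  tolerance L {ε} 0≤L 0<ε = go (shrink L 0<ε)
    where
    go : (∃ λ δ → 0ℚ ℚ.< δ × L ℚ.* δ ℚ.≤ ε) → ∃ λ η → 0ℚ ℚ.< η × η ℚ.≤ 1ℚ × L ℚ.* η ℚ.≤ ε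
    go (δ , 0<δ , Lδ≤ε) = let η , 0<η , η≤1 , η≤δ = min1 0<δ in η , 0<η , η≤1 , ℚₚ.≤-trans (*-mono 0≤L η≤δ) Lδ≤ε

  nonNegative-* : ∀ {x y} → 0ℝ ≼ x → 0ℝ ≼ y → 0ℝ ≼ x * y
  nonNegative-* {x} {y} (wrap 0≤x) (wrap 0≤y) = wrap λ ε 0<ε →
    let B , bound = common-bound x y in go ε 0<ε (fromℕ B , 0≤fromℕ B , bound)
    where
    module _ (ε : ℚ) (B : ℚ) (0≤B : 0ℚ ℚ.≤ B) where
      combine : ∀ η → 0ℚ ℚ.< η → η ℚ.≤ 1ℚ → (B ℚ.+ B ℚ.+ 1ℚ) ℚ.* η ℚ.≤ ε → ∀ a b → ℚ.∣ a ∣ ℚ.≤ B → ℚ.∣ b ∣ ℚ.≤ B →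
        0ℚ ℚ.≤ a ℚ.+ η → 0ℚ ℚ.≤ b ℚ.+ η → 0ℚ ℚ.≤ a ℚ.* b ℚ.+ ε
      combine η 0<η η≤1 Lη≤ε a b a≤B b≤B 0≤a 0≤b = ℚₚ.≤-trans
        (almost-nonNegative-* (ℚₚ.<⇒≤ 0<η) η≤1 0≤a 0≤b (ℚₚ.≤-trans (≤∣∣ a) a≤B) (ℚₚ.≤-trans (≤∣∣ b) b≤B))
        (ℚₚ.+-monoʳ-≤ (a ℚ.* b) Lη≤ε)
      0≤L : 0ℚ ℚ.≤ B ℚ.+ B ℚ.+ 1ℚ
      0≤L = 0≤+ (0≤+ 0≤B 0≤B) (ℚₚ.nonNegative⁻¹ 1ℚ)
    go : ∀ ε → 0ℚ ℚ.< ε → (∃ λ B → 0ℚ ℚ.≤ B × Eventually λ k → ℚ.∣ seq x k ∣ ℚ.≤ B × ℚ.∣ seq y k ∣ ℚ.≤ B) →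
      Eventually λ k → 0ℚ ℚ.≤ seq x k ℚ.* seq y k ℚ.+ ε
    go ε 0<ε (B , 0≤B , bound) =
      let η , 0<η , η≤1 , Lη≤ε = tolerance (B ℚ.+ B ℚ.+ 1ℚ) (0≤L ε B 0≤B) 0<ε in
      eventually-zip (λ k (a≤B , b≤B) (0≤a , 0≤b) → combine ε B 0≤B η 0<η η≤1 Lη≤ε (seq x k) (seq y k) a≤B b≤B 0≤a 0≤b) bound
        (eventually-zip (λ k 0≤a 0≤b → 0≤a , 0≤b) (0≤x η 0<η) (0≤y η 0<η))

  -- The tolerance of `compare`: six parts separate the rational samples, and one part each covers
  -- the drift of `x` and of `y` after the sampled index.
  eighths : ∀ ε → let η = ½ ℚ.* (½ ℚ.* (½ ℚ.* ε)) in η ℚ.+ η ℚ.+ η ℚ.+ η ℚ.+ (η ℚ.+ η ℚ.+ η ℚ.+ η) ≡ ε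
  eighths = solve 1 (λ ε → let η = con ½ :* (con ½ :* (con ½ :* ε)) in η :+ η :+ η :+ η :+ (η :+ η :+ η :+ η) := ε) refl

  module _ (a b c d η : ℚ) where
    private
      8η = η ℚ.+ η ℚ.+ η ℚ.+ η ℚ.+ (η ℚ.+ η ℚ.+ η ℚ.+ η)
      6η = η ℚ.+ η ℚ.+ η ℚ.+ η ℚ.+ (η ℚ.+ η)

    upper-case : ∀ {ε} → 8η ≡ ε → c ℚ.≤ d ℚ.+ 6η → a ℚ.≤ c ℚ.+ η → d ℚ.≤ b ℚ.+ η → a ℚ.≤ b ℚ.+ ε
    upper-case refl c≤d a≤c d≤b = linear (ℚₚ.+-mono-≤ c≤d (ℚₚ.+-mono-≤ a≤c d≤b))
      (solve 5 (λ a b c d η → b :+ (η :+ η :+ η :+ η :+ (η :+ η :+ η :+ η)) :+ (c :+ (a :+ d)) := a :+ (d :+ (η :+ η :+ η :+ η :+ (η :+ η)) :+ (c :+ η :+ (b :+ η)))) refl a b c d η)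

    lower-case : 0ℚ ℚ.≤ η → d ℚ.+ 6η ℚ.≤ c → c ℚ.≤ a ℚ.+ η → b ℚ.≤ d ℚ.+ η → b ℚ.+ (η ℚ.+ η) ℚ.≤ a
    lower-case 0≤η d≤c c≤a b≤d = linear (ℚₚ.+-mono-≤ (ℚₚ.+-mono-≤ d≤c (ℚₚ.+-mono-≤ c≤a b≤d)) (0≤+ 0≤η 0≤η))
      (solve 5 (λ a b c d η → a :+ (d :+ (η :+ η :+ η :+ η :+ (η :+ η)) :+ (c :+ b) :+ con 0ℚ) := b :+ (η :+ η) :+ (c :+ (a :+ η :+ (d :+ η)) :+ (η :+ η))) refl a b c d η)

  module _ (x y : ℝ) (ε : ℚ) where
    Below : Set
    Below = Eventually λ k → seq x k ℚ.≤ seq y k ℚ.+ ε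

    Above : Set
    Above = ∃ λ η → 0ℚ ℚ.< η × Eventually λ k → seq y k ℚ.+ (η ℚ.+ η) ℚ.≤ seq x k

    private
      compare-at : ∀ η → 0ℚ ℚ.< η → η ℚ.+ η ℚ.+ η ℚ.+ η ℚ.+ (η ℚ.+ η ℚ.+ η ℚ.+ η) ≡ ε → ∀ M →
        (∀ k → M ℕ.≤ k → ℚ.∣ seq x k ℚ.- seq x M ∣ ℚ.≤ η) → (∀ k → M ℕ.≤ k → ℚ.∣ seq x M ℚ.- seq x k ∣ ℚ.≤ η) →
        (∀ k → M ℕ.≤ k → ℚ.∣ seq y k ℚ.- seq y M ∣ ℚ.≤ η) → (∀ k → M ℕ.≤ k → ℚ.∣ seq y M ℚ.- seq y k ∣ ℚ.≤ η) →
        seq x M ℚ.≤ seq y M ℚ.+ (η ℚ.+ η ℚ.+ η ℚ.+ η ℚ.+ (η ℚ.+ η)) ⊎ seq y M ℚ.+ (η ℚ.+ η ℚ.+ η ℚ.+ η ℚ.+ (η ℚ.+ η)) ℚ.≤ seq x M →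
        Below ⊎ Above
      compare-at η 0<η 8η≡ε M cx cx′ cy cy′ (inj₁ ≤6η) = inj₁ (M , λ k M≤k →
        upper-case (seq x k) (seq y k) (seq x M) (seq y M) η 8η≡ε ≤6η
          (∣-∣≤⇒≤+ (seq x k) (seq x M) (cx k M≤k)) (∣-∣≤⇒≤+ (seq y M) (seq y k) (cy′ k M≤k)))
      compare-at η 0<η 8η≡ε M cx cx′ cy cy′ (inj₂ 6η≤) = inj₂ (η , 0<η , M , λ k M≤k →
        lower-case (seq x k) (seq y k) (seq x M) (seq y M) η (ℚₚ.<⇒≤ 0<η) 6η≤
          (∣-∣≤⇒≤+ (seq x M) (seq x k) (cx′ k M≤k)) (∣-∣≤⇒≤+ (seq y k) (seq y M) (cy k M≤k)))

      compare-cauchy : ∀ η → 0ℚ ℚ.< η → η ℚ.+ η ℚ.+ η ℚ.+ η ℚ.+ (η ℚ.+ η ℚ.+ η ℚ.+ η) ≡ ε →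
        (∃ λ N → ∀ m n → N ℕ.≤ m → N ℕ.≤ n → ℚ.∣ seq x m ℚ.- seq x n ∣ ℚ.≤ η) →
        (∃ λ N → ∀ m n → N ℕ.≤ m → N ℕ.≤ n → ℚ.∣ seq y m ℚ.- seq y n ∣ ℚ.≤ η) → Below ⊎ Above
      compare-cauchy η 0<η 8η≡ε (M₁ , cx) (M₂ , cy) = compare-at η 0<η 8η≡ε M
        (λ k M≤k → cx k M (ℕₚ.≤-trans M₁≤M M≤k) M₁≤M) (λ k M≤k → cx M k M₁≤M (ℕₚ.≤-trans M₁≤M M≤k))
        (λ k M≤k → cy k M (ℕₚ.≤-trans M₂≤M M≤k) M₂≤M) (λ k M≤k → cy M k M₂≤M (ℕₚ.≤-trans M₂≤M M≤k))
        (ℚₚ.≤-total _ _)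
        where
        M = M₁ ℕ.+ M₂
        M₁≤M = ℕₚ.m≤m+n M₁ M₂
        M₂≤M = ℕₚ.m≤n+m M₂ M₁

    -- The alternatives overlap, so one comparison of rational samples, at an index past both Cauchy
    -- moduli, is enough to decide between them.
    compare : 0ℚ ℚ.< ε → Below ⊎ Above
    compare 0<ε = compare-cauchy _ 0<η (eighths ε) (isCauchy x _ 0<η) (isCauchy y _ 0<η)
      where
      0<η : 0ℚ ℚ.< ½ ℚ.* (½ ℚ.* (½ ℚ.* ε))
      0<η = 0<½* (0<½* (0<½* 0<ε))

  Above⇒≽ : ∀ {x y ε} → Above x y ε → y ≼ x
  Above⇒≽ {x} {y} (η , 0<η , above) = eventually-≼ {y} {x}
    (eventually-map (λ k → ℚₚ.≤-trans (≤-+ (seq y k) (0≤+ (ℚₚ.<⇒≤ 0<η) (ℚₚ.<⇒≤ 0<η)))) above)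

  Above⇒⋠ : ∀ {x y ε} → Above x y ε → ¬ (x ≼ y)
  Above⇒⋠ {x} {y} (η , 0<η , above) (wrap x≤y) = refute (eventually-zip (λ k p q → contradict (seq x k) (seq y k) η p q) above (x≤y η 0<η))
    where
    contradict : ∀ x y η → y ℚ.+ (η ℚ.+ η) ℚ.≤ x → x ℚ.≤ y ℚ.+ η → η ℚ.≤ 0ℚ
    contradict x y η y≤x x≤y = linear (ℚₚ.+-mono-≤ y≤x x≤y)
      (solve 3 (λ x y η → con 0ℚ :+ (y :+ (η :+ η) :+ x) := η :+ (x :+ (y :+ η))) refl x y η)
    refute : ¬ Eventually (λ _ → η ℚ.≤ 0ℚ)
    refute (N , η≤0) = ℚₚ.<-irrefl refl (ℚₚ.<-≤-trans 0<η (η≤0 N ℕₚ.≤-refl))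

  -- If `y ≼ x` is refuted, `compare` never answers `Above`; its answers `Below` for all ε amount to
  -- `x ≼ y`.
  ⋠⇒≽ : ∀ {x y} → ¬ (x ≼ y) → ¬ ¬ (y ≼ x)
  ⋠⇒≽ {x} {y} x⋠y y⋠x = x⋠y (wrap λ ε 0<ε → get ε (compare x y ε 0<ε))
    where
    get : ∀ ε → Below x y ε ⊎ Above x y ε → Below x y ε
    get ε (inj₁ below) = below
    get ε (inj₂ above) = contradiction (Above⇒≽ {x} {y} {ε} above) y⋠x

  ≼-stable : ∀ {x y} → ¬ ¬ (x ≼ y) → x ≼ y
  ≼-stable {x} {y} ¬¬x≼y = wrap λ ε 0<ε → get ε (compare x y ε 0<ε)
    where
    get : ∀ ε → Below x y ε ⊎ Above x y ε → Below x y ε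
    get ε (inj₁ below) = below
    get ε (inj₂ above) = contradiction (Above⇒⋠ {x} {y} {ε} above) ¬¬x≼y

≼-cases : ∀ {x y a b} → (x ≼ y → a ≼ b) → (y ≼ x → a ≼ b) → a ≼ b
≼-cases f g = ≼-stable λ a⋠b → ⋠⇒≽ (λ x≼y → a⋠b (f x≼y)) (λ y≼x → a⋠b (g y≼x))

≃-refl : ∀ {x} → x ≃ x
≃-refl = ≼-refl , ≼-refl

≃-sym : ∀ {x y} → x ≃ y → y ≃ x
≃-sym (p , q) = q , p

≃-trans : ∀ {x y z} → x ≃ y → y ≃ z → x ≃ z
≃-trans (p , q) (p′ , q′) = ≼-trans p p′ , ≼-trans q′ q

≼-isPreorder : IsPreorder _≃_ _≼_
≼-isPreorder = record
  { isEquivalence = record { refl = ≃-refl ; sym = ≃-sym ; trans = ≃-trans }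
  ; reflexive     = ≃⇒≼
  ; trans         = ≼-trans
  }

module ≼-Reasoning = Relation.Binary.Reasoning.Base.Double ≼-isPreorder

abstract
  ≃⇒≈ : ∀ {x y} → x ≃ y → x ≈ y
  ≃⇒≈ {x} {y} (wrap x≤y , wrap y≤x) ε 0<ε = eventually-zip (λ k p q → ≤+⇒∣-∣≤ p q) (x≤y ε 0<ε) (y≤x ε 0<ε)

  ≈⇒≃ : ∀ {x y} → x ≈ y → x ≃ y
  ≈⇒≃ {x} {y} x≈y =
    wrap (λ ε 0<ε → eventually-map (λ k → ∣-∣≤⇒≤+ (seq x k) (seq y k)) (x≈y ε 0<ε)) ,
    wrap (λ ε 0<ε → eventually-map (λ k h → ∣-∣≤⇒≤+ (seq y k) (seq x k) (subst (ℚ._≤ ε) (∣-∣-sym (seq x k) (seq y k)) h)) (x≈y ε 0<ε))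

  +-cong : ∀ {x y u v} → x ≃ y → u ≃ v → x + u ≃ y + v
  +-cong (p , q) (p′ , q′) = +-mono p p′ , +-mono q q′

  +-comm : ∀ x y → x + y ≃ y + x
  +-comm x y = pointwise-≃ {x + y} {y + x} (λ k → ℚₚ.+-comm (seq x k) (seq y k))

  *-comm : ∀ x y → x * y ≃ y * x
  *-comm x y = pointwise-≃ {x * y} {y * x} (λ k → ℚₚ.*-comm (seq x k) (seq y k))

  *-assoc : ∀ x y z → x * y * z ≃ x * (y * z)
  *-assoc x y z = pointwise-≃ {x * y * z} {x * (y * z)} (λ k → ℚₚ.*-assoc (seq x k) (seq y k) (seq z k))

  *-identityˡ : ∀ x → 1ℝ * x ≃ x
  *-identityˡ x = pointwise-≃ {1ℝ * x} {x} (λ k → ℚₚ.*-identityˡ (seq x k))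

  *-zeroˡ : ∀ x → 0ℝ * x ≃ 0ℝ
  *-zeroˡ x = pointwise-≃ {0ℝ * x} {0ℝ} (λ k → ℚₚ.*-zeroˡ (seq x k))

  +-identityˡ : ∀ x → 0ℝ + x ≃ x
  +-identityˡ x = pointwise-≃ {0ℝ + x} {x} (λ k → ℚₚ.+-identityˡ (seq x k))

  *-distribʳ : ∀ x y z → (y + z) * x ≃ y * x + z * x
  *-distribʳ x y z = pointwise-≃ {(y + z) * x} {y * x + z * x} (λ k → ℚₚ.*-distribʳ-+ (seq x k) (seq y k) (seq z k))

  ≼⇒0≼- : ∀ {x y} → x ≼ y → 0ℝ ≼ y - x
  ≼⇒0≼- {x} {y} x≼y = ≼-trans (≃⇒≽ (pointwise-≃ {x - x} {0ℝ} (λ k → ℚₚ.+-inverseʳ (seq x k)))) (+-mono x≼y ≼-refl)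

  0≼-⇒≼ : ∀ {x y} → 0ℝ ≼ y - x → x ≼ y
  0≼-⇒≼ {x} {y} 0≼ = ≼-trans (≃⇒≽ (+-identityˡ x)) (≼-trans (+-mono 0≼ ≼-refl)
    (≃⇒≼ (pointwise-≃ {y - x + x} {y} (λ k → solve 2 (λ x y → y :- x :+ x := y) refl (seq x k) (seq y k)))))

  *-monoˡ : ∀ {x y z} → 0ℝ ≼ z → x ≼ y → z * x ≼ z * y
  *-monoˡ {x} {y} {z} 0≼z x≼y = 0≼-⇒≼ (≼-trans (nonNegative-* 0≼z (≼⇒0≼- x≼y))
    (≃⇒≼ (pointwise-≃ {z * (y - x)} {z * y - z * x} (λ k → solve 3 (λ x y z → z :* (y :- x) := z :* y :- z :* x) refl (seq x k) (seq y k) (seq z k)))))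

  *-monoʳ : ∀ {x y z} → 0ℝ ≼ z → x ≼ y → x * z ≼ y * z
  *-monoʳ {x} {y} {z} 0≼z x≼y = ≼-trans (≃⇒≼ (*-comm x z)) (≼-trans (*-monoˡ 0≼z x≼y) (≃⇒≼ (*-comm z y)))

  *-monoᵇ : ∀ {x y u v} → 0ℝ ≼ u → 0ℝ ≼ y → x ≼ y → u ≼ v → x * u ≼ y * v
  *-monoᵇ 0≼u 0≼y x≼y u≼v = ≼-trans (*-monoʳ 0≼u x≼y) (*-monoˡ 0≼y u≼v)

  nonNegative-+ : ∀ {x y} → 0ℝ ≼ x → 0ℝ ≼ y → 0ℝ ≼ x + y
  nonNegative-+ {x} {y} 0≼x 0≼y = ≼-trans (≃⇒≽ (+-identityˡ 0ℝ)) (+-mono 0≼x 0≼y)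

  ℚ→ℝ-mono : ∀ {p q} → p ℚ.≤ q → ℚ→ℝ p ≼ ℚ→ℝ q
  ℚ→ℝ-mono {p} {q} p≤q = pointwise-≼ {ℚ→ℝ p} {ℚ→ℝ q} (λ _ → p≤q)

  ℚ→ℝ-cancel-≼ : ∀ {p q} → ℚ→ℝ p ≼ ℚ→ℝ q → p ℚ.≤ q
  ℚ→ℝ-cancel-≼ {p} {q} (wrap p≤q) = ℚₚ.≮⇒≥ λ q<p → absurd q<p (p≤q (½ ℚ.* (p ℚ.- q)) (0<½* (0<p-q q<p)))
    where
    0<p-q : q ℚ.< p → 0ℚ ℚ.< p ℚ.- q
    0<p-q q<p = subst (ℚ._< p ℚ.- q) (ℚₚ.+-inverseʳ q) (ℚₚ.+-monoˡ-< (ℚ.- q) q<p)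
    absurd : q ℚ.< p → ¬ (Eventually λ _ → p ℚ.≤ q ℚ.+ ½ ℚ.* (p ℚ.- q))
    absurd q<p (N , h) = ℚₚ.<-irrefl refl (ℚₚ.<-≤-trans (0<½* (0<p-q q<p)) (linear (h N ℕₚ.≤-refl)
      (solve 2 (λ p q → con 0ℚ :+ p := con ½ :* (p :- q) :+ (q :+ con ½ :* (p :- q))) refl p q)))

  ℕ→ℝ-mono : ∀ {m n} → m ℕ.≤ n → ℕ→ℝ m ≼ ℕ→ℝ n
  ℕ→ℝ-mono m≤n = ℚ→ℝ-mono (fromℕ-mono m≤n)

  ℕ→ℝ-cancel-≼ : ∀ {m n} → ℕ→ℝ m ≼ ℕ→ℝ n → m ℕ.≤ n
  ℕ→ℝ-cancel-≼ {m} {n} h = ℕₚ.≮⇒≥ λ n<m → ℚₚ.<-irrefl refl (ℚₚ.<-≤-trans (ℚₚ.positive⁻¹ 1ℚ)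
    (linear (ℚₚ.≤-trans (fromℕ-mono n<m) (ℚ→ℝ-cancel-≼ h)) (trans (ℚₚ.+-identityˡ (fromℕ (suc n))) (fromℕ-suc n))))

  ℕ→ℝ-suc : ∀ n → ℕ→ℝ (suc n) ≃ 1ℝ + ℕ→ℝ n
  ℕ→ℝ-suc n = pointwise-≃ {ℕ→ℝ (suc n)} {1ℝ + ℕ→ℝ n} (λ _ → fromℕ-suc n)

  0≼ℕ→ℝ : ∀ n → 0ℝ ≼ ℕ→ℝ n
  0≼ℕ→ℝ n = ℚ→ℝ-mono (0≤fromℕ n)

*-cong : ∀ {x y u v} → 0ℝ ≼ y → 0ℝ ≼ u → x ≃ y → u ≃ v → x * u ≃ y * v
*-cong 0≼y 0≼u (p , q) (p′ , q′) =
  *-monoᵇ 0≼u 0≼y p p′ , *-monoᵇ (≼-trans 0≼u p′) (≼-trans 0≼y q) q q′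

open ≼-Reasoning

-- The exponential function

abstract
  -- Equality of reals is a relation on sequences, so this needs an estimate: on [-b, b] the partial
  -- sums from index 2 b on are Lipschitz with one common constant.
  exp-cong : ∀ {x y} → x ≃ y → exp x ≃ exp y
  exp-cong {x} {y} x≃y = ≈⇒≃ λ ε 0<ε → go ε 0<ε (common-bound x y)
    where
    go : ∀ ε → 0ℚ ℚ.< ε → (∃ λ B → Eventually λ k → ℚ.∣ seq x k ∣ ℚ.≤ fromℕ B × ℚ.∣ seq y k ∣ ℚ.≤ fromℕ B) →
      Eventually λ k → ℚ.∣ partialSum (seq x k) k ℚ.- partialSum (seq y k) k ∣ ℚ.≤ ε
    go ε 0<ε (b , bound) = let δ , 0<δ , Lδ≤ε = shrink (Exponential.L b) 0<ε in
      eventually-zip (λ k f g → f g) (b ℕ.+ b , λ k K≤k (close , x≤b , y≤b) → ℚₚ.≤-trans (partialSum-difference b x≤b y≤b k K≤k)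
          (ℚₚ.≤-trans (*-mono {Exponential.L b} (0≤+ (0≤partialSum b (b ℕ.+ b)) (0≤T b (b ℕ.+ b))) close) Lδ≤ε))
        (eventually-zip (λ k close bounds → close , bounds) (≃⇒≈ x≃y δ 0<δ) bound)

  -- `product-error` bounds the discrepancy by a piece of the tail of the series at 2 b. It tends to
  -- zero, because from index 4 b on each term is at most half of the preceding one.
  exp-+ : ∀ x y → exp (x + y) ≃ exp x * exp y
  exp-+ x y = ≃-sym (≈⇒≃ λ ε 0<ε → go ε 0<ε (common-bound x y))
    where
    error : ∀ b ε N → b ℕ.+ b ℕ.+ (b ℕ.+ b) ℕ.≤ N → term (fromℕ (b ℕ.+ b)) N ℚ.≤ ε → ∀ k → N ℕ.≤ k → ∀ p q →
      ℚ.∣ p ∣ ℚ.≤ fromℕ b × ℚ.∣ q ∣ ℚ.≤ fromℕ b → ℚ.∣ partialSum p k ℚ.* partialSum q k ℚ.- partialSum (p ℚ.+ q) k ∣ ℚ.≤ ε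
    error b ε N K≤N TN≤ε k N≤k p q (p≤b , q≤b) = ℚₚ.≤-trans (product-error (0≤fromℕ b) p≤b q≤b k)
      (subst (λ B → partialSum B (k ℕ.+ k) ℚ.- partialSum B k ℚ.≤ ε) (fromℕ-+ b b)
        (ℚₚ.≤-trans (≤∣∣ (partialSum B (k ℕ.+ k) ℚ.- partialSum B k))
        (ℚₚ.≤-trans (tail≤T (b ℕ.+ b) {B} (ℚₚ.≤-reflexive (ℚₚ.0≤p⇒∣p∣≡p (0≤fromℕ (b ℕ.+ b)))) k (k ℕ.+ k) (ℕₚ.≤-trans K≤N N≤k) (ℕₚ.m≤m+n k k))
        (ℚₚ.≤-trans (subst (λ m → term B m ℚ.≤ term B N) (ℕₚ.m∸n+n≡m N≤k) (T-decreasing (b ℕ.+ b) N (k ℕ.∸ N) K≤N)) TN≤ε))))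
      where
      B : ℚ
      B = fromℕ (b ℕ.+ b)
    go : ∀ ε → 0ℚ ℚ.< ε → (∃ λ B → Eventually λ k → ℚ.∣ seq x k ∣ ℚ.≤ fromℕ B × ℚ.∣ seq y k ∣ ℚ.≤ fromℕ B) →
      Eventually λ k → ℚ.∣ partialSum (seq x k) k ℚ.* partialSum (seq y k) k ℚ.- partialSum (seq x k ℚ.+ seq y k) k ∣ ℚ.≤ ε
    go ε 0<ε (b , bound) = let N , K≤N , TN≤ε = T-null (b ℕ.+ b) 0<ε in
      eventually-zip (λ k f g → f g) (N , λ k N≤k bounds → error b ε N K≤N TN≤ε k N≤k (seq x k) (seq y k) bounds) bound

  0≤square : ∀ q → 0ℚ ℚ.≤ q ℚ.* q
  0≤square q = go (ℚₚ.≤-total 0ℚ q)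
    where
    go : 0ℚ ℚ.≤ q ⊎ q ℚ.≤ 0ℚ → 0ℚ ℚ.≤ q ℚ.* q
    go (inj₁ 0≤q) = 0≤* 0≤q 0≤q
    go (inj₂ q≤0) = subst (0ℚ ℚ.≤_) (solve 1 (λ q → (:- q) :* (:- q) := q :* q) refl q) (0≤* (ℚₚ.neg-antimono-≤ q≤0) (ℚₚ.neg-antimono-≤ q≤0))

  -- Partial sums at negative arguments can be negative, whereas the square of exp (x / 2) has
  -- nonnegative approximations.
  0≼exp : ∀ x → 0ℝ ≼ exp x
  0≼exp x = ≼-trans (pointwise-≼ {0ℝ} {exp ½x * exp ½x} (λ k → 0≤square (partialSum (½ ℚ.* seq x k) k)))
    (≼-trans (≃⇒≽ (exp-+ ½x ½x)) (≃⇒≼ (exp-cong (pointwise-≃ {½x + ½x} {x} (λ k → ½+½ (seq x k))))))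
    where
    ½x : ℝ
    ½x = ℚ→ℝ ½ * x

  partialSum-0 : ∀ k → partialSum 0ℚ k ≡ 1ℚ
  partialSum-0 zero    = refl
  partialSum-0 (suc k) = trans (cong₂ ℚ._+_ (partialSum-0 k) (trans (cong (ℚ._* 1/suc k) (ℚₚ.*-zeroʳ (term 0ℚ k))) (ℚₚ.*-zeroˡ (1/suc k)))) (ℚₚ.+-identityʳ 1ℚ)

  exp-0 : exp 0ℝ ≃ 1ℝ
  exp-0 = pointwise-≃ {exp 0ℝ} {1ℝ} partialSum-0

  exp-neg : ∀ x → exp (- x) * exp x ≃ 1ℝ
  exp-neg x = ≃-trans (≃-sym (exp-+ (- x) x)) (≃-trans (exp-cong (pointwise-≃ { - x + x} {0ℝ} (λ k → ℚₚ.+-inverseˡ (seq x k)))) exp-0)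

  1+≤partialSum : ∀ {q} → 0ℚ ℚ.≤ q → ∀ k → 1ℚ ℚ.+ q ℚ.≤ partialSum q (suc k)
  1+≤partialSum {q} 0≤q zero    = ℚₚ.≤-reflexive (cong (1ℚ ℚ.+_) (sym (trans (ℚₚ.*-identityʳ (1ℚ ℚ.* q)) (ℚₚ.*-identityˡ q))))
  1+≤partialSum {q} 0≤q (suc k) = ℚₚ.≤-trans (1+≤partialSum 0≤q k) (≤-+ (partialSum q (suc k)) (0≤term 0≤q (suc (suc k))))

  -- Approximations of a nonnegative real may be negative. Their absolute values represent the same
  -- real and allow termwise estimates of `partialSum`.
  absolute : ℝ → ℝ
  absolute x = mkℝ (λ k → ℚ.∣ seq x k ∣) (CauchyLemmas.lipschitz {seq x} {λ k → ℚ.∣ seq x k ∣} 1ℚ 0 (λ m n _ _ → subst (ℚ.∣ ℚ.∣ seq x m ∣ ℚ.- ℚ.∣ seq x n ∣ ∣ ℚ.≤_)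
    (sym (ℚₚ.*-identityˡ _)) (abs-lipschitz (seq x m) (seq x n))) (0≤fromℕ 1) (isCauchy x))
    where
    ∣∣≤ : ∀ a b → ℚ.∣ a ∣ ℚ.≤ ℚ.∣ b ∣ ℚ.+ ℚ.∣ a ℚ.- b ∣
    ∣∣≤ a b = subst (λ c → ℚ.∣ c ∣ ℚ.≤ ℚ.∣ b ∣ ℚ.+ ℚ.∣ a ℚ.- b ∣) (solve 2 (λ a b → b :+ (a :- b) := a) refl a b) (ℚₚ.∣p+q∣≤∣p∣+∣q∣ b (a ℚ.- b))
    abs-lipschitz : ∀ a b → ℚ.∣ ℚ.∣ a ∣ ℚ.- ℚ.∣ b ∣ ∣ ℚ.≤ ℚ.∣ a ℚ.- b ∣
    abs-lipschitz a b = ≤+⇒∣-∣≤ (∣∣≤ a b) (subst (λ c → ℚ.∣ b ∣ ℚ.≤ ℚ.∣ a ∣ ℚ.+ c) (∣-∣-sym b a) (∣∣≤ b a))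

  absolute-nonNegative : ∀ {x} → 0ℝ ≼ x → absolute x ≃ x
  absolute-nonNegative {x} (wrap 0≤x) =
    wrap (λ ε 0<ε → eventually-map (λ k → near (seq x k) ε (ℚₚ.<⇒≤ 0<ε)) (0≤x _ (0<½* 0<ε))) ,
    pointwise-≼ {x} {absolute x} (λ k → ≤∣∣ (seq x k))
    where
    near : ∀ q ε → 0ℚ ℚ.≤ ε → 0ℚ ℚ.≤ q ℚ.+ ½ ℚ.* ε → ℚ.∣ q ∣ ℚ.≤ q ℚ.+ ε
    near q ε 0≤ε 0≤q = ∣∣-≤ (≤-+ q 0≤ε) (linear (ℚₚ.+-mono-≤ 0≤q 0≤q)
      (solve 2 (λ q ε → q :+ ε :+ (con 0ℚ :+ con 0ℚ) := :- q :+ (q :+ con ½ :* ε :+ (q :+ con ½ :* ε))) refl q ε))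

  1+≼exp : ∀ {x} → 0ℝ ≼ x → 1ℝ + x ≼ exp x
  1+≼exp {x} 0≼x = ≼-trans (+-mono ≼-refl (≃⇒≽ (absolute-nonNegative 0≼x)))
    -- The partial sum of index 0 lacks the linear term, hence the start at index 1.
    (≼-trans (eventually-≼ {1ℝ + absolute x} {exp (absolute x)} (1 , λ { zero () ; (suc k) _ → 1+≤partialSum (ℚₚ.0≤∣p∣ (seq x (suc k))) k }))
      (≃⇒≼ (exp-cong (absolute-nonNegative 0≼x))))

  1≼exp : ∀ {x} → 0ℝ ≼ x → 1ℝ ≼ exp x
  1≼exp {x} 0≼x = ≼-trans (≃⇒≽ (≃-trans (+-comm 1ℝ 0ℝ) (+-identityˡ 1ℝ))) (≼-trans (+-mono ≼-refl 0≼x) (1+≼exp 0≼x))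

  exp-mono : ∀ {x y} → x ≼ y → exp x ≼ exp y
  exp-mono {x} {y} x≼y = begin
    exp x                   ≈⟨ *-identityˡ (exp x) ⟨
    1ℝ * exp x              ≲⟨ *-monoʳ (0≼exp x) (1≼exp (≼⇒0≼- x≼y)) ⟩
    exp (y - x) * exp x     ≈⟨ exp-+ (y - x) x ⟨
    exp (y - x + x)         ≈⟨ exp-cong (pointwise-≃ {y - x + x} {y} (λ k → solve 2 (λ x y → y :- x :+ x := y) refl (seq x k) (seq y k))) ⟩
    exp y                   ∎

-- The logarithm

abstract
  0≤harmonic : ∀ a b → 0ℚ ℚ.≤ harmonic a b
  0≤harmonic a zero    = ℚₚ.≤-refl
  0≤harmonic a (suc b) = 0≤+ (0≤1/suc a) (0≤harmonic (suc a) b)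

  harmonic-mono : ∀ a {b c} → b ℕ.≤ c → harmonic a b ℚ.≤ harmonic a c
  harmonic-mono a {b} {c} b≤c = subst (harmonic a b ℚ.≤_)
    (trans (sym (harmonic-+ a b (c ℕ.∸ b))) (cong (harmonic a) (ℕₚ.m+[n∸m]≡n b≤c)))
    (≤-+ (harmonic a b) (0≤harmonic (a ℕ.+ b) (c ℕ.∸ b)))

  ln-mono : ∀ {m n} → m ℕ.≤ n → ln m ≼ ln n
  ln-mono {m} {n} m≤n = pointwise-≼ {ln m} {ln n} (λ k → harmonic-mono (suc k) (ℕₚ.*-monoˡ-≤ (suc k) (ℕₚ.∸-monoˡ-≤ 1 m≤n)))

  0≼ln : ∀ n → 0ℝ ≼ ln n
  0≼ln n = pointwise-≼ {0ℝ} {ln n} (λ k → 0≤harmonic (suc k) ((n ℕ.∸ 1) ℕ.* suc k))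

  ln-1 : ln 1 ≃ 0ℝ
  ln-1 = pointwise-≃ {ln 1} {0ℝ} (λ _ → refl)

  harmonic-block : ∀ r k → 1/suc (suc r) ℚ.≤ harmonic (suc k ℕ.+ r ℕ.* suc k) (suc k)
  harmonic-block r k = subst (ℚ._≤ harmonic (suc k ℕ.+ r ℕ.* suc k) (suc k)) block-length
    (harmonic-lower h (suc k ℕ.+ r ℕ.* suc k) (suc k) (ℕₚ.≤-reflexive (ℕₚ.+-comm (suc r ℕ.* suc k) (suc k))))
    where
    h : ℕ
    h = k ℕ.+ suc r ℕ.* suc k
    block-length : fromℕ (suc k) ℚ.* 1/suc h ≡ 1/suc (suc r)
    block-length = fromℕ-suc-cancel (suc r) (trans
      (solve 3 (λ a b c → a :* (b :* c) := b :* (a :* c)) refl (fromℕ (suc (suc r))) (fromℕ (suc k)) (1/suc h))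
      (trans (cong (fromℕ (suc k) ℚ.*_) (suc*1/suc (suc r) k)) (trans (1/suc-inverse k) (sym (1/suc-inverse (suc r))))))

  -- The last block of the Riemann sum belongs to the interval [r + 1, r + 2], on which 1/t is at
  -- least 1/(r + 2).
  ln-suc : ∀ r → ln (suc r) + ℚ→ℝ (1/suc (suc r)) ≼ ln (suc (suc r))
  ln-suc r = pointwise-≼ {ln (suc r) + ℚ→ℝ (1/suc (suc r))} {ln (suc (suc r))} (λ k → subst (riemannSum (suc r) k ℚ.+ 1/suc (suc r) ℚ.≤_)
    (trans (sym (harmonic-+ (suc k) (r ℕ.* suc k) (suc k))) (cong (harmonic (suc k)) (ℕₚ.+-comm (r ℕ.* suc k) (suc k))))
    (ℚₚ.+-monoʳ-≤ (riemannSum (suc r) k) (harmonic-block r k)))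

  -- Points of mesh 1/M beyond a are points of mesh 1/(a M) beyond 1, scaled by a.
  riemannSum-* : ∀ i j k → riemannSum (suc i ℕ.* suc j) k ≡ riemannSum (suc i) k ℚ.+ riemannSum (suc j) (k ℕ.+ i ℕ.* suc k)
  riemannSum-* i j k = trans (cong (harmonic (suc k)) (ℕ-solve 3 (λ i j k → (j ⊕ i ⊗ (c1 ⊕ j)) ⊗ (c1 ⊕ k) ⊜ i ⊗ (c1 ⊕ k) ⊕ j ⊗ (c1 ⊕ (k ⊕ i ⊗ (c1 ⊕ k)))) refl i j k))
    (harmonic-+ (suc k) (i ℕ.* suc k) (j ℕ.* suc (k ℕ.+ i ℕ.* suc k)))
    where
    open ℕ-Solver using (Polynomial) renaming (solve to ℕ-solve; _:+_ to _⊕_; _:*_ to _⊗_; _:=_ to _⊜_; con to ℕ-con)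
    c1 : Polynomial 3
    c1 = ℕ-con 1

  -- By `riemannSum-*` the second summand is the Riemann sum for `ln (suc j)` at a later index, and
  -- so has the same limit.
  ln-* : ∀ i j → ln (suc i ℕ.* suc j) ≃ ln (suc i) + ln (suc j)
  ln-* i j = ≈⇒≃ λ ε 0<ε → go ε (riemannSum-cauchy (suc j) ε 0<ε)
    where
    go : ∀ ε → (∃ λ N → ∀ m n → N ℕ.≤ m → N ℕ.≤ n → ℚ.∣ riemannSum (suc j) m ℚ.- riemannSum (suc j) n ∣ ℚ.≤ ε) →
      Eventually λ k → ℚ.∣ riemannSum (suc i ℕ.* suc j) k ℚ.- (riemannSum (suc i) k ℚ.+ riemannSum (suc j) k) ∣ ℚ.≤ ε
    go ε (N , close) = N , λ k N≤k → subst (λ z → ℚ.∣ z ∣ ℚ.≤ ε)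
      (trans (solve 3 (λ a b c → b :- c := a :+ b :- (a :+ c)) refl (riemannSum (suc i) k) (riemannSum (suc j) (k ℕ.+ i ℕ.* suc k)) (riemannSum (suc j) k))
        (cong (λ z → z ℚ.- (riemannSum (suc i) k ℚ.+ riemannSum (suc j) k)) (sym (riemannSum-* i j k))))
      (close (k ℕ.+ i ℕ.* suc k) k (ℕₚ.≤-trans N≤k (ℕₚ.m≤m+n k (i ℕ.* suc k))) N≤k)

  ln-^ : ∀ i k → ln (suc i ℕ.^ k) ≃ ℕ→ℝ k * ln (suc i)
  ln-^ i zero    = ≃-trans ln-1 (≃-sym (*-zeroˡ (ln (suc i))))
  ln-^ i (suc k) = ≃-trans (product (suc i ℕ.^ k) {{ℕₚ.m^n≢0 (suc i) k}})
    (≃-trans (+-cong (≃-sym (*-identityˡ (ln (suc i)))) (ln-^ i k)) (pointwise-≃ {1ℝ * l + ℕ→ℝ k * l} {ℕ→ℝ (suc k) * l}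
      (λ m → trans (sym (ℚₚ.*-distribʳ-+ (seq l m) 1ℚ (fromℕ k))) (cong (ℚ._* seq l m) (sym (fromℕ-suc k))))))
    where
    l : ℝ
    l = ln (suc i)
    product : ∀ n .{{_ : ℕ.NonZero n}} → ln (suc i ℕ.* n) ≃ ln (suc i) + ln n
    product (suc n) = ln-* i n

  -- The sums over right end points never decrease as the mesh shrinks, so each is a lower bound of
  -- the limit.
  riemannSum≼ln : ∀ n k → ℚ→ℝ (riemannSum n k) ≼ ln n
  riemannSum≼ln n k = eventually-≼ {ℚ→ℝ (riemannSum n k)} {ln n} (k , λ m k≤m → subst (λ m → riemannSum n k ℚ.≤ riemannSum n m) (ℕₚ.m∸n+n≡m k≤m) (go (m ℕ.∸ k)))
    where
    go : ∀ j → riemannSum n k ℚ.≤ riemannSum n (j ℕ.+ k)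
    go j = let d , eq , 0≤d , _ = increase n j k in subst (riemannSum n k ℚ.≤_) (sym eq) (≤-+ (riemannSum n k) 0≤d)

  suc*[1+1/suc] : ∀ a → fromℕ (suc a) ℚ.* (1ℚ ℚ.+ 1/suc a) ≡ fromℕ (suc (suc a))
  suc*[1+1/suc] a = trans (ℚₚ.*-distribˡ-+ (fromℕ (suc a)) 1ℚ (1/suc a))
    (trans (cong₂ ℚ._+_ (ℚₚ.*-identityʳ (fromℕ (suc a))) (1/suc-inverse a)) (trans (ℚₚ.+-comm (fromℕ (suc a)) 1ℚ) (sym (fromℕ-suc (suc a)))))

  -- exp (1/i) ≥ (i + 1) / i, and the product of these fractions telescopes.
  telescope : ∀ a b → ℕ→ℝ (suc (a ℕ.+ b)) ≼ ℕ→ℝ (suc a) * exp (ℚ→ℝ (harmonic a b))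
  telescope a zero    = ≼-trans (ℕ→ℝ-mono (ℕₚ.≤-reflexive (cong suc (ℕₚ.+-identityʳ a))))
    (≼-trans (≃⇒≽ (≃-trans (*-comm (ℕ→ℝ (suc a)) 1ℝ) (*-identityˡ _))) (*-monoˡ (0≼ℕ→ℝ (suc a)) (1≼exp ≼-refl)))
  telescope a (suc b) = begin
    ℕ→ℝ (suc (a ℕ.+ suc b))                                   ≲⟨ ℕ→ℝ-mono (ℕₚ.≤-reflexive (cong suc (ℕₚ.+-suc a b))) ⟩
    ℕ→ℝ (suc (suc a ℕ.+ b))                                   ≲⟨ telescope (suc a) b ⟩
    ℕ→ℝ (suc (suc a)) * exp (ℚ→ℝ h)                           ≲⟨ *-monoʳ (0≼exp (ℚ→ℝ h)) (≃⇒≽ (pointwise-≃ {ℕ→ℝ (suc a) * (1ℝ + ℚ→ℝ (1/suc a))} {ℕ→ℝ (suc (suc a))} (λ _ → suc*[1+1/suc] a))) ⟩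
    ℕ→ℝ (suc a) * (1ℝ + ℚ→ℝ (1/suc a)) * exp (ℚ→ℝ h)          ≲⟨ *-monoʳ (0≼exp (ℚ→ℝ h)) (*-monoˡ (0≼ℕ→ℝ (suc a)) (1+≼exp (ℚ→ℝ-mono (0≤1/suc a)))) ⟩
    ℕ→ℝ (suc a) * exp (ℚ→ℝ (1/suc a)) * exp (ℚ→ℝ h)           ≈⟨ *-assoc (ℕ→ℝ (suc a)) (exp (ℚ→ℝ (1/suc a))) (exp (ℚ→ℝ h)) ⟩
    ℕ→ℝ (suc a) * (exp (ℚ→ℝ (1/suc a)) * exp (ℚ→ℝ h))         ≲⟨ *-monoˡ (0≼ℕ→ℝ (suc a)) (≃⇒≽ (exp-+ (ℚ→ℝ (1/suc a)) (ℚ→ℝ h))) ⟩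
    ℕ→ℝ (suc a) * exp (ℚ→ℝ (1/suc a) + ℚ→ℝ h)                 ≲⟨ *-monoˡ (0≼ℕ→ℝ (suc a)) (exp-mono (pointwise-≼ {ℚ→ℝ (1/suc a) + ℚ→ℝ h} {ℚ→ℝ (harmonic a (suc b))} (λ _ → ℚₚ.≤-refl))) ⟩
    ℕ→ℝ (suc a) * exp (ℚ→ℝ (harmonic a (suc b)))              ∎
    where
    h : ℚ
    h = harmonic (suc a) b

  ≼-+ε : ∀ {x y} → (∀ ε → 0ℚ ℚ.< ε → x ≼ y + ℚ→ℝ ε) → x ≼ y
  ≼-+ε {x} {y} h = wrap λ ε 0<ε → eventually-map (λ k → subst (seq x k ℚ.≤_)
      (solve 2 (λ y e → y :+ con ½ :* e :+ con ½ :* e := y :+ e) refl (seq y k) ε))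
    (unwrap (h (½ ℚ.* ε) (0<½* 0<ε)) (½ ℚ.* ε) (0<½* 0<ε))

  upper-bound : ∀ x → ∃ λ B → x ≼ ℕ→ℝ B
  upper-bound x = let B , N , x≤B = CauchyLemmas.bounded {seq x} (isCauchy x) in
    B , eventually-≼ {x} {ℕ→ℝ B} (N , λ k N≤k → ℚₚ.≤-trans (≤∣∣ (seq x k)) (x≤B k N≤k))

  -- For mesh 1/(j + 1), `telescope` gives n ≤ (1 + 1/(j + 1)) exp (ln n), and the excess vanishes
  -- as j grows.
  ℕ≼exp-ln : ∀ r → ℕ→ℝ (suc r) ≼ exp (ln (suc r))
  ℕ≼exp-ln r = ≼-+ε λ ε 0<ε → let B , E≼B = upper-bound E ; N , small = archimedes (fromℕ B) 0<ε in
    ≼-trans (divided N) (+-mono ≼-refl (≼-trans (*-monoʳ (ℚ→ℝ-mono (0≤1/suc N)) E≼B)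
      (pointwise-≼ {ℕ→ℝ B * ℚ→ℝ (1/suc N)} {ℚ→ℝ ε} (λ _ → small N ℕₚ.≤-refl))))
    where
    E : ℝ
    E = exp (ln (suc r))
    scaled : ∀ j → ℕ→ℝ (suc r ℕ.* suc j) ≼ ℕ→ℝ (suc (suc j)) * E
    scaled j = ≼-trans (ℕ→ℝ-mono (ℕₚ.n≤1+n (suc r ℕ.* suc j)))
      (≼-trans (telescope (suc j) (r ℕ.* suc j)) (*-monoˡ (0≼ℕ→ℝ (suc (suc j))) (exp-mono (riemannSum≼ln (suc r) j))))
    divided : ∀ j → ℕ→ℝ (suc r) ≼ E + E * ℚ→ℝ (1/suc j)
    divided j = begin
      ℕ→ℝ (suc r)                                      ≈⟨ pointwise-≃ {ℕ→ℝ (suc r)} {ℕ→ℝ (suc r ℕ.* suc j) * ℚ→ℝ (1/suc j)} (λ _ → sym (cancel j)) ⟩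
      ℕ→ℝ (suc r ℕ.* suc j) * ℚ→ℝ (1/suc j)            ≲⟨ *-monoʳ (ℚ→ℝ-mono (0≤1/suc j)) (scaled j) ⟩
      ℕ→ℝ (suc (suc j)) * E * ℚ→ℝ (1/suc j)            ≈⟨ pointwise-≃ {ℕ→ℝ (suc (suc j)) * E * ℚ→ℝ (1/suc j)} {E + E * ℚ→ℝ (1/suc j)} (λ k → expand j (seq E k)) ⟩
      E + E * ℚ→ℝ (1/suc j)                            ∎
      where
      cancel : ∀ j → fromℕ (suc r ℕ.* suc j) ℚ.* 1/suc j ≡ fromℕ (suc r)
      cancel j = trans (cong (ℚ._* 1/suc j) (fromℕ-* (suc r) (suc j))) (trans (ℚₚ.*-assoc (fromℕ (suc r)) (fromℕ (suc j)) (1/suc j))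
        (trans (cong (fromℕ (suc r) ℚ.*_) (1/suc-inverse j)) (ℚₚ.*-identityʳ (fromℕ (suc r)))))
      expand : ∀ j e → fromℕ (suc (suc j)) ℚ.* e ℚ.* 1/suc j ≡ e ℚ.+ e ℚ.* 1/suc j
      expand j e = trans (cong (λ z → z ℚ.* e ℚ.* 1/suc j) (fromℕ-suc (suc j)))
        (trans (solve 3 (λ f e r → (con 1ℚ :+ f) :* e :* r := e :* (f :* r) :+ e :* r) refl (fromℕ (suc j)) e (1/suc j))
          (cong (ℚ._+ e ℚ.* 1/suc j) (trans (cong (e ℚ.*_) (1/suc-inverse j)) (ℚₚ.*-identityʳ e))))

-- Sums of powers

∑ : List ℝ → ℝ
∑ = foldr _+_ 0ℝ

abstract
  exp-neg-ln : ∀ r → exp (- ln (suc r)) ≼ ℚ→ℝ (1/suc r)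
  exp-neg-ln r = begin
    e                                                ≈⟨ pointwise-≃ {e} {e * ℕ→ℝ (suc r) * ℚ→ℝ (1/suc r)} (λ k → expand (seq e k)) ⟩
    e * ℕ→ℝ (suc r) * ℚ→ℝ (1/suc r)                  ≲⟨ *-monoʳ (ℚ→ℝ-mono (0≤1/suc r)) (*-monoˡ (0≼exp (- ln (suc r))) (ℕ≼exp-ln r)) ⟩
    e * exp (ln (suc r)) * ℚ→ℝ (1/suc r)             ≲⟨ *-monoʳ (ℚ→ℝ-mono (0≤1/suc r)) (≃⇒≼ (exp-neg (ln (suc r)))) ⟩
    1ℝ * ℚ→ℝ (1/suc r)                               ≈⟨ *-identityˡ (ℚ→ℝ (1/suc r)) ⟩
    ℚ→ℝ (1/suc r)                                    ∎
    where
    e : ℝ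
    e = exp (- ln (suc r))
    expand : ∀ q → q ≡ q ℚ.* fromℕ (suc r) ℚ.* 1/suc r
    expand q = sym (trans (ℚₚ.*-assoc q (fromℕ (suc r)) (1/suc r)) (trans (cong (q ℚ.*_) (1/suc-inverse r)) (ℚₚ.*-identityʳ q)))

module _ {t : ℝ} (0≼t : 0ℝ ≼ t) where

  abstract
    -- The integral of t x^{-1-t} over [M, M + 1] is at least its value at the right end point.
    integral-step : ∀ r → let x = ln (suc r); y = ln (suc (suc r)) in
      t * exp (- ((1ℝ + t) * y)) ≼ exp (- (t * x)) - exp (- (t * y))
    integral-step r = begin
      t * exp (- ((1ℝ + t) * y))       ≲⟨ *-monoˡ 0≼t (≃⇒≼ (≃-trans (exp-cong (pointwise-≃ { - ((1ℝ + t) * y)} { - y + - (t * y)}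
                                            (λ k → solve 2 (λ t y → :- ((con 1ℚ :+ t) :* y) := :- y :+ :- (t :* y)) refl (seq t k) (seq y k)))) (exp-+ (- y) (- (t * y))))) ⟩
      t * (exp (- y) * Y)              ≲⟨ *-monoˡ 0≼t (*-monoʳ (0≼exp (- (t * y))) (≼-trans (exp-neg-ln (suc r)) 1/≼d)) ⟩
      t * (d * Y)                      ≈⟨ pointwise-≃ {t * (d * Y)} {Y * (1ℝ + t * d) - Y} (λ k → solve 3 (λ t d Y → t :* (d :* Y) := Y :* (con 1ℚ :+ t :* d) :- Y) refl (seq t k) (seq d k) (seq Y k)) ⟩
      Y * (1ℝ + t * d) - Y             ≲⟨ +-mono (*-monoˡ (0≼exp (- (t * y))) (1+≼exp (nonNegative-* 0≼t (≼⇒0≼- (ln-mono (ℕₚ.n≤1+n (suc r))))))) ≼-refl ⟩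
      Y * exp (t * d) - Y              ≲⟨ +-mono (≃⇒≼ (≃-trans (≃-sym (exp-+ (- (t * y)) (t * d))) (exp-cong (pointwise-≃ { - (t * y) + t * d} { - (t * x)}
                                            (λ k → solve 3 (λ t x y → :- (t :* y) :+ t :* (y :- x) := :- (t :* x)) refl (seq t k) (seq x k) (seq y k)))))) ≼-refl ⟩
      exp (- (t * x)) - Y              ∎
      where
      x y d Y : ℝ
      x = ln (suc r)
      y = ln (suc (suc r))
      d = y - x
      Y = exp (- (t * y))
      1/≼d : ℚ→ℝ (1/suc (suc r)) ≼ d
      1/≼d = ≼-trans (≃⇒≼ (pointwise-≃ {ℚ→ℝ (1/suc (suc r))} {x + ℚ→ℝ (1/suc (suc r)) - x} (λ k → solve 2 (λ x q → q := x :+ q :- x) refl (seq x k) (1/suc (suc r)))))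
        (+-mono (ln-suc r) ≼-refl)

  module _ {T : ℝ} (L : ℝ) (0≼T : 0ℝ ≼ T) (Tt≃1 : T * t ≃ 1ℝ) where

    -- `L` stands for ln A. Lists are ranked from their end: the head has rank `suc (length qs)`,
    -- and the further `suc` is the trivial bipartition.
    data Decaying : List ℝ → Set where
      []  : Decaying []
      extend : ∀ {q qs} → q ≼ exp (- ((1ℝ + t) * L)) → q ≼ exp (- ((1ℝ + t) * ln (suc (suc (length qs))))) →
        Decaying qs → Decaying (q ∷ qs)

    private
      a : ℝ
      a = exp (- (t * L))

      decay : ℕ → ℝ
      decay M = exp (- (t * ln M))

    abstract
      ∑≼length* : ∀ {qs} → Decaying qs → ∑ qs ≼ ℕ→ℝ (length qs) * exp (- ((1ℝ + t) * L))
      ∑≼length* [] = ≃⇒≽ (*-zeroˡ _)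
      ∑≼length* {q ∷ qs} (extend q≼ _ dec) = ≼-trans (+-mono (≼-trans q≼ (≃⇒≽ (*-identityˡ e))) (∑≼length* dec))
        (≃⇒≼ (≃-trans (≃-sym (*-distribʳ e 1ℝ (ℕ→ℝ (length qs)))) (*-cong (0≼ℕ→ℝ (suc (length qs))) (0≼exp _) (≃-sym (ℕ→ℝ-suc (length qs))) ≃-refl)))
        where
        e : ℝ
        e = exp (- ((1ℝ + t) * L))

      -- There are at most A entries, each at most A^(-(1 + t)); `a` is A^(-t).
      ∑-few : ∀ {qs} → Decaying qs → ln (length qs) ≼ L → ∑ qs ≼ a
      ∑-few [] _ = 0≼exp _
      ∑-few {q ∷ qs} dec len≼ = begin
        ∑ (q ∷ qs)                                        ≲⟨ ∑≼length* dec ⟩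
        ℕ→ℝ (suc (length qs)) * exp (- ((1ℝ + t) * L))    ≲⟨ *-monoʳ (0≼exp _) (≼-trans (ℕ≼exp-ln (length qs)) (exp-mono len≼)) ⟩
        exp L * exp (- ((1ℝ + t) * L))                    ≈⟨ exp-+ L (- ((1ℝ + t) * L)) ⟨
        exp (L + - ((1ℝ + t) * L))                        ≈⟨ exp-cong (pointwise-≃ {L + - ((1ℝ + t) * L)} { - (t * L)}
                                                              (λ k → solve 2 (λ t L → L :+ :- ((con 1ℚ :+ t) :* L) := :- (t :* L)) refl (seq t k) (seq L k))) ⟩
        a                                                 ∎

      decay-anti : ∀ {M} → L ≼ ln M → decay M ≼ a
      decay-anti L≼ = exp-mono (neg-mono (*-monoˡ 0≼t L≼))

      q≼T* : ∀ {q r} → q ≼ exp (- ((1ℝ + t) * ln (suc (suc r)))) → q ≼ T * (decay (suc r) - decay (suc (suc r)))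
      q≼T* {q} {r} q≼ = begin
        q                          ≲⟨ q≼ ⟩
        e                          ≈⟨ *-identityˡ e ⟨
        1ℝ * e                     ≲⟨ *-monoʳ (0≼exp _) (≃⇒≽ Tt≃1) ⟩
        T * t * e                  ≈⟨ *-assoc T t e ⟩
        T * (t * e)                ≲⟨ *-monoˡ 0≼T (integral-step r) ⟩
        T * (decay (suc r) - decay (suc (suc r))) ∎
        where
        e : ℝ
        e = exp (- ((1ℝ + t) * ln (suc (suc r))))

      -- The second summand is the integral of x^(-(1 + t)) from A to `suc (length qs)` in closed
      -- form, so the bound telescopes as entries are added.
      ∑-many : ∀ {qs} → Decaying qs → L ≼ ln (length qs) → ∑ qs ≼ a + T * (a - decay (suc (length qs)))
      -- `ln 0` is 0 by convention, so `L` is at most `ln 1` here and `decay 1` is at most `a`.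
      ∑-many [] L≼ = nonNegative-+ (0≼exp _) (nonNegative-* 0≼T (≼⇒0≼- (decay-anti (≼-trans L≼ (ln-mono z≤n)))))
      ∑-many {q ∷ qs} (extend _ q≼ dec) L≼ = ≼-cases {L} {ln (length qs)}
        (λ L≼′ → begin
          q + ∑ qs                                    ≲⟨ +-mono (q≼T* q≼) (∑-many dec L≼′) ⟩
          T * (x - y) + (a + T * (a - x))             ≈⟨ pointwise-≃ {T * (x - y) + (a + T * (a - x))} {a + T * (a - y)} (λ k →
                                                           solve 4 (λ T x y a → T :* (x :- y) :+ (a :+ T :* (a :- x)) := a :+ T :* (a :- y)) refl (seq T k) (seq x k) (seq y k) (seq a k)) ⟩
          a + T * (a - y)                             ∎)
        -- The entry that passes A: the tail has at most A entries, and as `suc (length qs)` is at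
        -- least A, `decay (suc (length qs))` may be raised to `a`.
        (λ ≼L → begin
          q + ∑ qs                                    ≲⟨ +-mono (≼-trans (q≼T* q≼) (*-monoˡ 0≼T (+-mono (decay-anti L≼) ≼-refl))) (∑-few dec ≼L) ⟩
          T * (a - y) + a                             ≈⟨ +-comm (T * (a - y)) a ⟩
          a + T * (a - y)                             ∎)
        where
        x y : ℝ
        x = decay (suc (length qs))
        y = decay (suc (suc (length qs)))

      ∑-bound : ∀ {qs} → Decaying qs → ∑ qs ≼ exp (- (t * L)) * (1ℝ + T)
      ∑-bound {qs} dec = ≼-trans (≼-cases {L} {ln (length qs)}
        (λ L≼ → ≼-trans (∑-many dec L≼) (+-mono ≼-refl (*-monoˡ 0≼T a-y≼a)))
        (λ ≼L → ≼-trans (∑-few dec ≼L) (≼-trans (≃⇒≽ (≃-trans (+-comm a 0ℝ) (+-identityˡ a))) (+-mono ≼-refl (nonNegative-* 0≼T (0≼exp _))))))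
        (≃⇒≼ (pointwise-≃ {a + T * a} {a * (1ℝ + T)} (λ k → solve 2 (λ a T → a :+ T :* a := a :* (con 1ℚ :+ T)) refl (seq a k) (seq T k))))
        where
        a-y≼a : a - decay (suc (length qs)) ≼ a
        a-y≼a = 0≼-⇒≼ (≼-trans (0≼exp _) (≃⇒≼ (pointwise-≃ {y} {a - (a - y)} (λ k → solve 2 (λ a y → y := a :- (a :- y)) refl (seq a k) (seq y k)))))
          where
          y : ℝ
          y = decay (suc (length qs))

-- The union bound

+-interchange : ∀ a b c d → a + b + (c + d) ≃ a + c + (b + d)
+-interchange a b c d = pointwise-≃ {a + b + (c + d)} {a + c + (b + d)} (λ k →
  solve 4 (λ a b c d → a :+ b :+ (c :+ d) := a :+ c :+ (b :+ d)) refl (seq a k) (seq b k) (seq c k) (seq d k))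

*-distribˡ : ∀ x y z → x * y + x * z ≃ x * (y + z)
*-distribˡ x y z = pointwise-≃ {x * y + x * z} {x * (y + z)} (λ k → sym (ℚₚ.*-distribˡ-+ (seq x k) (seq y k) (seq z k)))

*-zeroʳ : ∀ x → x * 0ℝ ≃ 0ℝ
*-zeroʳ x = pointwise-≃ {x * 0ℝ} {0ℝ} (λ k → ℚₚ.*-zeroʳ (seq x k))

sum-mono : ∀ {m} {f g : Subset m → ℝ} → (∀ F → f F ≼ g F) → sum f ≼ sum g
sum-mono {zero}  f≼g = f≼g []
sum-mono {suc m} f≼g = +-mono (sum-mono (f≼g ∘ (inside ∷_))) (sum-mono (f≼g ∘ (outside ∷_)))

sum-+ : ∀ {m} (f g : Subset m → ℝ) → sum (λ F → f F + g F) ≃ sum f + sum g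
sum-+ {zero}  f g = ≃-refl
sum-+ {suc m} f g = ≃-trans (+-cong (sum-+ (f ∘ (inside ∷_)) (g ∘ (inside ∷_))) (sum-+ (f ∘ (outside ∷_)) (g ∘ (outside ∷_)))) (+-interchange _ _ _ _)

sum-*ˡ : ∀ {m} x (f : Subset m → ℝ) → sum (λ F → x * f F) ≃ x * sum f
sum-*ˡ {zero}  x f = ≃-refl
sum-*ˡ {suc m} x f = ≃-trans (+-cong (sum-*ˡ x (f ∘ (inside ∷_))) (sum-*ˡ x (f ∘ (outside ∷_)))) (*-distribˡ x _ _)

sum-zero : ∀ m → sum {m} (λ _ → 0ℝ) ≃ 0ℝ
sum-zero zero    = ≃-refl
sum-zero (suc m) = ≃-trans (+-cong (sum-zero m) (sum-zero m)) (+-identityˡ 0ℝ)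

sum-∑ : ∀ {m} {A : Set} (g : A → Subset m → ℝ) xs → sum (λ F → ∑ (map (λ x → g x F) xs)) ≃ ∑ (map (λ x → sum (g x)) xs)
sum-∑ {m} g []  = sum-zero m
sum-∑ g (x ∷ xs) = ≃-trans (sum-+ (g x) (λ F → ∑ (map (λ y → g y F) xs))) (+-cong ≃-refl (sum-∑ g xs))

0≼∑ : ∀ {A : Set} {f : A → ℝ} → (∀ x → 0ℝ ≼ f x) → ∀ xs → 0ℝ ≼ ∑ (map f xs)
0≼∑ 0≼f []       = ≼-refl
0≼∑ 0≼f (x ∷ xs) = nonNegative-+ (0≼f x) (0≼∑ 0≼f xs)

≼+ʳ : ∀ {x y} → 0ℝ ≼ y → x ≼ x + y
≼+ʳ {x} {y} 0≼y = ≼-trans (≃⇒≽ (≃-trans (+-comm x 0ℝ) (+-identityˡ x))) (+-mono ≼-refl 0≼y)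

≼+ˡ : ∀ {x y} → 0ℝ ≼ x → y ≼ x + y
≼+ˡ {x} {y} 0≼x = ≼-trans (≃⇒≽ (+-identityˡ y)) (+-mono 0≼x ≼-refl)

∈⇒≼∑ : ∀ {A : Set} {f : A → ℝ} → (∀ x → 0ℝ ≼ f x) → ∀ {x xs} → x ∈ xs → f x ≼ ∑ (map f xs)
∈⇒≼∑ 0≼f {x} {_ ∷ xs} (here refl) = ≼+ʳ (0≼∑ 0≼f xs)
∈⇒≼∑ 0≼f (there {x = y} x∈) = ≼-trans (∈⇒≼∑ 0≼f x∈) (≼+ˡ (0≼f y))

∑-mono : ∀ {A : Set} {f g : A → ℝ} → (∀ x → f x ≼ g x) → ∀ xs → ∑ (map f xs) ≼ ∑ (map g xs)
∑-mono f≼g []       = ≼-refl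
∑-mono f≼g (x ∷ xs) = +-mono (f≼g x) (∑-mono f≼g xs)

contains : ∀ {m} → Subset m → Subset m → Bool
contains []            []      = true
contains (inside ∷ X)  (f ∷ F) = f ∧ contains X F
contains (outside ∷ X) (f ∷ F) = contains X F

⊆⇒contains : ∀ {m} (X F : Subset m) → X ⊆ F → contains X F ≡ true
⊆⇒contains []            []            X⊆F = refl
⊆⇒contains (outside ∷ X) (f ∷ F)       X⊆F = ⊆⇒contains X F (drop-∷-⊆ X⊆F)
⊆⇒contains (inside ∷ X)  (inside ∷ F)  X⊆F = ⊆⇒contains X F (drop-∷-⊆ X⊆F)
⊆⇒contains (inside ∷ X)  (outside ∷ F) X⊆F with () ← X⊆F Vec.here

if-*ˡ : ∀ x b w → (if b then x * w else 0ℝ) ≼ x * (if b then w else 0ℝ)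
if-*ˡ x true  w = ≼-refl
if-*ˡ x false w = ≃⇒≽ (*-zeroʳ x)

module _ {p : ℝ} (0≼p : 0ℝ ≼ p) (p≼1 : p ≼ 1ℝ) where

  0≼weight : ∀ {m} (F : Subset m) → 0ℝ ≼ weight p F
  0≼weight []            = ℕ→ℝ-mono {0} {1} ℕ.z≤n
  0≼weight (inside ∷ F)  = nonNegative-* 0≼p (0≼weight F)
  0≼weight (outside ∷ F) = nonNegative-* (≼⇒0≼- p≼1) (0≼weight F)

  0≼if : ∀ b {w} → 0ℝ ≼ w → 0ℝ ≼ (if b then w else 0ℝ)
  0≼if true  0≼w = 0≼w
  0≼if false 0≼w = ≼-refl

  covering : ∀ {m} → Subset m → Subset m → ℝ
  covering X F = if contains X F then weight p F else 0ℝ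

  supersets : ∀ {m} → Subset m → ℝ
  supersets X = sum (covering X)

  -- Independence, one edge at a time: an edge of `X` contributes the factor `p`, and for any other
  -- edge the weights `p` and `1ℝ - p` add up to one.
  supersets≼^ : ∀ {m} (X : Subset m) → supersets X ≼ p ^ ∣ X ∣
  supersets≼^ [] = ≼-refl
  supersets≼^ {suc m} (inside ∷ X) = begin
    sum (λ F → if contains X F then p * weight p F else 0ℝ) + sum {m} (λ _ → 0ℝ)
      ≲⟨ +-mono (sum-mono (λ F → if-*ˡ p (contains X F) (weight p F))) (≃⇒≼ (sum-zero m)) ⟩
    sum (λ F → p * covering X F) + 0ℝ
      ≈⟨ ≃-trans (+-comm _ 0ℝ) (+-identityˡ _) ⟩
    sum (λ F → p * covering X F)
      ≈⟨ sum-*ˡ p (covering X) ⟩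
    p * supersets X
      ≲⟨ *-monoˡ 0≼p (supersets≼^ X) ⟩
    p * p ^ ∣ X ∣ ∎
  supersets≼^ (outside ∷ X) = begin
    sum (λ F → if contains X F then p * weight p F else 0ℝ) + sum (λ F → if contains X F then (1ℝ - p) * weight p F else 0ℝ)
      ≲⟨ +-mono (sum-mono (λ F → if-*ˡ p (contains X F) (weight p F))) (sum-mono (λ F → if-*ˡ (1ℝ - p) (contains X F) (weight p F))) ⟩
    sum (λ F → p * covering X F) + sum (λ F → (1ℝ - p) * covering X F)
      ≈⟨ +-cong (sum-*ˡ p (covering X)) (sum-*ˡ (1ℝ - p) (covering X)) ⟩
    p * supersets X + (1ℝ - p) * supersets X
      ≈⟨ pointwise-≃ {p * supersets X + (1ℝ - p) * supersets X} {supersets X} (λ k →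
           solve 2 (λ p s → p :* s :+ (con 1ℚ :- p) :* s := s) refl (seq p k) (seq (supersets X) k)) ⟩
    supersets X
      ≲⟨ supersets≼^ X ⟩
    p ^ ∣ X ∣ ∎

  Pr-∑ : ∀ {m} {D : Pred (Subset m) 0ℓ} (D? : Decidable D) (Xs : List (Subset m)) →
    (∀ F → D F → ∃ λ X → X ∈ Xs × X ⊆ F) → Pr p D? ≼ ∑ (map (λ X → p ^ ∣ X ∣) Xs)
  Pr-∑ D? Xs covered = begin
    Pr p D?                                                                          ≲⟨ sum-mono termwise ⟩
    sum (λ F → ∑ (map (λ X → covering X F) Xs))           ≈⟨ sum-∑ covering Xs ⟩
    ∑ (map supersets Xs)                                                             ≲⟨ ∑-mono supersets≼^ Xs ⟩
    ∑ (map (λ X → p ^ ∣ X ∣) Xs)                                                     ∎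
    where
    termwise : ∀ F → (if does (D? F) then weight p F else 0ℝ) ≼ ∑ (map (λ X → covering X F) Xs)
    termwise F with D? F
    ... | no  _ = 0≼∑ (λ X → 0≼if (contains X F) (0≼weight F)) Xs
    ... | yes d with covered F d
    ...   | X , X∈ , X⊆F = ≼-trans (≼-reflexive-if (⊆⇒contains X F X⊆F)) (∈⇒≼∑ (λ X → 0≼if (contains X F) (0≼weight F)) X∈)
      where
      ≼-reflexive-if : ∀ {b} → b ≡ true → weight p F ≼ (if b then weight p F else 0ℝ)
      ≼-reflexive-if refl = ≼-refl

module _ {n m : ℕ} (G : Graph (suc n) m) where

  -- `largeValues` lists only sides that contain vertex zero; a cut given by its other side is
  -- replaced by the complement.
  normalise : ∀ S → ∃ λ S′ → crossing G (inside ∷ S′) ≡ crossing G S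
  normalise (inside ∷ S)  = S , refl
  normalise (outside ∷ S) = ∁ S , crossing-∁ G (outside ∷ S)

  union-bound : ∀ {p} → 0ℝ ≼ p → p ≼ 1ℝ → ∀ a {D : Pred (Subset m) 0ℓ} (D? : Decidable D) →
    (∀ F → D F → ∃ λ C → a ℕ.≤ value G C × CutFails G C F) → Pr p D? ≼ ∑ (map (p ^_) (largeValues G a))
  union-bound {p} 0≼p p≼1 a D? fails = subst (λ xs → Pr p D? ≼ ∑ xs)
    (trans (sym (map-∘ large)) (map-∘ large))
    (Pr-∑ 0≼p p≼1 D? (map (λ S → crossing G (inside ∷ S)) large) covered)
    where
    large : List (Subset n)
    large = filter (λ S → a ℕₚ.≤? bipartitionValue G S) (subsets n)
    covered : ∀ F → _ → ∃ λ X → X ∈ map (λ S → crossing G (inside ∷ S)) large × X ⊆ F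
    covered F d with fails F d
    ... | C , a≤ , ⊆F with normalise (Cut.side C)
    ...   | S , eq = crossing G (inside ∷ S) ,
      ∈-map⁺ (λ S → crossing G (inside ∷ S)) (∈-filter⁺ (λ S → a ℕₚ.≤? bipartitionValue G S) (∈-subsets S) (subst (λ X → a ℕ.≤ ∣ X ∣) (sym eq) a≤)) ,
      subst (_⊆ F) (sym eq) ⊆F

-- Powers, roots and quotients of reals

abstract
  0≼^ : ∀ {x} → 0ℝ ≼ x → ∀ k → 0ℝ ≼ x ^ k
  0≼^ 0≼x zero    = 0≼ℕ→ℝ 1
  0≼^ 0≼x (suc k) = nonNegative-* 0≼x (0≼^ 0≼x k)

  ^-mono : ∀ {x y} → 0ℝ ≼ x → x ≼ y → ∀ k → x ^ k ≼ y ^ k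
  ^-mono 0≼x x≼y zero    = ≼-refl
  ^-mono 0≼x x≼y (suc k) = *-monoᵇ (0≼^ 0≼x k) (≼-trans 0≼x x≼y) x≼y (^-mono 0≼x x≼y k)

  1≼^ : ∀ {x} → 1ℝ ≼ x → ∀ k → 1ℝ ≼ x ^ k
  1≼^ 1≼x zero    = ≼-refl
  1≼^ {x} 1≼x (suc k) = ≼-trans (≃⇒≽ (*-identityˡ 1ℝ)) (*-monoᵇ (0≼ℕ→ℝ 1) (≼-trans (0≼ℕ→ℝ 1) 1≼x) 1≼x (1≼^ 1≼x k))

  ^-distrib-* : ∀ x y k → (x * y) ^ k ≃ x ^ k * y ^ k
  ^-distrib-* x y k = pointwise-≃ {(x * y) ^ k} {x ^ k * y ^ k} (go k)
    where
    go : ∀ k i → seq ((x * y) ^ k) i ≡ seq (x ^ k) i ℚ.* seq (y ^ k) i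
    go zero    i = refl
    go (suc k) i = trans (cong (seq x i ℚ.* seq y i ℚ.*_) (go k i))
      (solve 4 (λ x y X Y → x :* y :* (X :* Y) := x :* X :* (y :* Y)) refl (seq x i) (seq y i) (seq (x ^ k) i) (seq (y ^ k) i))

  exp-^ : ∀ x k → exp x ^ k ≃ exp (ℕ→ℝ k * x)
  exp-^ x zero    = ≃-trans (≃-sym exp-0) (exp-cong (≃-sym (*-zeroˡ x)))
  exp-^ x (suc k) = ≃-trans (*-cong (0≼exp x) (0≼^ (0≼exp x) k) ≃-refl (exp-^ x k))
    (≃-trans (≃-sym (exp-+ x (ℕ→ℝ k * x))) (exp-cong (pointwise-≃ {x + ℕ→ℝ k * x} {ℕ→ℝ (suc k) * x}
      (λ i → trans (solve 2 (λ x f → x :+ f :* x := (con 1ℚ :+ f) :* x) refl (seq x i) (fromℕ k)) (cong (ℚ._* seq x i) (sym (fromℕ-suc k)))))))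

  -- No root is extracted: if `1ℝ ≼ z`, then `z` is at most its own power.
  root≼1 : ∀ {z} k → z ^ suc k ≼ 1ℝ → z ≼ 1ℝ
  root≼1 {z} k z^≼1 = ≼-cases {z} {1ℝ} (λ z≼1 → z≼1) (λ 1≼z → ≼-trans (≃⇒≽ (≃-trans (*-comm z 1ℝ) (*-identityˡ z)))
    (≼-trans (*-monoˡ (≼-trans (0≼ℕ→ℝ 1) 1≼z) (1≼^ 1≼z k)) z^≼1))

  -- The root is taken of p eˡ, whose power is at most one.
  root≼exp : ∀ {p l} k → 0ℝ ≼ p → p ^ suc k ≼ exp (- (ℕ→ℝ (suc k) * l)) → p ≼ exp (- l)
  root≼exp {p} {l} k 0≼p p^≼ = begin
    p                          ≈⟨ ≃-trans (*-comm p 1ℝ) (*-identityˡ p) ⟨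
    p * 1ℝ                     ≲⟨ *-monoˡ 0≼p (≃⇒≽ (≃-trans (*-comm (exp l) (exp (- l))) (exp-neg l))) ⟩
    p * (exp l * exp (- l))    ≈⟨ *-assoc p (exp l) (exp (- l)) ⟨
    p * exp l * exp (- l)      ≲⟨ *-monoʳ (0≼exp (- l)) (root≼1 k (begin
        (p * exp l) ^ suc k                          ≈⟨ ^-distrib-* p (exp l) (suc k) ⟩
        p ^ suc k * exp l ^ suc k                    ≲⟨ *-monoᵇ (0≼^ (0≼exp l) (suc k)) (0≼exp (- kl)) p^≼ (≃⇒≼ (exp-^ l (suc k))) ⟩
        exp (- kl) * exp kl                          ≈⟨ exp-neg kl ⟩
        1ℝ                                           ∎)) ⟩
    1ℝ * exp (- l)             ≈⟨ *-identityˡ (exp (- l)) ⟩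
    exp (- l)                  ∎
    where
    kl : ℝ
    kl = ℕ→ℝ (suc k) * l

  0≼/ : ∀ {x y} (0<y : 0ℝ < y) → 0ℝ ≼ x → 0ℝ ≼ x / y ⟨ 0<y ⟩
  0≼/ {x} {y} (ε , 0<ε , N , h) 0≼x = nonNegative-* 0≼x (pointwise-≼ {0ℝ} (λ k → ℚₚ.<⇒≤ (ℚₚ.positive⁻¹ _
    {{ℚₚ.1/pos⇒pos (seq y k ℚ.⊔ ε) {{CauchyLemmas.⊔-positive 0<ε (seq y k)}}}})))

  /-* : ∀ {x y} (0<y : 0ℝ < y) → x / y ⟨ 0<y ⟩ * y ≃ x
  /-* {x} {y} 0<y@(ε , 0<ε , N , h) = eventually-≼ {x / y ⟨ 0<y ⟩ * y} {x} (N , λ k N≤k → ℚₚ.≤-reflexive (cancel k N≤k)) ,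
    eventually-≼ {x} {x / y ⟨ 0<y ⟩ * y} (N , λ k N≤k → ℚₚ.≤-reflexive (sym (cancel k N≤k)))
    where
    inverse : ∀ k → N ℕ.≤ k → CauchyLemmas.1/⊔ 0<ε (seq y k) ℚ.* seq y k ≡ 1ℚ
    inverse k N≤k = trans (cong (CauchyLemmas.1/⊔ 0<ε (seq y k) ℚ.*_) (sym (ℚₚ.p≥q⇒p⊔q≡p (subst (ℚ._≤ seq y k) (ℚₚ.+-identityˡ ε) (h k N≤k)))))
      (ℚₚ.*-inverseˡ (seq y k ℚ.⊔ ε) {{CauchyLemmas.⊔-nonZero 0<ε (seq y k)}})
    cancel : ∀ k → N ℕ.≤ k → seq x k ℚ.* CauchyLemmas.1/⊔ 0<ε (seq y k) ℚ.* seq y k ≡ seq x k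
    cancel k N≤k = trans (ℚₚ.*-assoc (seq x k) (CauchyLemmas.1/⊔ 0<ε (seq y k)) (seq y k)) (trans (cong (seq x k ℚ.*_) (inverse k N≤k)) (ℚₚ.*-identityʳ (seq x k)))

  0<⇒0≼ : ∀ {x} → 0ℝ < x → 0ℝ ≼ x
  0<⇒0≼ {x} (ε , 0<ε , N , h) = eventually-≼ {0ℝ} {x} (N , λ k N≤k → ℚₚ.≤-trans (ℚₚ.<⇒≤ 0<ε) (subst (ℚ._≤ seq x k) (ℚₚ.+-identityˡ ε) (h k N≤k)))

∑-↭ : ∀ {xs ys} → xs ↭ ys → ∑ xs ≃ ∑ ys
∑-↭ Perm.refl            = ≃-refl
∑-↭ (Perm.prep x xs↭)    = +-cong ≃-refl (∑-↭ xs↭)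
∑-↭ (Perm.swap {xs} {ys} x y xs↭) = ≃-trans (+-cong ≃-refl (+-cong ≃-refl (∑-↭ xs↭)))
  (pointwise-≃ {x + (y + ∑ ys)} {y + (x + ∑ ys)} (λ k → solve 3 (λ x y z → x :+ (y :+ z) := y :+ (x :+ z)) refl (seq x k) (seq y k) (seq (∑ ys) k)))
∑-↭ (Perm.trans p q)     = ≃-trans (∑-↭ p) (∑-↭ q)

-- Ranking the cut values

module _ {t T : ℝ} (L : ℝ) (0≼t : 0ℝ ≼ t) (0≼T : 0ℝ ≼ T) (Tt≃1 : T * t ≃ 1ℝ) (f : ℕ → ℝ) (N : ℕ → ℕ) where

  Dominated : ℕ → Set
  Dominated w = f w ≼ exp (- ((1ℝ + t) * L)) × f w ≼ exp (- ((1ℝ + t) * ln (N w)))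

  -- The head of a decreasing list bounds all its elements, so that its rank counts them.
  decreasing⇒Decaying : ∀ {ws} → AllPairs ℕ._≥_ ws → All Dominated ws → (∀ w → length (filter (ℕₚ._≤? w) ws) ℕ.< N w) →
    Decaying 0≼t L 0≼T Tt≃1 (map f ws)
  decreasing⇒Decaying [] [] counts = []
  decreasing⇒Decaying {w ∷ ws} (≥ws ∷ decr) ((f≼L , f≼N) ∷ dom) counts = extend f≼L
    (≼-trans f≼N (exp-mono (neg-mono (*-monoˡ (nonNegative-+ (0≼ℕ→ℝ 1) 0≼t) (ln-mono (subst (λ k → suc (suc k) ℕ.≤ N w) (sym (length-map-ws)) rank))))))
    (decreasing⇒Decaying decr dom λ v → ℕₚ.≤-<-trans (shorter v) (counts v))
    where
    length-map-ws : length (map f ws) ≡ length ws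
    length-map-ws = length-map f ws
    rank : length (w ∷ ws) ℕ.< N w
    rank = subst (λ xs → length xs ℕ.< N w) (filter-all (ℕₚ._≤? w) (ℕₚ.≤-refl ∷ ≥ws)) (counts w)
    shorter : ∀ v → length (filter (ℕₚ._≤? v) ws) ℕ.≤ length (filter (ℕₚ._≤? v) (w ∷ ws))
    shorter v with does (w ℕₚ.≤? v)
    ... | true  = ℕₚ.n≤1+n _
    ... | false = ℕₚ.≤-refl

  -- Sorting in decreasing order puts the largest value at the head, as the ranks in `Decaying`
  -- require; sums and counts are invariant under permutation.
  ∑-dominated : ∀ ws → All Dominated ws → (∀ w → length (filter (ℕₚ._≤? w) ws) ℕ.< N w) →
    ∑ (map f ws) ≼ exp (- (t * L)) * (1ℝ + T)
  ∑-dominated ws dom counts = ≼-trans (≃⇒≽ (∑-↭ (map-↭ f (sort-↭ ws)))) (∑-bound 0≼t L 0≼T Tt≃1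
    (decreasing⇒Decaying (Linked⇒AllPairs (flip ℕₚ.≤-trans) (sort-↗ ws)) (All-resp-↭ (↭-sym (sort-↭ ws)) dom)
      (λ w → subst (ℕ._< N w) (sym (↭-length (filter-↭ (ℕₚ._≤? w) (sort-↭ ws)))) (counts w))))
    where
    open Data.List.Sort (decTotalOrder ℕₚ.≤-decTotalOrder) using (sort; sort-↭; sort-↗)
    open import Data.List.Relation.Binary.Permutation.Propositional.Properties using () renaming (map⁺ to map-↭)

-- Replacing the real threshold by an integer

module _ {n m : ℕ} (G : Graph n m) (x : ℝ) {D : Pred (Subset m) 0ℓ} (D? : Decidable D)
  (D⇒ : ∀ F → D F → CutOfValueAtLeastFails G x F) where

  -- Finitely many failing cuts occur as witnesses of D; a is the least of their values.
  threshold : ∀ (Fs : List (Subset m)) → ∃ λ a → (∀ w → w ℕ.≤ m → a ℕ.≤ w → x ≼ ℕ→ℝ w) ×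
    (∀ F → F ∈ Fs → D F → ∃ λ C → a ℕ.≤ value G C × CutFails G C F)
  -- No cut value exceeds `m`, so with the default `suc m` the first condition is vacuous.
  threshold [] = suc m , (λ w w≤m m<w → contradiction w≤m (ℕₚ.<⇒≱ m<w)) , λ F ()
  threshold (F₀ ∷ Fs) with threshold Fs | D? F₀
  ... | a , large , fails | no ¬d = a , large , λ { F (here refl) d → contradiction d ¬d ; F (there F∈) d → fails F F∈ d }
  ... | a , large , fails | yes d₀ with D⇒ F₀ d₀
  ...   | C₀ , x≤C₀ , fails₀ = a ℕ.⊓ value G C₀ , large′ ,
    λ { F (here refl) d → C₀ , ℕₚ.m⊓n≤n a (value G C₀) , fails₀
      ; F (there F∈) d → let C , a≤ , CF = fails F F∈ d in C , ℕₚ.≤-trans (ℕₚ.m⊓n≤m a (value G C₀)) a≤ , CF }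
    where
    large′ : ∀ w → w ℕ.≤ m → a ℕ.⊓ value G C₀ ℕ.≤ w → x ≼ ℕ→ℝ w
    large′ w w≤m ⊓≤w with ℕₚ.⊓-sel a (value G C₀)
    ... | inj₁ eq = large w w≤m (ℕₚ.≤-trans (ℕₚ.≤-reflexive (sym eq)) ⊓≤w)
    ... | inj₂ eq = ≼-trans (wrap x≤C₀) (ℕ→ℝ-mono (ℕₚ.≤-trans (ℕₚ.≤-reflexive (sym eq)) ⊓≤w))

0≼2+ : ∀ {δ} → 0ℝ ≼ δ → 0ℝ ≼ 2ℝ + δ
0≼2+ 0≼δ = nonNegative-+ (0≼ℕ→ℝ 2) 0≼δ

-- Failure probabilities and their sum

module _ {n′ m c′ : ℕ} (G : Graph (suc n′) m) (c≤ : MinCut≥ G (suc c′)) {p δ : ℝ} (0≼p : 0ℝ ≼ p) (p≼1 : p ≼ 1ℝ)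
  (0<δ : 0ℝ < δ) (p^c≼ : p ^ suc c′ ≼ suc n′ ** (- (2ℝ + δ))) (α : ℝ) (1≼α : 1ℝ ≼ α) where

  private
    n c : ℕ
    n = suc n′
    c = suc c′
    -- `T` is the inverse of `t`, `L` is the logarithm of A, and `exp (- λᵖ)` is the c-th root of
    -- n^(-(2 + δ)), which bounds `p`.
    ℓ t T L λᵖ : ℝ
    ℓ = ln n
    t = ℚ→ℝ ½ * δ
    T = 2ℝ / δ ⟨ 0<δ ⟩
    L = 2ℝ * α * ℓ
    λᵖ = (2ℝ + δ) * ℓ * ℚ→ℝ (1/suc c′)

  abstract
    0≼δ : 0ℝ ≼ δ
    0≼δ = 0<⇒0≼ 0<δ

    0≼t : 0ℝ ≼ t
    0≼t = nonNegative-* (ℚ→ℝ-mono (ℚₚ.nonNegative⁻¹ ½)) 0≼δ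

    0≼T : 0ℝ ≼ T
    0≼T = 0≼/ 0<δ (0≼ℕ→ℝ 2)

    Tt≃1 : T * t ≃ 1ℝ
    Tt≃1 = begin-equality
      T * t               ≈⟨ pointwise-≃ {T * t} {T * δ * ℚ→ℝ ½} (λ k → solve 2 (λ T d → T :* (con ½ :* d) := T :* d :* con ½) refl (seq T k) (seq δ k)) ⟩
      T * δ * ℚ→ℝ ½       ≈⟨ *-cong (0≼ℕ→ℝ 2) (ℚ→ℝ-mono (ℚₚ.nonNegative⁻¹ ½)) (/-* 0<δ) ≃-refl ⟩
      2ℝ * ℚ→ℝ ½          ≈⟨ pointwise-≃ {2ℝ * ℚ→ℝ ½} {1ℝ} (λ _ → refl) ⟩
      1ℝ                  ∎

    0≼λ : 0ℝ ≼ λᵖ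
    0≼λ = nonNegative-* (nonNegative-* (0≼2+ 0≼δ) (0≼ln n)) (ℚ→ℝ-mono (0≤1/suc c′))

    cancel-c : ∀ (x : ℚ) → fromℕ c ℚ.* (x ℚ.* 1/suc c′) ≡ x
    cancel-c x = trans (solve 3 (λ f x r → f :* (x :* r) := x :* (f :* r)) refl (fromℕ c) x (1/suc c′))
      (trans (cong (x ℚ.*_) (1/suc-inverse c′)) (ℚₚ.*-identityʳ x))

    p≼exp : p ≼ exp (- λᵖ)
    p≼exp = root≼exp {p} {λᵖ} c′ 0≼p (≼-trans p^c≼ (exp-mono (≃⇒≼ (pointwise-≃ { - (2ℝ + δ) * ℓ} { - (ℕ→ℝ c * λᵖ)}
      (λ k → trans (sym (ℚₚ.neg-distribˡ-* (seq (2ℝ + δ) k) (seq ℓ k))) (cong ℚ.-_ (sym (cancel-c (seq ((2ℝ + δ) * ℓ) k)))))))))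

    p^≼exp : ∀ w → p ^ w ≼ exp (- (ℕ→ℝ w * λᵖ))
    p^≼exp w = ≼-trans (^-mono 0≼p p≼exp w) (≼-trans (≃⇒≼ (exp-^ (- λᵖ) w)) (exp-mono (≃⇒≼
      (pointwise-≃ {ℕ→ℝ w * - λᵖ} { - (ℕ→ℝ w * λᵖ)} (λ k → sym (ℚₚ.neg-distribʳ-* (fromℕ w) (seq λᵖ k)))))))

    -- The exponent for value α c is α c `λᵖ` = α (2 + δ) ln n = (1 + δ/2) (2 α ln n).
    large⇒p^≼ : ∀ w → α * ℕ→ℝ c ≼ ℕ→ℝ w → p ^ w ≼ exp (- ((1ℝ + t) * L))
    large⇒p^≼ w αc≼w = ≼-trans (p^≼exp w) (exp-mono (neg-mono (begin
      (1ℝ + t) * L             ≈⟨ pointwise-≃ {(1ℝ + t) * L} {α * ℕ→ℝ c * λᵖ} (λ k → rearrange (seq δ k) (seq α k) (seq ℓ k)) ⟩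
      α * ℕ→ℝ c * λᵖ           ≲⟨ *-monoʳ 0≼λ αc≼w ⟩
      ℕ→ℝ w * λᵖ               ∎)))
      where
      rearrange : ∀ d a l → (1ℚ ℚ.+ ½ ℚ.* d) ℚ.* (fromℕ 2 ℚ.* a ℚ.* l) ≡ a ℚ.* fromℕ c ℚ.* ((fromℕ 2 ℚ.+ d) ℚ.* l ℚ.* 1/suc c′)
      rearrange d a l = trans (solve 3 (λ d a l → (con 1ℚ :+ con ½ :* d) :* (con (fromℕ 2) :* a :* l) := a :* ((con (fromℕ 2) :+ d) :* l)) refl d a l)
        (trans (cong (a ℚ.*_) (sym (cancel-c ((fromℕ 2 ℚ.+ d) ℚ.* l)))) (sym (ℚₚ.*-assoc a (fromℕ c) _)))

    -- The counting bound gives c ln N ≤ 2 w ln n, and 2 (1 + δ/2) = 2 + δ: the 2 in the exponent of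
    -- the hypothesis on `p ^ c` pays for the number of cuts.
    rank⇒p^≼ : ∀ w N .{{_ : ℕ.NonZero N}} → N ℕ.^ c ℕ.≤ n ℕ.^ (2 ℕ.* w) → p ^ w ≼ exp (- ((1ℝ + t) * ln N))
    rank⇒p^≼ w N@(suc N′) N^c≤ = ≼-trans (p^≼exp w) (exp-mono (neg-mono (begin
      (1ℝ + t) * ln N
        ≈⟨ pointwise-≃ {(1ℝ + t) * ln N} {(1ℝ + t) * (ℕ→ℝ c * (ln N * ℚ→ℝ (1/suc c′)))} (λ k → cong ((1ℚ ℚ.+ ½ ℚ.* seq δ k) ℚ.*_) (sym (cancel-c (seq (ln N) k)))) ⟩
      (1ℝ + t) * (ℕ→ℝ c * (ln N * ℚ→ℝ (1/suc c′)))
        ≈⟨ pointwise-≃ {(1ℝ + t) * (ℕ→ℝ c * (ln N * r))} {(1ℝ + t) * (ℕ→ℝ c * ln N * r)} (λ k → cong ((1ℚ ℚ.+ ½ ℚ.* seq δ k) ℚ.*_) (sym (ℚₚ.*-assoc (fromℕ c) (seq (ln N) k) (1/suc c′)))) ⟩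
      (1ℝ + t) * (ℕ→ℝ c * ln N * r)
        ≲⟨ *-monoˡ (nonNegative-+ (0≼ℕ→ℝ 1) 0≼t) (*-monoʳ (ℚ→ℝ-mono (0≤1/suc c′)) (begin
             ℕ→ℝ c * ln N              ≈⟨ ln-^ N′ c ⟨
             ln (N ℕ.^ c)              ≲⟨ ln-mono N^c≤ ⟩
             ln (n ℕ.^ (2 ℕ.* w))      ≈⟨ ln-^ n′ (2 ℕ.* w) ⟩
             ℕ→ℝ (2 ℕ.* w) * ℓ         ∎)) ⟩
      (1ℝ + t) * (ℕ→ℝ (2 ℕ.* w) * ℓ * r)
        ≈⟨ pointwise-≃ {(1ℝ + t) * (ℕ→ℝ (2 ℕ.* w) * ℓ * r)} {ℕ→ℝ w * λᵖ} (λ k → rearrange (seq δ k) (seq ℓ k)) ⟩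
      ℕ→ℝ w * λᵖ ∎)))
      where
      r : ℝ
      r = ℚ→ℝ (1/suc c′)
      rearrange : ∀ d l → (1ℚ ℚ.+ ½ ℚ.* d) ℚ.* (fromℕ (2 ℕ.* w) ℚ.* l ℚ.* 1/suc c′) ≡ fromℕ w ℚ.* ((fromℕ 2 ℚ.+ d) ℚ.* l ℚ.* 1/suc c′)
      rearrange d l = trans (cong (λ z → (1ℚ ℚ.+ ½ ℚ.* d) ℚ.* (z ℚ.* l ℚ.* 1/suc c′)) (fromℕ-* 2 w))
        (solve 4 (λ d l w r → (con 1ℚ :+ con ½ :* d) :* (con (fromℕ 2) :* w :* l :* r) := w :* ((con (fromℕ 2) :+ d) :* l :* r)) refl d l (fromℕ w) (1/suc c′))

    -- A threshold of zero would admit the trivial bipartition, whose value is 0. It is excluded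
    -- because α c is at least c, which is positive.
    threshold-positive : ∀ a → (∀ w → w ℕ.≤ m → a ℕ.≤ w → α * ℕ→ℝ c ≼ ℕ→ℝ w) → 0 ℕ.< a
    threshold-positive (suc a) _     = s≤s z≤n
    threshold-positive zero    large = contradiction (ℕ→ℝ-cancel-≼ {c} {0} (begin
      ℕ→ℝ c          ≈⟨ *-identityˡ (ℕ→ℝ c) ⟨
      1ℝ * ℕ→ℝ c     ≲⟨ *-monoʳ (0≼ℕ→ℝ c) 1≼α ⟩
      α * ℕ→ℝ c      ≲⟨ large 0 z≤n z≤n ⟩
      ℕ→ℝ 0          ∎)) (λ ())

    failure-bound : ∀ {D : Pred (Subset m) 0ℓ} (D? : Decidable D) → (∀ F → D F → CutOfValueAtLeastFails G (α * ℕ→ℝ c) F) →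
      Pr p D? ≼ n ** (- (α * δ)) * (1ℝ + T)
    failure-bound {D} D? D⇒ = go (threshold G (α * ℕ→ℝ c) D? D⇒ (subsets m))
      where
      go : (∃ λ a → (∀ w → w ℕ.≤ m → a ℕ.≤ w → α * ℕ→ℝ c ≼ ℕ→ℝ w) ×
        (∀ F → F ∈ subsets m → D F → ∃ λ C → a ℕ.≤ value G C × CutFails G C F)) → Pr p D? ≼ n ** (- (α * δ)) * (1ℝ + T)
      go (a , large , fails) = begin
        Pr p D?                                 ≲⟨ union-bound G 0≼p p≼1 a D? (λ F → fails F (∈-subsets F)) ⟩
        ∑ (map (p ^_) (largeValues G a))        ≲⟨ ∑-dominated L 0≼t 0≼T Tt≃1 (p ^_) N (largeValues G a) dominated (largeValues-count G 0<a) ⟩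
        exp (- (t * L)) * (1ℝ + T)              ≲⟨ *-monoʳ (nonNegative-+ (0≼ℕ→ℝ 1) 0≼T) (exp-mono (≃⇒≼ (pointwise-≃ { - (t * L)} { - (α * δ) * ℓ}
                                                     (λ k → solve 3 (λ a d l → :- (con ½ :* d :* (con (fromℕ 2) :* a :* l)) := (:- (a :* d)) :* l) refl (seq α k) (seq δ k) (seq ℓ k))))) ⟩
        n ** (- (α * δ)) * (1ℝ + T)             ∎
        where
        N : ℕ → ℕ
        N = smallBipartitions G
        0<a : 0 ℕ.< a
        0<a = threshold-positive a large
        dominates : ∀ S → a ℕ.≤ bipartitionValue G S → Dominated L 0≼t 0≼T Tt≃1 (p ^_) N (bipartitionValue G S)
        dominates S a≤w = large⇒p^≼ w (large w (∣p∣≤n (crossing G (inside ∷ S))) a≤w) ,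
          rank⇒p^≼ w (N w) {{ℕ.>-nonZero (ℕₚ.≤-<-trans z≤n (largeValues-count G 0<a w))}}
            (smallBipartitions-bound c w {{_}} {{ℕ.>-nonZero (ℕₚ.<-≤-trans 0<a a≤w)}} G c≤)
          where
          w : ℕ
          w = bipartitionValue G S
        dominated : All (Dominated L 0≼t 0≼T Tt≃1 (p ^_) N) (largeValues G a)
        dominated = map⁺ (All.map (λ {S} → dominates S) (all-filter (λ S → a ℕₚ.≤? bipartitionValue G S) (subsets n′)))

-- Degenerate cases and the conclusion

abstract
  -- Refutes c = 0, where `p ^ 0` is 1. For n ≥ 2 the logarithm is at least 1/2, so (2 + δ) ln n is
  -- at least 1 and its exponential at least 2.
  1⋠**-[2+δ] : ∀ {δ} r → 0ℝ ≼ δ → ¬ (1ℝ ≼ suc (suc r) ** (- (2ℝ + δ)))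
  1⋠**-[2+δ] {δ} r 0≼δ 1≼ = contradiction (ℕ→ℝ-cancel-≼ {2} {1} (begin
    ℕ→ℝ 2                                 ≲⟨ pointwise-≼ {ℕ→ℝ 2} {1ℝ + 2ℝ * ℚ→ℝ (1/suc 1)} (λ _ → ℚₚ.≤-refl) ⟩
    1ℝ + 2ℝ * ℚ→ℝ (1/suc 1)               ≲⟨ +-mono ≼-refl (*-monoᵇ (ℚ→ℝ-mono (0≤1/suc 1)) (0≼2+ 0≼δ) 2≼2+δ ½≼ℓ) ⟩
    1ℝ + y                                ≲⟨ 1+≼exp (nonNegative-* (0≼2+ 0≼δ) (0≼ln (suc (suc r)))) ⟩
    exp y                                 ≈⟨ *-identityˡ (exp y) ⟨
    1ℝ * exp y                            ≲⟨ *-monoʳ (0≼exp y) (≼-trans 1≼ (exp-mono (≃⇒≼ (pointwise-≃ { - (2ℝ + δ) * ℓ} { - y} (λ k → sym (ℚₚ.neg-distribˡ-* (seq (2ℝ + δ) k) (seq ℓ k))))))) ⟩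
    exp (- y) * exp y                     ≈⟨ exp-neg y ⟩
    ℕ→ℝ 1                                 ∎)) (λ { (s≤s ()) })
    where
    ℓ y : ℝ
    ℓ = ln (suc (suc r))
    y = (2ℝ + δ) * ℓ
    2≼2+δ : 2ℝ ≼ 2ℝ + δ
    2≼2+δ = ≼+ʳ 0≼δ
    ½≼ℓ : ℚ→ℝ (1/suc 1) ≼ ℓ
    ½≼ℓ = ≼-trans (≼+ˡ (0≼ln 1)) (≼-trans (ln-suc 0) (ln-mono (s≤s (s≤s z≤n))))

disconnected⇒cutFails : ∀ {n m} (G : Graph (suc n) m) F → Disconnected G F → ∃ λ C → CutFails G C F
disconnected⇒cutFails G F disconnected with failing-cut-or-reachable G F zero
... | inj₁ cut   = cut
... | inj₂ reach = contradiction (λ u v → EqClosure.symmetric _ (reach u) ◅◅ reach v) disconnected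

no-cut-of-one-vertex : ¬ Cut 1
no-cut-of-one-vertex C with Cut.nonempty C | Cut.nonempty′ C
... | zero , ∈S | zero , ∈∁S = x∈∁p⇒x∉p ∈∁S ∈S

theorem2p9 : (n m : ℕ) (G : Graph n m) (c : ℕ) → IsMinCutValue G c →
    (p δ : ℝ) → 0ℝ ≤ p → p ≤ 1ℝ → (0<δ : 0ℝ < δ) →
    p ^ c ≈ n ** (- (2ℝ + δ)) →
    Pr p (disconnected? G) ≤ n ** (- δ) * (1ℝ + 2ℝ / δ ⟨ 0<δ ⟩)
    ×
    ((α : ℝ) → 1ℝ ≤ α →
    PrAtMost p (CutOfValueAtLeastFails G (α * ℕ→ℝ c))
    (n ** (- (α * δ)) * (1ℝ + 2ℝ / δ ⟨ 0<δ ⟩)))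
theorem2p9 zero          m G c       ((C , _) , _) with () ← proj₁ (Cut.nonempty C)
theorem2p9 (suc zero)    m G c       ((C , _) , _) = contradiction C no-cut-of-one-vertex
theorem2p9 (suc (suc r)) m G zero    _ p δ _ _ 0<δ p^0≈ = contradiction (≃⇒≼ (≈⇒≃ {p ^ 0} {suc (suc r) ** (- (2ℝ + δ))} p^0≈)) (1⋠**-[2+δ] r (0<⇒0≼ 0<δ))
theorem2p9 n@(suc (suc _)) m G c@(suc _) (_ , c≤) p δ 0≤p p≤1 0<δ p^c≈ = part₁ , λ α 1≤α D? D⇒ → unwrap (part₂ α (wrap 1≤α) D? D⇒)
  where
  b : ℝ
  b = 1ℝ + 2ℝ / δ ⟨ 0<δ ⟩
  part₂ : ∀ α → 1ℝ ≼ α → ∀ {D : Pred (Subset m) 0ℓ} (D? : Decidable D) → (∀ F → D F → CutOfValueAtLeastFails G (α * ℕ→ℝ c) F) →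
    Pr p D? ≼ n ** (- (α * δ)) * b
  part₂ α 1≼α = failure-bound G c≤ (wrap 0≤p) (wrap p≤1) 0<δ (≃⇒≼ (≈⇒≃ {p ^ c} {n ** (- (2ℝ + δ))} p^c≈)) α 1≼α
  part₁ : Pr p (disconnected? G) ≤ n ** (- δ) * b
  part₁ = unwrap (≼-trans
    (part₂ 1ℝ ≼-refl (disconnected? G) (λ F disconnected → let C , fails = disconnected⇒cutFails G F disconnected in
      C , unwrap (≼-trans (≃⇒≼ (*-identityˡ (ℕ→ℝ c))) (ℕ→ℝ-mono (c≤ C))) , fails))
    (*-monoʳ (nonNegative-+ (0≼ℕ→ℝ 1) (0≼/ 0<δ (0≼ℕ→ℝ 2)))
      (exp-mono (≃⇒≼ (pointwise-≃ { - (1ℝ * δ) * ln n} { - δ * ln n} (λ k → cong (λ d → ℚ.- d ℚ.* seq (ln n) k) (ℚₚ.*-identityˡ (seq δ k))))))))
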